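{- Let $q=4$ or $q=6$, set $\widetilde{q}:=(q-2)/q$, let $x$ be a variable (or a complex number), and for $k\ge 0$ let $$b_k^{(1)}:=\frac{1}{k+1}B_{k+1,\chi_{2q,1}}(x),\qquad b_k^{(2)}:=\frac{1}{k+1}B_{k+1,\chi_{2q,2}}(x),$$ where the characters $\chi_{2q,1},\chi_{2q,2}$ modulo $2q$ are those specified in the context. Then for all integers $m\geq 0$ we have $H_{2m}\big(b_k^{(1)}\big)=0$, and $$H_{2m+1}\big(b_k^{(1)}\big)=(-1)^{m+1}\left(\frac{q-2}{2}q^{2m}\right)^{2m+2}\prod_{\ell=1}^m\left(\frac{\ell^2}{4}\left(\widetilde{q}^{\,2}-(2\ell)^2\right)\right)^{2(m+1-\ell)},$$ $$H_{2m}\big(b_k^{(2)}\big)=(-1)^{m+1}\frac{q^{2m(2m+1)}}{m!^2}\prod_{\ell=1}^m\left(\frac{\ell^2}{4}\left(\widetilde{q}^{\,2}-(2\ell-1)^2\right)\right)^{2(m+1-\ell)},$$ $$H_{2m+1}\big(b_k^{(2)}\big)=\left(\frac{1}{2}q^{2m+1}\right)^{2m+2}\prod_{\ell=0}^m\frac{\ell!^4}{16^\ell}\left(\widetilde{q}^{\,2}-(2\ell+1)^2\right)^{2(m-\ell)+1}.$$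
   Context: For a Dirichlet character $\chi$ modulo $N$, the generalized Bernoulli numbers and polynomials (taken with respect to the modulus $N$) are defined by $\sum_{a=1}^N\frac{\chi(a)te^{at}}{e^{Nt}-1}=\sum_{n\ge 0}B_{n,\chi}\frac{t^n}{n!}$ and $B_{n,\chi}(x)=\sum_{k=0}^n\binom{n}{k}B_{k,\chi}x^{n-k}$. The characters are: modulo 8, $\chi_{8,1}$ takes the values $1,-1,-1,1$ and $\chi_{8,2}$ the values $1,1,-1,-1$ at $1,3,5,7$ respectively; modulo 12, $\chi_{12,1}$ takes the values $1,-1,-1,1$ and $\chi_{12,2}$ the values $1,1,-1,-1$ at $1,5,7,11$ respectively; all are $0$ at residues not coprime to the modulus. The character $\chi_{12,2}$ is not primitive; it is regarded as a character modulo $12$, so $N=12$ is used in the definition above. For a sequence $(c_0,c_1,\ldots)$ (indexed from $k=0$), $H_n(c_k)=\det\big(c_{i+j}\big)_{0\le i,j\le n}$. Here $m!^2=(m!)^2$, $\ell!^4=(\ell!)^4$, and empty products equal $1$. -}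

module Defs where

open import Algebra.Bundles using (CommutativeRing)
import Algebra.Properties.CommutativeMonoid.Sum as Sum
import Algebra.Properties.Semiring.Exp as Exp
open import Data.Fin using (Fin; zero; suc; toℕ; fromℕ<; punchIn)
open import Data.Fin.Properties using (all?; toℕ-fromℕ<)
open import Data.Integer as ℤ using (ℤ; +_; 0ℤ; 1ℤ; -1ℤ)
import Data.Integer.Properties as ℤ
open import Data.Nat as ℕ using (ℕ; zero; suc; NonZero; _!; _%_)
open import Data.Nat.Combinatorics using (_C_)
open import Data.Nat.Coprimality using (Coprime; coprime?)
open import Data.Nat.DivMod using (m%n<n; [m+n]%n≡m%n; %-distribˡ-*)
open import Data.Nat.Divisibility using (∣n∣m%n⇒∣m; %-presˡ-∣)
import Data.Nat.Properties as ℕ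
open import Data.Product using (_,_)
open import Data.Rational as ℚ using (ℚ; 0ℚ; 1ℚ; _/_; 1/_)
import Data.Rational.Properties as ℚ
open import Data.Rational.Unnormalised as ℚᵘ using (mkℚᵘ)
import Data.Rational.Unnormalised.Properties as ℚᵘ
open import Data.Sum using (_⊎_; inj₁; inj₂)
open import Function using (_∘_; _⇔_; mk⇔)
open import Relation.Binary.PropositionalEquality
open import Relation.Nullary using (¬_)
open import Relation.Nullary.Decidable using (True; toWitness; ¬?; _→-dec_)

infixr 8 _^_
_^_ : ℚ → ℕ → ℚ
_^_ = Exp._^_ (CommutativeRing.semiring ℚ.+-*-commutativeRing)

∑ : ∀ n → (Fin n → ℚ) → ℚ
∑ n = Sum.sum ℚ.+-0-commutativeMonoid {n}

fromℕ : ℕ → ℚ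
fromℕ n = + n / 1

fromℤ : ℤ → ℚ
fromℤ i = i / 1

1/! : ℕ → ℚ
1/! n = (+ 1 / (n !)) {{ℕ._!≢0 n}}

-- ∏[ ℓ ∈ a ⋯ b ] f ranges over a ≤ ℓ ≤ b and is 1ℚ when b < a.
∏-range : ℕ → ℕ → (ℕ → ℚ) → ℚ
∏-range a b f = Sum.sum ℚ.*-1-commutativeMonoid {suc b ℕ.∸ a} (λ i → f (a ℕ.+ toℕ i))

infixl 10 ∏-range
syntax ∏-range a b (λ ℓ → e) = ∏[ ℓ ∈ a ⋯ b ] e

-- The characters needed here are real, so values are taken in ℤ.
record DirichletCharacter (N : ℕ) : Set where
  field
    {{modulus≢0}}  : NonZero N
    value          : ℕ → ℤ
    periodic       : ∀ a → value (a ℕ.+ N) ≡ value a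
    multiplicative : ∀ a b → value (a ℕ.* b) ≡ value a ℤ.* value b
    normalized     : value 1 ≡ 1ℤ
    support        : ∀ a → (¬ value a ≡ 0ℤ) ⇔ Coprime a N

-- Extends t periodically; only its values at 0, …, N − 1 matter.
fromTable : ∀ N .{{_ : NonZero N}} (t : ℕ → ℤ) →
  True (all? {n = N} λ i → all? {n = N} λ j →
    t ((toℕ i ℕ.* toℕ j) % N) ℤ.≟ t (toℕ i) ℤ.* t (toℕ j)) →
  True (t (1 % N) ℤ.≟ 1ℤ) →
  True (all? {n = N} λ i → ¬? (t (toℕ i) ℤ.≟ 0ℤ) →-dec coprime? (toℕ i) N) →
  True (all? {n = N} λ i → coprime? (toℕ i) N →-dec ¬? (t (toℕ i) ℤ.≟ 0ℤ)) →
  DirichletCharacter N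
fromTable N@(suc _) t mul one supp⇒ supp⇐ = record
  { value          = χ
  ; periodic       = λ a → cong t ([m+n]%n≡m%n a N)
  ; multiplicative = λ a b → trans (cong t (%-distribˡ-* a b N))
      (subst₂ (λ r s → t ((r ℕ.* s) % N) ≡ t r ℤ.* t s) (residue-toℕ a) (residue-toℕ b)
        (toWitness mul (residue a) (residue b)))
  ; normalized     = toWitness one
  ; support        = λ a → mk⇔ (support⇒ a) (support⇐ a)
  }
  where
  χ : ℕ → ℤ
  χ a = t (a % N)

  residue : ℕ → Fin N
  residue a = fromℕ< (m%n<n a N)

  residue-toℕ : ∀ a → toℕ (residue a) ≡ a % N
  residue-toℕ a = toℕ-fromℕ< (m%n<n a N)

  support⇒ : ∀ a → ¬ χ a ≡ 0ℤ → Coprime a N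
  support⇒ a χa≢0 {d} (d∣a , d∣N) =
    subst (λ r → ¬ t r ≡ 0ℤ → Coprime r N) (residue-toℕ a)
      (toWitness supp⇒ (residue a)) χa≢0 {d} (%-presˡ-∣ d∣a d∣N , d∣N)

  support⇐ : ∀ a → Coprime a N → ¬ χ a ≡ 0ℤ
  support⇐ a a⊥N =
    subst (λ r → Coprime r N → ¬ t r ≡ 0ℤ) (residue-toℕ a)
      (toWitness supp⇐ (residue a))
      (λ {d} (d∣r , d∣N) → a⊥N {d} (∣n∣m%n⇒∣m d∣N d∣r , d∣N))

table₈,₁ table₈,₂ table₁₂,₁ table₁₂,₂ : ℕ → ℤ

table₈,₁ 1 = 1ℤ
table₈,₁ 3 = -1ℤ
table₈,₁ 5 = -1ℤ
table₈,₁ 7 = 1ℤ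
table₈,₁ _ = 0ℤ

table₈,₂ 1 = 1ℤ
table₈,₂ 3 = 1ℤ
table₈,₂ 5 = -1ℤ
table₈,₂ 7 = -1ℤ
table₈,₂ _ = 0ℤ

table₁₂,₁ 1  = 1ℤ
table₁₂,₁ 5  = -1ℤ
table₁₂,₁ 7  = -1ℤ
table₁₂,₁ 11 = 1ℤ
table₁₂,₁ _  = 0ℤ

table₁₂,₂ 1  = 1ℤ
table₁₂,₂ 5  = 1ℤ
table₁₂,₂ 7  = -1ℤ
table₁₂,₂ 11 = -1ℤ
table₁₂,₂ _  = 0ℤ

χ₈,₁ χ₈,₂ : DirichletCharacter 8
χ₈,₁ = fromTable 8 table₈,₁ _ _ _ _
χ₈,₂ = fromTable 8 table₈,₂ _ _ _ _

χ₁₂,₁ χ₁₂,₂ : DirichletCharacter 12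
χ₁₂,₁ = fromTable 12 table₁₂,₁ _ _ _ _
χ₁₂,₂ = fromTable 12 table₁₂,₂ _ _ _ _

χ₂q,₁ χ₂q,₂ : ∀ {q} → q ≡ 4 ⊎ q ≡ 6 → DirichletCharacter (2 ℕ.* q)
χ₂q,₁ (inj₁ refl) = χ₈,₁
χ₂q,₁ (inj₂ refl) = χ₁₂,₁
χ₂q,₂ (inj₁ refl) = χ₈,₂
χ₂q,₂ (inj₂ refl) = χ₁₂,₂

-- Formal power series as coefficient sequences.
Series : Set
Series = ℕ → ℚ

infixl 7 _⊛_
_⊛_ : Series → Series → Series
(f ⊛ g) n = ∑ (suc n) λ k → f (toℕ k) ℚ.* g (n ℕ.∸ toℕ k)

-- Long division: f/g = h + t · (((f − h g)/t)/g) with h = f 0 / g 0.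
quotient : (f g : Series) .{{_ : ℚ.NonZero (g 0)}} → Series
quotient f g zero    = f 0 ℚ.* 1/ g 0
quotient f g (suc n) =
  quotient (λ k → f (suc k) ℚ.- (f 0 ℚ.* 1/ g 0) ℚ.* g (suc k)) g n

quotient-⊛ : ∀ f g .{{_ : ℚ.NonZero (g 0)}} n → (quotient f g ⊛ g) n ≡ f n
quotient-⊛ f g zero = begin
  (f 0 ℚ.* 1/ g 0) ℚ.* g 0 ℚ.+ 0ℚ ≡⟨ ℚ.+-identityʳ _ ⟩
  (f 0 ℚ.* 1/ g 0) ℚ.* g 0        ≡⟨ ℚ.*-assoc (f 0) (1/ g 0) (g 0) ⟩
  f 0 ℚ.* (1/ g 0 ℚ.* g 0)        ≡⟨ cong (f 0 ℚ.*_) (ℚ.*-inverseˡ (g 0)) ⟩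
  f 0 ℚ.* 1ℚ                      ≡⟨ ℚ.*-identityʳ (f 0) ⟩
  f 0                             ∎
  where open ≡-Reasoning
quotient-⊛ f g (suc n) = begin
  h ℚ.* g (suc n) ℚ.+ (quotient f′ g ⊛ g) n              ≡⟨ cong (h ℚ.* g (suc n) ℚ.+_) (quotient-⊛ f′ g n) ⟩
  h ℚ.* g (suc n) ℚ.+ (f (suc n) ℚ.- h ℚ.* g (suc n))    ≡⟨ ℚ.+-comm (h ℚ.* g (suc n)) _ ⟩
  (f (suc n) ℚ.- h ℚ.* g (suc n)) ℚ.+ h ℚ.* g (suc n)    ≡⟨ ℚ.+-assoc (f (suc n)) _ _ ⟩
  f (suc n) ℚ.+ (ℚ.- (h ℚ.* g (suc n)) ℚ.+ h ℚ.* g (suc n)) ≡⟨ cong (f (suc n) ℚ.+_) (ℚ.+-inverseˡ (h ℚ.* g (suc n))) ⟩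
  f (suc n) ℚ.+ 0ℚ                                       ≡⟨ ℚ.+-identityʳ (f (suc n)) ⟩
  f (suc n)                                              ∎
  where
  open ≡-Reasoning
  h = f 0 ℚ.* 1/ g 0
  f′ : Series
  f′ k = f (suc k) ℚ.- h ℚ.* g (suc k)

exp : ℕ → Series
exp a n = fromℕ (a ℕ.^ n) ℚ.* 1/! n

t·_ : Series → Series
(t· f) zero    = 0ℚ
(t· f) (suc n) = f n

-- (e^{Nt} − 1) / t
expm1/t : ℕ → Series
expm1/t N n = exp N (suc n)

expm1 : ℕ → Series
expm1 N zero    = exp N 0 ℚ.- 1ℚ
expm1 N (suc n) = exp N (suc n)

expm1/t-nonZero : ∀ N .{{_ : NonZero N}} → ℚ.NonZero (expm1/t N 0)
expm1/t-nonZero N@(suc _) =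
  subst ℚ.NonZero (sym (trans (ℚ.*-identityʳ _) (cong fromℕ (ℕ.^-identityʳ N))))
    (ℚ.pos⇒nonZero (fromℕ N) {{ℚ.normalize-pos N 1}})

-- Σ_{a=1}^{N} χ(a) e^{at}
twistedExp : ∀ {N} → DirichletCharacter N → Series
twistedExp {N} χ n = ∑ N λ i →
  fromℤ (DirichletCharacter.value χ (suc (toℕ i))) ℚ.* exp (suc (toℕ i)) n

-- n! times the coefficient of tⁿ in Σ_a χ(a) t e^{at} / (e^{Nt} − 1); the
-- factor t is cancelled so that the denominator is invertible.
genBernoulli : ∀ {N} → DirichletCharacter N → ℕ → ℚ
genBernoulli {N} χ n =
  fromℕ (n !) ℚ.* quotient (twistedExp χ) (expm1/t N) {{expm1/t-nonZero N}} n
  where open DirichletCharacter χ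

fromℕ-*-recip : ∀ d .{{_ : NonZero d}} → fromℕ d ℚ.* (+ 1 / d) ≡ 1ℚ
fromℕ-*-recip d@(suc d-1) = ℚ.toℚᵘ-injective (begin
  ℚ.toℚᵘ (fromℕ d ℚ.* (+ 1 / d))             ≈⟨ ℚ.toℚᵘ-homo-* (fromℕ d) (+ 1 / d) ⟩
  ℚ.toℚᵘ (fromℕ d) ℚᵘ.* ℚ.toℚᵘ (+ 1 / d)     ≈⟨ ℚᵘ.*-cong (ℚ.toℚᵘ-fromℚᵘ (mkℚᵘ (+ d) 0)) (ℚ.toℚᵘ-fromℚᵘ (mkℚᵘ (+ 1) d-1)) ⟩
  mkℚᵘ (+ d) 0 ℚᵘ.* mkℚᵘ (+ 1) d-1           ≈⟨ ℚᵘ.*-inverseʳ (mkℚᵘ (+ d) 0) ⟩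
  ℚ.toℚᵘ 1ℚ                                  ∎)
  where open ℚᵘ.≃-Reasoning

⊛-suc : ∀ f g → g 0 ≡ 0ℚ → ∀ n → (f ⊛ g) (suc n) ≡ (f ⊛ (g ∘ suc)) n
⊛-suc f g g0≡0 zero    = cong (f 0 ℚ.* g 1 ℚ.+_)
  (trans (ℚ.+-identityʳ _) (trans (cong (f 1 ℚ.*_) g0≡0) (ℚ.*-zeroʳ (f 1))))
⊛-suc f g g0≡0 (suc n) = cong (f 0 ℚ.* g (suc (suc n)) ℚ.+_) (⊛-suc (f ∘ suc) g g0≡0 n)

⊛-congˡ : ∀ {f f′} g → (∀ n → f n ≡ f′ n) → ∀ n → (f ⊛ g) n ≡ (f′ ⊛ g) n
⊛-congˡ g f≗f′ zero    = cong (λ y → y ℚ.* g 0 ℚ.+ 0ℚ) (f≗f′ 0)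
⊛-congˡ g f≗f′ (suc n) =
  cong₂ (λ y z → y ℚ.* g (suc n) ℚ.+ z) (f≗f′ 0) (⊛-congˡ g (f≗f′ ∘ suc) n)

-- The defining generating function identity, denominator multiplied out.
genBernoulli-egf : ∀ {N} (χ : DirichletCharacter N) n →
  ((λ k → genBernoulli χ k ℚ.* 1/! k) ⊛ expm1 N) n ≡ (t· twistedExp χ) n
genBernoulli-egf {N} χ zero    =
  trans (ℚ.+-identityʳ _) (ℚ.*-zeroʳ (genBernoulli χ 0 ℚ.* 1/! 0))
genBernoulli-egf {N} χ (suc n) = begin
  (egf ⊛ expm1 N) (suc n)  ≡⟨ ⊛-suc egf (expm1 N) refl n ⟩
  (egf ⊛ expm1/t N) n      ≡⟨ ⊛-congˡ (expm1/t N) egf≗quotient n ⟩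
  (quotient (twistedExp χ) (expm1/t N) ⊛ expm1/t N) n
                           ≡⟨ quotient-⊛ (twistedExp χ) (expm1/t N) n ⟩
  twistedExp χ n           ∎
  where
  open DirichletCharacter χ using (modulus≢0)
  open ≡-Reasoning
  instance _ = expm1/t-nonZero N

  egf : Series
  egf k = genBernoulli χ k ℚ.* 1/! k

  egf≗quotient : ∀ k → egf k ≡ quotient (twistedExp χ) (expm1/t N) k
  egf≗quotient k = begin
    (fromℕ (k !) ℚ.* y) ℚ.* 1/! k  ≡⟨ cong (ℚ._* 1/! k) (ℚ.*-comm (fromℕ (k !)) y) ⟩
    (y ℚ.* fromℕ (k !)) ℚ.* 1/! k  ≡⟨ ℚ.*-assoc y (fromℕ (k !)) (1/! k) ⟩
    y ℚ.* (fromℕ (k !) ℚ.* 1/! k)  ≡⟨ cong (y ℚ.*_) (fromℕ-*-recip (k !) {{ℕ._!≢0 k}}) ⟩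
    y ℚ.* 1ℚ                        ≡⟨ ℚ.*-identityʳ y ⟩
    y                               ∎
    where y = quotient (twistedExp χ) (expm1/t N) k

module _ {c ℓ} (R : CommutativeRing c ℓ) where
  open CommutativeRing R hiding (zero)
  open Exp semiring using () renaming (_^_ to _^ᴿ_)
  open Sum +-commutativeMonoid using (sum)

  -- Laplace expansion along the first row.
  det : ∀ n → (Fin n → Fin n → Carrier) → Carrier
  det zero    M = 1#
  det (suc n) M = sum λ j →
    (- 1#) ^ᴿ toℕ j * M zero j * det n (λ i k → M (suc i) (punchIn j k))

  hankel : ℕ → (ℕ → Carrier) → Carrier
  hankel n s = det (suc n) λ i j → s (toℕ i ℕ.+ toℕ j)

  -- ι is meant to be the structure map of a ℚ-algebra.
  module _ (ι : ℚ → Carrier) where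

    genBernoulliPoly : ∀ {N} → DirichletCharacter N → ℕ → Carrier → Carrier
    genBernoulliPoly χ n x = sum {suc n} λ k →
      ι (fromℕ (n C toℕ k)) * ι (genBernoulli χ (toℕ k)) * x ^ᴿ (n ℕ.∸ toℕ k)

    shiftedBernoulli : ∀ {N} → DirichletCharacter N → Carrier → ℕ → Carrier
    shiftedBernoulli χ x k = ι (+ 1 / suc k) * genBernoulliPoly χ (suc k) x

{-# OPTIONS --safe #-}

-- Put q = 2h and s = (q − 2)/2.  After cancelling e^{qt} − 1, the sequence b_k at x = 0 has
-- exponential generating function sinh(st)/cosh(ht) for χ_{2q,1} and −cosh(st)/cosh(ht) for
-- χ_{2q,2}; a general x only multiplies it by e^{xt}.  Let L be the functional on polynomials
-- with L(y^k) = b_k at x = 0.  Since L(p(y + h) + p(y − h)) is a combination of p(s) and p(−s),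
-- L can be evaluated on the products ∏ (y² − c_i²), c_i = c_0 + 2hi.  The monic continuous dual
-- Hahn polynomials P_m in y² are weighted m-th differences of these products, which gives
-- L(P_m) = 0 (L(y P_m) = 0 for χ_{2q,1}) for m ≥ 1; orthogonality follows by their three-term
-- recurrence in y².  Column operations turn the Hankel matrix into (L((y + x)^i Q_j)) with Q_j
-- monic of degree j, which is block lower triangular with blocks of size 2 (size 1 does not
-- suffice for χ_{2q,1}, where every other leading minor vanishes).
module Submission where

open import Defs
open import Algebra.Bundles using (CommutativeMonoid; CommutativeRing)
open import Algebra.Morphism.Structures using (IsRingHomomorphism)
import Algebra.Properties.CommutativeMonoid.Sum as Sum
import Algebra.Properties.CommutativeSemiring.Exp as CommutativeExp
import Algebra.Properties.Ring as RingProperties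
import Algebra.Properties.Semiring.Exp as Exp
import Algebra.Properties.Semiring.Sum as SemiringSum
import Algebra.Solver.Ring.NaturalCoefficients.Default as SemiringSolver
open import Data.Empty using (⊥-elim)
open import Data.Fin as Fin using (Fin; toℕ; punchIn)
open import Data.Fin.Properties using (toℕ<n)
open import Data.Integer as ℤ using (+_)
import Data.Integer.Properties as ℤ
open import Data.Nat as ℕ using (ℕ; zero; suc; z≤n; s≤s; z<s; s<s; s≤s⁻¹; s<s⁻¹; _!)
open import Data.Nat.DivMod using (m/n*n≡m)
open import Data.Nat.Induction using (<-rec)
import Data.Nat.Properties as ℕ
import Data.Nat.Tactic.RingSolver as ℕSolver
open import Data.Product using (∃; _×_; _,_)
open import Data.Rational as ℚ using (ℚ; 0ℚ; 1ℚ; ½; _/_)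
open import Data.Rational.Properties using (+-*-rawRing)
import Data.Rational.Properties as ℚ
open import Data.Rational.Unnormalised as ℚᵘ using (mkℚᵘ; *≡*)
import Data.Rational.Unnormalised.Properties as ℚᵘ
open import Data.Sum using (_⊎_; inj₁; inj₂)
open import Function using (_∘_)
import Level
open import Relation.Binary.Definitions using (tri<; tri≈; tri>)
open import Relation.Binary.PropositionalEquality as ≡ using (_≡_; _≢_)
import Relation.Binary.Reasoning.Setoid as SetoidReasoning
open import Relation.Nullary.Decidable using (dec⇒maybe)
open import Tactic.RingSolver using (solve-∀)
open import Tactic.RingSolver.Core.AlmostCommutativeRing using (AlmostCommutativeRing; fromCommutativeRing)

-- Determinants and column operations

-- Why `L` can be evaluated on the products: since c_{i+1} = c_i + 2h, one has (y + h)² - (c_i + h)²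
-- = (y - c_i)(y + c_{i+1}). Hence for p(y) = ∏_{i<k} (y² - (c_i + h)²) the shift p(y + h)
-- telescopes to ∏ (y² - c_i²) · (y + c_k)/(y + c_0), and p(y - h) is the same with every c negated.
-- For c_0 = 0 the two quotients add up to 2. For c_0 = h, taking y p(y) instead of p(y) supplies
-- the factors y ± h that cancel the denominators, and the sum is 2y ∏ (y² - c_i²). This is why c_0
-- is 0 when `L` is even and h when `L` is odd. The value p(±s) is the product of the numbers s² -
-- (c_i + h)², which become the ratios of consecutive values of `L`. Multiplication by e^{xt} is
-- unitriangular on sequences and leaves the first nonzero entry of a sequence alone; therefore `x`
-- disappears from the determinants. All closed forms unfold from one ratio of consecutive leading
-- entries, -(2h(m+1))² (s² - (c_m + h)²).

double : ℕ → ℕ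
double zero    = zero
double (suc n) = suc (suc (double n))

skip : ℕ → ℕ → ℕ
skip zero    l       = suc l
skip (suc j) zero    = zero
skip (suc j) (suc l) = suc (skip j l)

toℕ-punchIn : ∀ {n} (j : Fin (suc n)) l → toℕ (punchIn j l) ≡ skip (toℕ j) (toℕ l)
toℕ-punchIn Fin.zero    l           = ≡.refl
toℕ-punchIn (Fin.suc j) Fin.zero    = ≡.refl
toℕ-punchIn (Fin.suc j) (Fin.suc l) = ≡.cong suc (toℕ-punchIn j l)

skip-≤ : ∀ j l → skip j l ℕ.≤ suc l
skip-≤ zero    l       = ℕ.≤-refl
skip-≤ (suc j) zero    = z≤n
skip-≤ (suc j) (suc l) = s≤s (skip-≤ j l)

swap : ℕ → ℕ → ℕ
swap zero    zero          = 1
swap zero    (suc zero)    = 0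
swap zero    (suc (suc l)) = suc (suc l)
swap (suc k) zero          = 0
swap (suc k) (suc l)       = suc (swap k l)

swap-< : ∀ k j → j ℕ.< k → swap k j ≡ j
swap-< (suc k) zero    _   = ≡.refl
swap-< (suc k) (suc j) j<k = ≡.cong suc (swap-< k j (s<s⁻¹ j<k))

swap-≡ : ∀ k → swap k k ≡ suc k
swap-≡ zero    = ≡.refl
swap-≡ (suc k) = ≡.cong suc (swap-≡ k)

swap-suc : ∀ k → swap k (suc k) ≡ k
swap-suc zero    = ≡.refl
swap-suc (suc k) = ≡.cong suc (swap-suc k)

swap-skip-≡ : ∀ k l → swap k (skip k l) ≡ skip (suc k) l
swap-skip-≡ zero    zero    = ≡.refl
swap-skip-≡ zero    (suc l) = ≡.refl
swap-skip-≡ (suc k) zero    = ≡.refl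
swap-skip-≡ (suc k) (suc l) = ≡.cong suc (swap-skip-≡ k l)

swap-skip-suc : ∀ k l → swap k (skip (suc k) l) ≡ skip k l
swap-skip-suc zero    zero    = ≡.refl
swap-skip-suc zero    (suc l) = ≡.refl
swap-skip-suc (suc k) zero    = ≡.refl
swap-skip-suc (suc k) (suc l) = ≡.cong suc (swap-skip-suc k l)

-- Cases for expanding a column-swapped matrix along its first row. A column `j` outside the
-- exchanged pair keeps its place, and its minor sees the exchange at a position `k′`; the last
-- component of `other` keeps that pair inside the smaller matrix.
data SwapView (k j : ℕ) : Set where
  left  : j ≡ k → SwapView k j
  right : j ≡ suc k → SwapView k j
  other : ∀ k′ → swap k j ≡ j → (∀ l → swap k (skip j l) ≡ skip j (swap k′ l)) →
    (∀ n → suc k ℕ.< suc n → j ℕ.< suc n → suc k′ ℕ.< n) → SwapView k j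

swapView : ∀ k j → SwapView k j
swapView zero    zero          = left ≡.refl
swapView zero    (suc zero)    = right ≡.refl
swapView zero    (suc (suc j)) = other 0 ≡.refl
  (λ { zero → ≡.refl ; (suc zero) → ≡.refl ; (suc (suc l)) → ≡.refl })
  (λ n _ j<n → ℕ.≤-trans (s≤s (s≤s z≤n)) (s≤s⁻¹ j<n))
swapView (suc k) zero          = other k ≡.refl (λ l → ≡.refl) (λ n k<n _ → s≤s⁻¹ k<n)
swapView (suc k) (suc j)       with swapView k j
... | left eq  = left (≡.cong suc eq)
... | right eq = right (≡.cong suc eq)
... | other k′ fix comm bound = other (suc k′) (≡.cong suc fix)
  (λ { zero → ≡.refl ; (suc l) → ≡.cong suc (comm l) })
  (λ { zero (s≤s ()) ; (suc n) k<n j<n → s≤s (bound n (s≤s⁻¹ k<n) (s≤s⁻¹ j<n)) })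

update : ∀ {a} {A : Set a} → ℕ → A → (ℕ → A) → ℕ → A
update zero    x f zero    = x
update zero    x f (suc l) = f (suc l)
update (suc k) x f zero    = f zero
update (suc k) x f (suc l) = update k x (f ∘ suc) l

module _ {a} {A : Set a} where

  update-≡ : ∀ k (x : A) f → update k x f k ≡ x
  update-≡ zero    x f = ≡.refl
  update-≡ (suc k) x f = update-≡ k x (f ∘ suc)

  update-≢ : ∀ k (x : A) f l → l ≢ k → update k x f l ≡ f l
  update-≢ zero    x f zero    l≢k = ⊥-elim (l≢k ≡.refl)
  update-≢ zero    x f (suc l) l≢k = ≡.refl
  update-≢ (suc k) x f zero    l≢k = ≡.refl
  update-≢ (suc k) x f (suc l) l≢k = update-≢ k x (f ∘ suc) l (l≢k ∘ ≡.cong suc)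

  update-self : ∀ k (f : ℕ → A) l → update k (f k) f l ≡ f l
  update-self zero    f zero    = ≡.refl
  update-self zero    f (suc l) = ≡.refl
  update-self (suc k) f zero    = ≡.refl
  update-self (suc k) f (suc l) = update-self k (f ∘ suc) l

-- The same case analysis for a replaced column: the minor at `j` either omits it or contains it at
-- position `k′`.
data UpdateView {a} (A : Set a) (k j : ℕ) : Set a where
  same  : j ≡ k → (∀ (x : A) f l → update k x f (skip j l) ≡ f (skip j l)) → UpdateView A k j
  other : ∀ k′ → (∀ (x : A) f → update k x f j ≡ f j) →
    (∀ (x : A) f l → update k x f (skip j l) ≡ update k′ x (f ∘ skip j) l) →
    (∀ n → k ℕ.< suc n → j ℕ.< suc n → k′ ℕ.< n) → UpdateView A k j

updateView : ∀ {a} {A : Set a} k j → UpdateView A k j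
updateView zero    zero    = same ≡.refl (λ x f l → ≡.refl)
updateView zero    (suc j) = other 0 (λ x f → ≡.refl)
  (λ { x f zero → ≡.refl ; x f (suc l) → ≡.refl })
  (λ n _ j<n → ℕ.≤-trans (s≤s z≤n) (s≤s⁻¹ j<n))
updateView (suc k) zero    = other k (λ x f → ≡.refl) (λ x f l → ≡.refl) (λ n k<n _ → s≤s⁻¹ k<n)
updateView (suc k) (suc j) with updateView k j
... | same eq avoid = same (≡.cong suc eq)
  (λ { x f zero → ≡.refl ; x f (suc l) → avoid x (f ∘ suc) l })
... | other k′ fix comm bound = other (suc k′) (λ x f → fix x (f ∘ suc))
  (λ { x f zero → ≡.refl ; x f (suc l) → comm x (f ∘ suc) l })
  (λ { zero (s≤s ()) ; (suc n) k<n j<n → s≤s (bound n (s≤s⁻¹ k<n) (s≤s⁻¹ j<n)) })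

sum-last : ∀ {c ℓ} (M : CommutativeMonoid c ℓ) → let open CommutativeMonoid M in
  (f : ℕ → Carrier) → ∀ n →
  Sum.sum M {suc n} (f ∘ toℕ) ≈ Sum.sum M {n} (f ∘ toℕ) ∙ f n
sum-last M f zero    = trans (identityʳ (f 0)) (sym (identityˡ (f 0)))
  where open CommutativeMonoid M
sum-last M f (suc n) = trans (∙-congˡ (sum-last M (f ∘ suc) n)) (sym (assoc _ _ _))
  where open CommutativeMonoid M

module Columns {c ℓ} (R : CommutativeRing c ℓ) where
  open CommutativeRing R hiding (zero)
  open Exp semiring using () renaming (_^_ to _^ᴿ_)
  open Sum +-commutativeMonoid using (sum; sum-cong-≋; ∑-distrib-+)
  open SemiringSum semiring using (*-distribˡ-sum)
  open RingProperties ring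
  open SemiringSolver commutativeSemiring using (solve; _:=_; _:+_; _:*_; con)
  open SetoidReasoning setoid

  sum-cong : ∀ n (f g : ℕ → Carrier) → (∀ j → j ℕ.< n → f j ≈ g j) →
    sum {n} (f ∘ toℕ) ≈ sum {n} (g ∘ toℕ)
  sum-cong n f g f≈g = sum-cong-≋ {n} {f ∘ toℕ} {g ∘ toℕ} λ j → f≈g (toℕ j) (toℕ<n j)

  Column : Set c
  Column = ℕ → Carrier

  minor : (ℕ → Column) → ℕ → ℕ → Column
  minor C j l i = C (skip j l) (suc i)

  -- Determinant of the first n rows and columns; C j i is the entry in row i, column j.
  D : ℕ → (ℕ → Column) → Carrier

  expansionTerm : ℕ → (ℕ → Column) → ℕ → Carrier
  expansionTerm n C j = (- 1#) ^ᴿ j * C j 0 * D n (minor C j)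

  D zero    C = 1#
  D (suc n) C = sum {suc n} (expansionTerm n C ∘ toℕ)

  -- With columns indexed by ℕ, a column operation is a precomposition or an update of a function,
  -- free of transport along sizes.
  det≈D : ∀ n M C → (∀ i j → M i j ≈ C (toℕ j) (toℕ i)) → det R n M ≈ D n C
  det≈D zero    M C M≈C = refl
  det≈D (suc n) M C M≈C = sum-cong-≋ {suc n}
    {λ j → (- 1#) ^ᴿ toℕ j * M Fin.zero j * det R n (λ i l → M (Fin.suc i) (punchIn j l))}
    {expansionTerm n C ∘ toℕ} λ j →
    *-cong (*-congˡ (M≈C Fin.zero j))
      (det≈D n _ (minor C (toℕ j)) λ i l →
        trans (M≈C (Fin.suc i) (punchIn j l))
          (reflexive (≡.cong (λ k → C k (suc (toℕ i))) (toℕ-punchIn j l))))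

  D-cong : ∀ n {C C′} → (∀ j → j ℕ.< n → ∀ i → C j i ≈ C′ j i) → D n C ≈ D n C′
  D-cong zero    C≈C′ = refl
  D-cong (suc n) {C} {C′} C≈C′ = sum-cong (suc n) (expansionTerm n C) (expansionTerm n C′) λ j j<n →
    *-cong (*-congˡ (C≈C′ j j<n 0))
      (D-cong n λ l l<n i → C≈C′ _ (s≤s (ℕ.≤-trans (skip-≤ j l) l<n)) (suc i))

  D-cong-≡ : ∀ n {C C′} → (∀ j i → C j i ≡ C′ j i) → D n C ≈ D n C′
  D-cong-≡ n C≡C′ = D-cong n λ j _ i → reflexive (C≡C′ j i)

  sum-neg : ∀ n (f : ℕ → Carrier) → sum {n} (λ j → - f (toℕ j)) ≈ - sum {n} (f ∘ toℕ)
  sum-neg n f = begin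
    sum {n} (λ j → - f (toℕ j))      ≈⟨ sum-cong n (λ j → - f j) (λ j → - 1# * f j) (λ j _ → sym (-1*x≈-x (f j))) ⟩
    sum {n} (λ j → - 1# * f (toℕ j)) ≈⟨ *-distribˡ-sum {n} (- 1#) (f ∘ toℕ) ⟨
    - 1# * sum {n} (f ∘ toℕ)         ≈⟨ -1*x≈-x _ ⟩
    - sum {n} (f ∘ toℕ)              ∎

  sum-swap : ∀ k n (f : ℕ → Carrier) → suc k ℕ.< n →
    sum {n} (λ j → f (swap k (toℕ j))) ≈ sum {n} (f ∘ toℕ)
  sum-swap zero    (suc (suc n)) f _   = solve 3 (λ x y z → y :+ (x :+ z) := x :+ (y :+ z)) refl
    (f 0) (f 1) (sum {n} (λ j → f (suc (suc (toℕ j)))))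
  sum-swap zero    (suc zero)    f (s≤s ())
  sum-swap (suc k) (suc n)       f k<n = +-congˡ (sum-swap k n (f ∘ suc) (s<s⁻¹ k<n))

  -- In the first-row expansion the terms of the two exchanged columns trade places: their minors
  -- agree and their signs are opposite. Every other term changes sign by induction.
  D-swap : ∀ n C k → suc k ℕ.< n → D n (C ∘ swap k) ≈ - D n C
  D-swap (suc n) C k k<n = begin
    sum {suc n} (expansionTerm n (C ∘ swap k) ∘ toℕ)       ≈⟨ sum-cong (suc n) (expansionTerm n (C ∘ swap k)) (λ j → - expansionTerm n C (swap k j)) term ⟩
    sum {suc n} (λ j → - expansionTerm n C (swap k (toℕ j))) ≈⟨ sum-neg (suc n) (expansionTerm n C ∘ swap k) ⟩
    - sum {suc n} (λ j → expansionTerm n C (swap k (toℕ j))) ≈⟨ -‿cong (sum-swap k (suc n) (expansionTerm n C) k<n) ⟩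
    - sum {suc n} (expansionTerm n C ∘ toℕ)                ∎
    where
    term : ∀ j → j ℕ.< suc n → expansionTerm n (C ∘ swap k) j ≈ - expansionTerm n C (swap k j)
    term j j<n with swapView k j
    ... | left ≡.refl = begin
      (- 1#) ^ᴿ k * C (swap k k) 0 * D n (minor (C ∘ swap k) k)
        ≈⟨ *-congˡ (D-cong-≡ n λ l i → ≡.cong (λ m → C m (suc i)) (swap-skip-≡ k l)) ⟩
      (- 1#) ^ᴿ k * C (swap k k) 0 * D n (minor C (suc k))
        ≈⟨ *-congʳ (*-congʳ (trans (sym (*-identityˡ _)) (trans (*-congʳ 1≈-1*-1) (*-assoc _ _ _)))) ⟩
      - 1# * (- 1#) ^ᴿ suc k * C (swap k k) 0 * D n (minor C (suc k))
        ≈⟨ solve 4 (λ m s x y → m :* s :* x :* y := m :* (s :* x :* y)) refl _ _ _ _ ⟩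
      - 1# * ((- 1#) ^ᴿ suc k * C (swap k k) 0 * D n (minor C (suc k)))
        ≈⟨ -1*x≈-x _ ⟩
      - ((- 1#) ^ᴿ suc k * C (swap k k) 0 * D n (minor C (suc k)))
        ≡⟨ ≡.cong (λ m → - ((- 1#) ^ᴿ m * C (swap k k) 0 * D n (minor C m))) (swap-≡ k) ⟨
      - expansionTerm n C (swap k k) ∎
      where
      1≈-1*-1 : 1# ≈ - 1# * - 1#
      1≈-1*-1 = trans (sym (-‿involutive 1#)) (sym (-1*x≈-x (- 1#)))
    ... | right ≡.refl = begin
      (- 1#) ^ᴿ suc k * C (swap k (suc k)) 0 * D n (minor (C ∘ swap k) (suc k))
        ≈⟨ *-congˡ (D-cong-≡ n λ l i → ≡.cong (λ m → C m (suc i)) (swap-skip-suc k l)) ⟩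
      - 1# * (- 1#) ^ᴿ k * C (swap k (suc k)) 0 * D n (minor C k)
        ≈⟨ solve 4 (λ m s x y → m :* s :* x :* y := m :* (s :* x :* y)) refl _ _ _ _ ⟩
      - 1# * ((- 1#) ^ᴿ k * C (swap k (suc k)) 0 * D n (minor C k))
        ≈⟨ -1*x≈-x _ ⟩
      - ((- 1#) ^ᴿ k * C (swap k (suc k)) 0 * D n (minor C k))
        ≡⟨ ≡.cong (λ m → - ((- 1#) ^ᴿ m * C (swap k (suc k)) 0 * D n (minor C m))) (swap-suc k) ⟨
      - expansionTerm n C (swap k (suc k)) ∎
    ... | other k′ fix comm bound = begin
      (- 1#) ^ᴿ j * C (swap k j) 0 * D n (minor (C ∘ swap k) j)
        ≈⟨ *-congˡ (D-cong-≡ n λ l i → ≡.cong (λ m → C m (suc i)) (comm l)) ⟩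
      (- 1#) ^ᴿ j * C (swap k j) 0 * D n (minor C j ∘ swap k′)
        ≈⟨ *-congˡ (D-swap n (minor C j) k′ (bound n k<n j<n)) ⟩
      (- 1#) ^ᴿ j * C (swap k j) 0 * - D n (minor C j)
        ≈⟨ -‿distribʳ-* _ _ ⟨
      - ((- 1#) ^ᴿ j * C (swap k j) 0 * D n (minor C j))
        ≡⟨ ≡.cong (λ m → - ((- 1#) ^ᴿ m * C (swap k j) 0 * D n (minor C m))) fix ⟨
      - expansionTerm n C (swap k j) ∎

  replace : ℕ → Column → (ℕ → Column) → ℕ → Column
  replace k v C j i = update k (v i) (λ l → C l i) j

  D-linear : ∀ n k → k ℕ.< n → ∀ C a u v →
    D n (replace k (λ i → a * u i + v i) C) ≈ a * D n (replace k u C) + D n (replace k v C)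
  D-linear (suc n) k k<n C a u v = begin
    sum {suc n} (expansionTerm n (replace k x C) ∘ toℕ)
      ≈⟨ sum-cong (suc n) (expansionTerm n (replace k x C))
           (λ j → a * expansionTerm n (replace k u C) j + expansionTerm n (replace k v C) j) term ⟩
    sum {suc n} (λ j → a * expansionTerm n (replace k u C) (toℕ j) + expansionTerm n (replace k v C) (toℕ j))
      ≈⟨ ∑-distrib-+ {suc n} (λ j → a * expansionTerm n (replace k u C) (toℕ j)) (expansionTerm n (replace k v C) ∘ toℕ) ⟩
    sum {suc n} (λ j → a * expansionTerm n (replace k u C) (toℕ j)) + D (suc n) (replace k v C)
      ≈⟨ +-congʳ (*-distribˡ-sum {suc n} a (expansionTerm n (replace k u C) ∘ toℕ)) ⟨
    a * D (suc n) (replace k u C) + D (suc n) (replace k v C) ∎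
    where
    x : Column
    x i = a * u i + v i
    term : ∀ j → j ℕ.< suc n → expansionTerm n (replace k x C) j
      ≈ a * expansionTerm n (replace k u C) j + expansionTerm n (replace k v C) j
    term j j<n with updateView {A = Carrier} k j
    ... | same ≡.refl avoid = begin
      (- 1#) ^ᴿ k * replace k x C k 0 * D n (minor (replace k x C) k)
        ≈⟨ *-cong (*-congˡ (new x)) (old x) ⟩
      (- 1#) ^ᴿ k * (a * u 0 + v 0) * D n (minor C k)
        ≈⟨ solve 5 (λ s a u v d → s :* (a :* u :+ v) :* d := a :* (s :* u :* d) :+ s :* v :* d) refl _ _ _ _ _ ⟩
      a * ((- 1#) ^ᴿ k * u 0 * D n (minor C k)) + (- 1#) ^ᴿ k * v 0 * D n (minor C k)
        ≈⟨ +-cong (*-congˡ (*-cong (*-congˡ (new u)) (old u))) (*-cong (*-congˡ (new v)) (old v)) ⟨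
      _ ∎
      where
      new : ∀ w → replace k w C k 0 ≈ w 0
      new w = reflexive (update-≡ k (w 0) _)
      old : ∀ w → D n (minor (replace k w C) k) ≈ D n (minor C k)
      old w = D-cong-≡ n λ l i → avoid (w (suc i)) _ l
    ... | other k′ fix comm bound = begin
      (- 1#) ^ᴿ j * replace k x C j 0 * D n (minor (replace k x C) j)
        ≈⟨ *-cong (*-congˡ (old x)) (new x) ⟩
      (- 1#) ^ᴿ j * C j 0 * D n (replace k′ (λ i → a * u (suc i) + v (suc i)) (minor C j))
        ≈⟨ *-congˡ (D-linear n k′ (bound n k<n j<n) (minor C j) a (u ∘ suc) (v ∘ suc)) ⟩
      (- 1#) ^ᴿ j * C j 0 * (a * D n (replace k′ (u ∘ suc) (minor C j)) + D n (replace k′ (v ∘ suc) (minor C j)))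
        ≈⟨ solve 4 (λ s a x y → s :* (a :* x :+ y) := a :* (s :* x) :+ s :* y) refl _ _ _ _ ⟩
      a * ((- 1#) ^ᴿ j * C j 0 * D n (replace k′ (u ∘ suc) (minor C j)))
        + (- 1#) ^ᴿ j * C j 0 * D n (replace k′ (v ∘ suc) (minor C j))
        ≈⟨ +-cong (*-congˡ (*-cong (*-congˡ (old u)) (new u))) (*-cong (*-congˡ (old v)) (new v)) ⟨
      _ ∎
      where
      old : ∀ w → replace k w C j 0 ≈ C j 0
      old w = reflexive (fix (w 0) _)
      new : ∀ w → D n (minor (replace k w C) j) ≈ D n (replace k′ (w ∘ suc) (minor C j))
      new w = D-cong-≡ n λ l i → comm (w (suc i)) _ l

  replace-cong : ∀ n k C {u v} → (∀ i → u i ≈ v i) → D n (replace k u C) ≈ D n (replace k v C)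
  replace-cong n k C {u} {v} u≈v = D-cong n λ j _ i → go k (u≈v i) _ j
    where
    go : ∀ k {x y} → x ≈ y → ∀ f j → update k x f j ≈ update k y f j
    go zero    x≈y f zero    = x≈y
    go zero    x≈y f (suc j) = refl
    go (suc k) x≈y f zero    = refl
    go (suc k) x≈y f (suc j) = go k x≈y (f ∘ suc) j

  D-replace-0 : ∀ n k → k ℕ.< n → ∀ C v → (∀ i → v i ≈ 0#) → D n (replace k v C) ≈ 0#
  D-replace-0 n k k<n C v v≈0 = begin
    D n (replace k v C)
      ≈⟨ replace-cong n k C (λ i → trans (v≈0 i) (sym (trans (+-identityʳ _) (zeroʳ _)))) ⟩
    D n (replace k (λ i → - 1# * 0# + 0#) C)
      ≈⟨ D-linear n k k<n C (- 1#) (λ _ → 0#) (λ _ → 0#) ⟩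
    - 1# * D n (replace k (λ _ → 0#) C) + D n (replace k (λ _ → 0#) C)
      ≈⟨ +-congʳ (-1*x≈-x _) ⟩
    - D n (replace k (λ _ → 0#) C) + D n (replace k (λ _ → 0#) C)
      ≈⟨ -‿inverseˡ _ ⟩
    0# ∎

  -- Only the first two columns meet the top row, and in each of their minors only one column meets
  -- the next row, so two expansions leave the 2 × 2 determinant times the common remainder.
  D-block : ∀ n C → (∀ l → C (suc (suc l)) 0 ≈ 0#) → (∀ l → C (suc (suc l)) 1 ≈ 0#) →
    D (suc (suc n)) C ≈ (C 0 0 * C 1 1 - C 1 0 * C 0 1) * D n (λ l i → C (suc (suc l)) (suc (suc i)))
  D-block n C C₀≈0 C₁≈0 = begin
    1# * C 0 0 * D (suc n) (minor C 0) + (- 1# * 1# * C 1 0 * D (suc n) (minor C 1) + _)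
      ≈⟨ +-cong (*-congˡ (first (minor C 0) C₁≈0)) (+-cong (*-congˡ (first (minor C 1) C₁≈0)) (tail {n} (suc n) C (suc ∘ suc) C₀≈0)) ⟩
    1# * C 0 0 * (C 1 1 * rest) + (- 1# * 1# * C 1 0 * (C 0 1 * rest) + 0#)
      ≈⟨ solve 6 (λ m a b c d r → con 1 :* a :* (d :* r) :+ (m :* con 1 :* c :* (b :* r) :+ con 0)
                   := (a :* d :+ m :* (c :* b)) :* r) refl (- 1#) (C 0 0) (C 0 1) (C 1 0) (C 1 1) rest ⟩
    (C 0 0 * C 1 1 + - 1# * (C 1 0 * C 0 1)) * rest
      ≈⟨ *-congʳ (+-congˡ (-1*x≈-x _)) ⟩
    (C 0 0 * C 1 1 - C 1 0 * C 0 1) * rest ∎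
    where
    rest = D n (λ l i → C (suc (suc l)) (suc (suc i)))

    tail : ∀ {k} n C (g : ℕ → ℕ) → (∀ l → C (g l) 0 ≈ 0#) →
      sum {k} (λ j → expansionTerm n C (g (toℕ j))) ≈ 0#
    tail {zero}  n C g C≈0 = refl
    tail {suc k} n C g C≈0 = trans
      (+-cong (trans (*-congʳ (trans (*-congˡ (C≈0 0)) (zeroʳ _))) (zeroˡ _)) (tail {k} n C (g ∘ suc) (C≈0 ∘ suc)))
      (+-identityʳ 0#)

    first : ∀ A → (∀ l → A (suc l) 0 ≈ 0#) →
      D (suc n) A ≈ A 0 0 * D n (λ l i → A (suc l) (suc i))
    first A A≈0 = trans (+-cong (*-congʳ (*-identityˡ _)) (tail {n} n A suc A≈0)) (+-identityʳ _)

  module _ (F G : ℕ → Column) where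
    blockDet : ℕ → Carrier
    blockDet k = F k (double k) * G k (suc (double k)) - G k (double k) * F k (suc (double k))

    ∏blocks : ℕ → Carrier
    ∏blocks m = Sum.sum *-commutativeMonoid {m} (blockDet ∘ toℕ)

  -- Applied to both families of a `weave`: the columns 2m and 2m + 1 both vanish above row 2m. The
  -- second one need not vanish at row 2m, which is what forces blocks of size 2.
  Staggered : (ℕ → Column) → Set ℓ
  Staggered F = ∀ m i → i ℕ.< double m → F m i ≈ 0#

  weave : (ℕ → Column) → (ℕ → Column) → ℕ → Column
  weave F G zero          = F 0
  weave F G (suc zero)    = G 0
  weave F G (suc (suc n)) = weave (λ m → F (suc m)) (λ m → G (suc m)) n

  weave-shift : (F G : ℕ → Column) → Staggered F → Staggered G →
    ∀ i → i ℕ.< 2 → ∀ l → weave (λ m → F (suc m)) (λ m → G (suc m)) l i ≈ 0#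
  weave-shift F G F≈0 G≈0 i i<2 zero          = F≈0 1 i i<2
  weave-shift F G F≈0 G≈0 i i<2 (suc zero)    = G≈0 1 i i<2
  weave-shift F G F≈0 G≈0 i i<2 (suc (suc l)) = weave-shift (λ m → F (suc m)) (λ m → G (suc m))
    (λ m i i<2m → F≈0 (suc m) i (ℕ.m≤n⇒m≤1+n (ℕ.m≤n⇒m≤1+n i<2m)))
    (λ m i i<2m → G≈0 (suc m) i (ℕ.m≤n⇒m≤1+n (ℕ.m≤n⇒m≤1+n i<2m))) i i<2 l

  weave-map : (F G : ℕ → Column) → ∀ l i → weave F G l (suc (suc i))
    ≡ weave (λ m i → F m (suc (suc i))) (λ m i → G m (suc (suc i))) l i
  weave-map F G zero          i = ≡.refl
  weave-map F G (suc zero)    i = ≡.refl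
  weave-map F G (suc (suc l)) i = weave-map (λ m → F (suc m)) (λ m → G (suc m)) l i

  module _ (F G : ℕ → Column)
    (F≈0 : Staggered F) (G≈0 : Staggered G) where

    D-weave-step : ∀ n → D (suc (suc n)) (weave F G)
      ≈ blockDet F G 0 * D n (weave (λ m i → F (suc m) (suc (suc i))) (λ m i → G (suc m) (suc (suc i))))
    D-weave-step n = trans
      (D-block n (weave F G) (weave-shift F G F≈0 G≈0 0 z<s) (weave-shift F G F≈0 G≈0 1 (s<s z<s)))
      (*-congˡ (D-cong-≡ n (weave-map (λ m → F (suc m)) (λ m → G (suc m)))))

  D-weave-even : ∀ m (F G : ℕ → Column) → Staggered F → Staggered G →
    D (double m) (weave F G) ≈ ∏blocks F G m
  D-weave-even zero    F G F≈0 G≈0 = refl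
  D-weave-even (suc m) F G F≈0 G≈0 = trans (D-weave-step F G F≈0 G≈0 (double m))
    (*-congˡ (D-weave-even m _ _ (λ m i i<2m → F≈0 (suc m) _ (s<s (s<s i<2m))) (λ m i i<2m → G≈0 (suc m) _ (s<s (s<s i<2m)))))

  D-weave-odd : ∀ m (F G : ℕ → Column) → Staggered F → Staggered G →
    D (suc (double m)) (weave F G) ≈ ∏blocks F G m * F m (double m)
  D-weave-odd zero    F G F≈0 G≈0 = trans (+-identityʳ _) (trans (*-identityʳ _) (trans (*-identityˡ _) (sym (*-identityˡ _))))
  D-weave-odd (suc m) F G F≈0 G≈0 = trans (D-weave-step F G F≈0 G≈0 (suc (double m)))
    (trans (*-congˡ (D-weave-odd m _ _ (λ m i i<2m → F≈0 (suc m) _ (s<s (s<s i<2m))) (λ m i i<2m → G≈0 (suc m) _ (s<s (s<s i<2m)))))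
      (sym (*-assoc _ _ _)))

  -- The linear span of the first `k` columns, as syntax trees, so that the vanishing of a
  -- determinant can be proved by structural recursion. The pointwise equation in `combine` takes
  -- the place of extensionality.
  data Span (w : ℕ → Column) (k : ℕ) : Column → Set (c Level.⊔ ℓ) where
    vanishing : ∀ {v} → (∀ i → v i ≈ 0#) → Span w k v
    column    : ∀ {l} → l ℕ.< k → Span w k (w l)
    combine   : ∀ {u v x} a → Span w k u → Span w k v → (∀ i → x i ≈ a * u i + v i) → Span w k x

  Span-mono : ∀ {w k k′ v} → k ℕ.≤ k′ → Span w k v → Span w k′ v
  Span-mono k≤k′ (vanishing v≈0)   = vanishing v≈0
  Span-mono k≤k′ (column l<k)      = column (ℕ.≤-trans l<k k≤k′)
  Span-mono k≤k′ (combine a u v x) = combine a (Span-mono k≤k′ u) (Span-mono k≤k′ v) x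

  -- If `w j` lists the values of a functional on the powers times Q_j, a row shift is
  -- multiplication by the variable; the condition says that this sends Q_j to Q_{j+1} plus a
  -- combination of Q_0, ..., Q_j.
  Recurrent : (ℕ → Column) → Set (c Level.⊔ ℓ)
  Recurrent w = ∀ j → ∃ λ u → Span w (suc j) u × (∀ i → w j (suc i) ≈ w (suc j) i + u i)

  Span-shift : ∀ {w} → Recurrent w → ∀ {k v} → Span w k v → Span w (suc k) (v ∘ suc)
  Span-shift rec (vanishing v≈0)    = vanishing (v≈0 ∘ suc)
  Span-shift rec (column {l} l<k)   with rec l
  ... | u , u∈ , eq = combine 1# (column (s<s l<k)) (Span-mono (ℕ.m≤n⇒m≤1+n l<k) u∈)
    λ i → trans (eq i) (+-congʳ (sym (*-identityˡ _)))
  Span-shift rec (combine a u v eq) = combine a (Span-shift rec u) (Span-shift rec v) (eq ∘ suc)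

  module ColumnOperations (x≈-x⇒x≈0 : ∀ x → x ≈ - x → x ≈ 0#) where

    -- Adjacent swaps bring the two equal columns together. Exchanging neighbours then shows that
    -- the determinant equals its own negative, which is where halving is used.
    D-equal : ∀ d n C p → suc (p ℕ.+ d) ℕ.< n → (∀ i → C p i ≈ C (suc (p ℕ.+ d)) i) → D n C ≈ 0#
    D-equal zero    n C p p<n Cp≈Cq rewrite ℕ.+-identityʳ p = x≈-x⇒x≈0 _ (begin
      D n C            ≈⟨ D-cong n (λ j _ i → sym (go p (λ l → C l i) (Cp≈Cq i) j)) ⟩
      D n (C ∘ swap p) ≈⟨ D-swap n C p p<n ⟩
      - D n C          ∎)
      where
      go : ∀ p (f : ℕ → Carrier) → f p ≈ f (suc p) → ∀ l → f (swap p l) ≈ f l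
      go zero    f eq zero          = sym eq
      go zero    f eq (suc zero)    = eq
      go zero    f eq (suc (suc l)) = refl
      go (suc p) f eq zero          = refl
      go (suc p) f eq (suc l)       = go p (f ∘ suc) eq l
    D-equal (suc d) n C p q<n Cp≈Cq = begin
      D n C              ≈⟨ -‿involutive _ ⟨
      - - D n C          ≈⟨ -‿cong (D-swap n C k q<n) ⟨
      - D n (C ∘ swap k) ≈⟨ -‿cong swapped ⟩
      - 0#               ≈⟨ -0#≈0# ⟩
      0#                 ∎
      where
      k = p ℕ.+ suc d
      swapped : D n (C ∘ swap k) ≈ 0#
      swapped = D-equal d n (C ∘ swap k) p (≡.subst (ℕ._< n) (ℕ.+-suc p d) (ℕ.<-trans (ℕ.n<1+n k) q<n)) λ i → begin
        C (swap k p) i              ≡⟨ ≡.cong (λ l → C l i) (swap-< k p (ℕ.m<m+n p z<s)) ⟩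
        C p i                       ≈⟨ Cp≈Cq i ⟩
        C (suc k) i                 ≡⟨ ≡.cong (λ l → C l i) (swap-≡ k) ⟨
        C (swap k k) i              ≡⟨ ≡.cong (λ l → C (swap k l) i) (ℕ.+-suc p d) ⟩
        C (swap k (suc (p ℕ.+ d))) i ∎

    D-replace-Span : ∀ {w k n C v} → k ℕ.< n → (∀ l → l ℕ.< k → ∀ i → C l i ≡ w l i) →
      Span w k v → D n (replace k v C) ≈ 0#
    D-replace-Span {k = k} {n} {C} k<n C≡w (vanishing v≈0) = D-replace-0 n k k<n C _ v≈0
    D-replace-Span {w} {k} {n} {C} k<n C≡w (column {l} l<k) = D-equal d n C′ l (≡.subst (ℕ._< n) (≡.sym q≡k) k<n) λ i → reflexive
      (≡.trans (update-≢ k (w l i) _ l (ℕ.<⇒≢ l<k)) (≡.trans (C≡w l l<k i)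
        (≡.sym (≡.trans (≡.cong (λ q → C′ q i) q≡k) (update-≡ k (w l i) _)))))
      where
      C′ = replace k (w l) C
      d = k ℕ.∸ suc l
      q≡k : suc (l ℕ.+ d) ≡ k
      q≡k = ℕ.m+[n∸m]≡n l<k
    D-replace-Span {k = k} {n} {C} k<n C≡w (combine {u} {v} {x} a u∈ v∈ eq) = begin
      D n (replace k x C)                                ≈⟨ replace-cong n k C eq ⟩
      D n (replace k (λ i → a * u i + v i) C)            ≈⟨ D-linear n k k<n C a u v ⟩
      a * D n (replace k u C) + D n (replace k v C)      ≈⟨ +-cong (*-congˡ (D-replace-Span k<n C≡w u∈)) (D-replace-Span k<n C≡w v∈) ⟩
      a * 0# + 0#                                        ≈⟨ trans (+-identityʳ _) (zeroʳ a) ⟩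
      0#                                                 ∎

    module _ (s : Column) (w : ℕ → Column) (w₀≈s : ∀ i → w 0 i ≈ s i) (rec : Recurrent w) where

      shifted : ℕ → Column
      shifted j i = s (i ℕ.+ j)

      -- The change of basis from the powers of the variable to the monic Q_j is unitriangular:
      -- multiplying the relation for `j` by the variable gives the one for `suc j`.
      shifted-Span : ∀ j → ∃ λ v → Span w j v × (∀ i → shifted j i ≈ v i + w j i)
      shifted-Span zero    = (λ _ → 0#) , vanishing (λ _ → refl) , λ i →
        trans (reflexive (≡.cong s (ℕ.+-identityʳ i))) (trans (sym (w₀≈s i)) (sym (+-identityˡ _)))
      shifted-Span (suc j) with shifted-Span j | rec j
      ... | v , v∈ , eq | u , u∈ , eq′ = (λ i → v (suc i) + u i) ,
        combine 1# (Span-shift rec v∈) u∈ (λ i → +-congʳ (sym (*-identityˡ _))) , λ i → begin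
        s (i ℕ.+ suc j)                ≡⟨ ≡.cong s (ℕ.+-suc i j) ⟩
        shifted j (suc i)              ≈⟨ eq (suc i) ⟩
        v (suc i) + w j (suc i)        ≈⟨ +-congˡ (eq′ i) ⟩
        v (suc i) + (w (suc j) i + u i) ≈⟨ solve 3 (λ x y z → x :+ (y :+ z) := (x :+ z) :+ y) refl _ _ _ ⟩
        v (suc i) + u i + w (suc j) i  ∎

      -- Columns are exchanged from left to right, so that when column `k` is treated its
      -- lower-order part already lies in the span of the columns before it.
      hybrid : ℕ → ℕ → Column
      hybrid zero    = shifted
      hybrid (suc k) = replace k (w k) (hybrid k)

      hybrid-≥ : ∀ k l → k ℕ.≤ l → ∀ i → hybrid k l i ≡ shifted l i
      hybrid-≥ zero    l _   i = ≡.refl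
      hybrid-≥ (suc k) l k<l i = ≡.trans (update-≢ k (w k i) _ l (ℕ.>⇒≢ k<l)) (hybrid-≥ k l (ℕ.<⇒≤ k<l) i)

      hybrid-< : ∀ k l → l ℕ.< k → ∀ i → hybrid k l i ≡ w l i
      hybrid-< (suc k) l l<k i with ℕ.<-cmp l k
      ... | tri< l<k′ l≢k _ = ≡.trans (update-≢ k (w k i) _ l l≢k) (hybrid-< k l l<k′ i)
      ... | tri≈ _ ≡.refl _ = update-≡ k (w k i) _
      ... | tri> _ _ k<l    = ⊥-elim (ℕ.<⇒≱ k<l (s≤s⁻¹ l<k))

      D-hybrid : ∀ n k → k ℕ.≤ n → D n shifted ≈ D n (hybrid k)
      D-hybrid n zero    _   = refl
      D-hybrid n (suc k) k<n with shifted-Span k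
      ... | v , v∈ , eq = begin
        D n shifted                        ≈⟨ D-hybrid n k (ℕ.<⇒≤ k<n) ⟩
        D n (hybrid k)                     ≈⟨ D-cong-≡ n (λ j i → ≡.sym (update-self k (λ l → hybrid k l i) j)) ⟩
        D n (replace k (hybrid k k) (hybrid k))
          ≈⟨ replace-cong n k (hybrid k) (λ i → trans (reflexive (hybrid-≥ k k ℕ.≤-refl i)) (trans (eq i) (+-congʳ (sym (*-identityˡ _))))) ⟩
        D n (replace k (λ i → 1# * v i + w k i) (hybrid k))
          ≈⟨ D-linear n k k<n (hybrid k) 1# v (w k) ⟩
        1# * D n (replace k v (hybrid k)) + D n (hybrid (suc k))
          ≈⟨ +-congʳ (trans (*-identityˡ _) (D-replace-Span k<n (hybrid-< k) v∈)) ⟩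
        0# + D n (hybrid (suc k))          ≈⟨ +-identityˡ _ ⟩
        D n (hybrid (suc k))               ∎

      hankel-columns : ∀ n → hankel R n s ≈ D (suc n) w
      hankel-columns n = begin
        hankel R n s               ≈⟨ det≈D (suc n) _ shifted (λ i j → refl) ⟩
        D (suc n) shifted          ≈⟨ D-hybrid (suc n) (suc n) ℕ.≤-refl ⟩
        D (suc n) (hybrid (suc n)) ≈⟨ D-cong (suc n) (λ j j<n i → reflexive (hybrid-< (suc n) j j<n i)) ⟩
        D (suc n) w                ∎

-- Binomial transforms

open import Data.Nat.Combinatorics
  using (_C_; nCk≡n!/k![n-k]!; k![n∸k]!∣n!; nCk+nC[k+1]≡[n+1]C[k+1]; k>n⇒nCk≡0)

module Transform {c ℓ} (R : CommutativeRing c ℓ) where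
  open CommutativeRing R hiding (zero)
  open Exp semiring using () renaming (_^_ to _^ᴿ_)
  open Sum +-commutativeMonoid using (sum; ∑-distrib-+)
  open SemiringSum semiring using (*-distribˡ-sum)
  open SemiringSolver commutativeSemiring using (solve; _:=_; _:+_; _:*_; con)
  open SetoidReasoning setoid
  open Columns R using (sum-cong)

  -- If f has exponential generating function φ(t), then τ a f has e^{at} φ(t).
  τ : Carrier → (ℕ → Carrier) → ℕ → Carrier
  τ a f zero    = f 0
  τ a f (suc n) = τ a (f ∘ suc) n + a * τ a f n

  τ-cong : ∀ {a b f g} → a ≈ b → (∀ n → f n ≈ g n) → ∀ n → τ a f n ≈ τ b g n
  τ-cong a≈b f≈g zero    = f≈g 0
  τ-cong a≈b f≈g (suc n) = +-cong (τ-cong a≈b (f≈g ∘ suc) n) (*-cong a≈b (τ-cong a≈b f≈g n))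

  τ-linear : ∀ a b f g n → τ a (λ k → b * f k + g k) n ≈ b * τ a f n + τ a g n
  τ-linear a b f g zero    = refl
  τ-linear a b f g (suc n) = trans
    (+-cong (τ-linear a b (f ∘ suc) (g ∘ suc) n) (*-congˡ (τ-linear a b f g n)))
    (solve 6 (λ a b x y z w → (b :* x :+ y) :+ a :* (b :* z :+ w) := b :* (x :+ a :* z) :+ (y :+ a :* w))
      refl a b _ _ _ _)

  τ-∘ : ∀ a b f n → τ a (τ b f) n ≈ τ (a + b) f n
  τ-∘ a b f zero    = refl
  τ-∘ a b f (suc n) = begin
    τ a (λ k → τ b (f ∘ suc) k + b * τ b f k) n + a * τ a (τ b f) n
      ≈⟨ +-congʳ (τ-cong refl (λ k → +-comm _ _) n) ⟩
    τ a (λ k → b * τ b f k + τ b (f ∘ suc) k) n + a * τ a (τ b f) n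
      ≈⟨ +-congʳ (τ-linear a b (τ b f) (τ b (f ∘ suc)) n) ⟩
    b * τ a (τ b f) n + τ a (τ b (f ∘ suc)) n + a * τ a (τ b f) n
      ≈⟨ +-cong (+-cong (*-congˡ (τ-∘ a b f n)) (τ-∘ a b (f ∘ suc) n)) (*-congˡ (τ-∘ a b f n)) ⟩
    b * τ (a + b) f n + τ (a + b) (f ∘ suc) n + a * τ (a + b) f n
      ≈⟨ solve 4 (λ a b x y → b :* x :+ y :+ a :* x := y :+ (a :+ b) :* x) refl a b _ _ ⟩
    τ (a + b) (f ∘ suc) n + (a + b) * τ (a + b) f n ∎

  τ-^ : ∀ a b n → τ a (b ^ᴿ_) n ≈ (a + b) ^ᴿ n
  τ-^ a b zero    = refl
  τ-^ a b (suc n) = begin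
    τ a (λ k → b * b ^ᴿ k) n + a * τ a (b ^ᴿ_) n
      ≈⟨ +-congʳ (τ-cong refl (λ k → sym (+-identityʳ _)) n) ⟩
    τ a (λ k → b * b ^ᴿ k + 0#) n + a * τ a (b ^ᴿ_) n
      ≈⟨ +-congʳ (τ-linear a b (b ^ᴿ_) (λ _ → 0#) n) ⟩
    b * τ a (b ^ᴿ_) n + τ a (λ _ → 0#) n + a * τ a (b ^ᴿ_) n
      ≈⟨ +-cong (+-cong (*-congˡ (τ-^ a b n)) (τ-zero n)) (*-congˡ (τ-^ a b n)) ⟩
    b * (a + b) ^ᴿ n + 0# + a * (a + b) ^ᴿ n
      ≈⟨ solve 3 (λ a b x → b :* x :+ con 0 :+ a :* x := (a :+ b) :* x) refl a b _ ⟩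
    (a + b) * (a + b) ^ᴿ n ∎
    where
    τ-zero : ∀ n → τ a (λ _ → 0#) n ≈ 0#
    τ-zero zero    = refl
    τ-zero (suc n) = trans (+-cong (τ-zero n) (trans (*-congˡ (τ-zero n)) (zeroʳ a))) (+-identityʳ _)

  -- The series e^{at} has constant term 1, so it preserves the lowest term of a series.
  τ-leading : ∀ a f n → (∀ i → i ℕ.< n → f i ≈ 0#) → τ a f n ≈ f n

  τ-vanishing : ∀ a f n → (∀ i → i ℕ.< n → f i ≈ 0#) → ∀ i → i ℕ.< n → τ a f i ≈ 0#
  τ-vanishing a f (suc n) f≈0 i i<n = trans
    (τ-leading a f i (λ k k<i → f≈0 k (ℕ.<-trans k<i i<n))) (f≈0 i i<n)

  τ-leading a f zero    f≈0 = refl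
  τ-leading a f (suc n) f≈0 = trans
    (+-cong (τ-leading a (f ∘ suc) n (λ i i<n → f≈0 (suc i) (s<s i<n)))
      (trans (*-congˡ (trans (τ-leading a f n (λ i i<n → f≈0 i (ℕ.m≤n⇒m≤1+n i<n))) (f≈0 n ℕ.≤-refl))) (zeroʳ a)))
    (+-identityʳ _)

  module _ (ν : ℕ → Carrier) (ν-0 : ν 0 ≈ 0#) (ν-1 : ν 1 ≈ 1#) (ν-+ : ∀ m n → ν (m ℕ.+ n) ≈ ν m + ν n) where

    -- Pascal's rule. Leaving the image `ν` of the natural numbers abstract covers both `fromℕ` over
    -- ℚ and `ι ∘ fromℕ` over `R`.
    τ-binomial : ∀ x f n → τ x f n ≈ sum {suc n} λ k → ν (n C toℕ k) * f (toℕ k) * x ^ᴿ (n ℕ.∸ toℕ k)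
    τ-binomial x f zero    = sym (trans (+-identityʳ _) (trans (*-identityʳ _) (trans (*-congʳ ν-1) (*-identityˡ _))))
    τ-binomial x f (suc n) = begin
      τ x (f ∘ suc) n + x * τ x f n
        ≈⟨ +-cong (τ-binomial x (f ∘ suc) n) (*-congˡ (τ-binomial x f n)) ⟩
      S₁ + x * (ν 1 * f 0 * x ^ᴿ n + S₂)
        ≈⟨ solve 4 (λ x s a b → s :+ x :* (a :+ b) := x :* a :+ (s :+ x :* b)) refl x S₁ _ S₂ ⟩
      x * (ν 1 * f 0 * x ^ᴿ n) + (S₁ + x * S₂)
        ≈⟨ +-cong (solve 3 (λ x a p → x :* (a :* p) := a :* (x :* p)) refl x (ν 1 * f 0) (x ^ᴿ n)) (+-congˡ x*S₂) ⟩
      ν 1 * f 0 * x ^ᴿ suc n + (S₁ + sum {suc n} (v ∘ toℕ))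
        ≈⟨ +-congˡ (∑-distrib-+ {suc n} (u ∘ toℕ) (v ∘ toℕ)) ⟨
      ν 1 * f 0 * x ^ᴿ suc n + sum {suc n} (λ k → u (toℕ k) + v (toℕ k))
        ≈⟨ +-congˡ (sum-cong (suc n) (λ k → u k + v k) w λ k _ → pascal k) ⟩
      ν 1 * f 0 * x ^ᴿ suc n + sum {suc n} (w ∘ toℕ) ∎
      where
      u v w : ℕ → Carrier
      u k = ν (n C k) * f (suc k) * x ^ᴿ (n ℕ.∸ k)
      v k = ν (n C suc k) * f (suc k) * x ^ᴿ (n ℕ.∸ k)
      w k = ν (suc n C suc k) * f (suc k) * x ^ᴿ (n ℕ.∸ k)
      v′ : ℕ → Carrier
      v′ k = ν (n C suc k) * f (suc k) * x ^ᴿ (n ℕ.∸ suc k)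
      S₁ S₂ : Carrier
      S₁ = sum {suc n} (u ∘ toℕ)
      S₂ = sum {n} (v′ ∘ toℕ)
      pascal : ∀ k → u k + v k ≈ w k
      pascal k = begin
        u k + v k
          ≈⟨ solve 4 (λ a b f p → a :* f :* p :+ b :* f :* p := (a :+ b) :* f :* p) refl _ _ _ _ ⟩
        (ν (n C k) + ν (n C suc k)) * f (suc k) * x ^ᴿ (n ℕ.∸ k)
          ≈⟨ *-congʳ (*-congʳ (trans (sym (ν-+ (n C k) (n C suc k))) (reflexive (≡.cong ν (nCk+nC[k+1]≡[n+1]C[k+1] n k))))) ⟩
        w k ∎
      -- The vanishing binomial coefficient C(n, n + 1) supplies a last term, so that both sums in
      -- Pascal's rule have the same range.
      x*S₂ : x * S₂ ≈ sum {suc n} (v ∘ toℕ)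
      x*S₂ = begin
        x * S₂                               ≈⟨ *-distribˡ-sum {n} x (v′ ∘ toℕ) ⟩
        sum {n} (λ k → x * v′ (toℕ k))       ≈⟨ sum-cong n (λ k → x * v′ k) v step ⟩
        sum {n} (v ∘ toℕ)                    ≈⟨ +-identityʳ _ ⟨
        sum {n} (v ∘ toℕ) + 0#               ≈⟨ +-congˡ last≈0 ⟨
        sum {n} (v ∘ toℕ) + v n              ≈⟨ sum-last +-commutativeMonoid v n ⟨
        sum {suc n} (v ∘ toℕ)                ∎
        where
        step : ∀ k → k ℕ.< n → x * v′ k ≈ v k
        step k k<n = begin
          x * v′ k ≈⟨ solve 3 (λ x a p → x :* (a :* p) := a :* (x :* p)) refl x _ _ ⟩
          ν (n C suc k) * f (suc k) * x ^ᴿ suc (n ℕ.∸ suc k)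
            ≡⟨ ≡.cong (λ m → ν (n C suc k) * f (suc k) * x ^ᴿ m) (≡.sym (ℕ.+-∸-assoc 1 k<n)) ⟩
          v k ∎
        last≈0 : v n ≈ 0#
        last≈0 = trans (*-congʳ (trans (*-congʳ (trans (reflexive (≡.cong ν (k>n⇒nCk≡0 (ℕ.n<1+n n)))) ν-0)) (zeroˡ _))) (zeroˡ _)

-- Hankel determinants from orthogonal polynomials

previous : (ℕ → ℕ → ℚ) → ℕ → ℕ → ℚ
previous w zero    n = 0ℚ
previous w (suc m) n = w m n

-- Row m of F (resp. G) is the sequence k ↦ L(yᵏ P), where μ k = L(yᵏ) and P is a monic
-- polynomial of degree 2m (resp. 2m + 1).
record Tower (μ : ℕ → ℚ) : Set where
  field
    F G     : ℕ → ℕ → ℚ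
    p α β   : ℕ → ℚ
    F-0     : ∀ n → F 0 n ≡ μ n
    F-step  : ∀ m n → F m (suc n) ≡ G m n ℚ.+ p m ℚ.* previous G m n
    G-step  : ∀ m n → G m (suc n) ≡ F (suc m) n ℚ.+ (α m ℚ.* F m n ℚ.+ β m ℚ.* previous F m n)
    F-stag  : ∀ m i → i ℕ.< double m → F m i ≡ 0ℚ
    G-stag  : ∀ m i → i ℕ.< double m → G m i ≡ 0ℚ
    corner  : ∀ m → F m (double m) ≡ 0ℚ ⊎ G m (double m) ≡ 0ℚ

  block : ℕ → ℚ
  block k = F k (double k) ℚ.* G k (suc (double k)) ℚ.- G k (double k) ℚ.* F k (suc (double k))

  ∏block : ℕ → ℚ
  ∏block m = Sum.sum ℚ.*-1-commutativeMonoid {m} (block ∘ toℕ)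

module Transfer {c ℓ} (R : CommutativeRing c ℓ) (ι : ℚ → CommutativeRing.Carrier R)
  (ι-hom : IsRingHomomorphism ℚ.+-*-rawRing (CommutativeRing.rawRing R) ι)
  (x : CommutativeRing.Carrier R) {μ : ℕ → ℚ} (T : Tower μ) where
  open CommutativeRing R hiding (zero)
  open RingProperties ring
  open IsRingHomomorphism ι-hom renaming (⟦⟧-cong to ι-cong)
  open Transform R
  open Columns R
  open Tower T
  open SemiringSolver commutativeSemiring using (solve; _:=_; _:+_; _:*_; con)
  open SetoidReasoning setoid

  -- The image of ½ under `ι` makes 2 invertible in `R`.
  x≈-x⇒x≈0 : ∀ y → y ≈ - y → y ≈ 0#
  x≈-x⇒x≈0 y y≈-y = begin
    y                       ≈⟨ *-identityˡ y ⟨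
    1# * y                  ≈⟨ *-congʳ 1#-homo ⟨
    ι (½ ℚ.+ ½) * y         ≈⟨ *-congʳ (+-homo ½ ½) ⟩
    (ι ½ + ι ½) * y         ≈⟨ solve 2 (λ a y → (a :+ a) :* y := a :* (y :+ y)) refl (ι ½) y ⟩
    ι ½ * (y + y)           ≈⟨ *-congˡ (+-congˡ y≈-y) ⟩
    ι ½ * (y + - y)         ≈⟨ *-congˡ (-‿inverseʳ y) ⟩
    ι ½ * 0#                ≈⟨ zeroʳ _ ⟩
    0#                      ∎

  -- Turns the sequence of values L(yᵏ P) into that of L((y + x)ᵏ P).
  lift : (ℕ → ℚ) → Column
  lift f = τ x (ι ∘ f)

  Fˣ Gˣ : ℕ → Column
  Fˣ m = lift (F m)
  Gˣ m = lift (G m)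

  -- A recurrence for multiplication by y becomes one for multiplication by y + x, with the extra
  -- term x times the sequence itself. The trailing `0#` matches a chain of `combine` that ends in
  -- `vanishing`.
  lift-shift : ∀ {f g u v : ℕ → ℚ} {a b} → (∀ n → f (suc n) ≡ g n ℚ.+ (a ℚ.* u n ℚ.+ b ℚ.* v n)) →
    ∀ n → lift f (suc n) ≈ lift g n + (ι a * lift u n + (ι b * lift v n + (x * lift f n + 0#)))
  lift-shift {f} {g} {u} {v} {a} {b} eq n = begin
    τ x (ι ∘ f ∘ suc) n + x * lift f n
      ≈⟨ +-congʳ (τ-cong refl expand n) ⟩
    τ x (λ k → ι a * ι (u k) + (ι b * ι (v k) + ι (g k))) n + x * lift f n
      ≈⟨ +-congʳ (trans (τ-linear x (ι a) (ι ∘ u) _ n) (+-congˡ (τ-linear x (ι b) (ι ∘ v) (ι ∘ g) n))) ⟩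
    ι a * lift u n + (ι b * lift v n + lift g n) + x * lift f n
      ≈⟨ solve 4 (λ u v g f → u :+ (v :+ g) :+ f := g :+ (u :+ (v :+ (f :+ con 0)))) refl _ _ _ _ ⟩
    lift g n + (ι a * lift u n + (ι b * lift v n + (x * lift f n + 0#))) ∎
    where
    expand : ∀ k → ι (f (suc k)) ≈ ι a * ι (u k) + (ι b * ι (v k) + ι (g k))
    expand k = begin
      ι (f (suc k))                                        ≈⟨ ι-cong (eq k) ⟩
      ι (g k ℚ.+ (a ℚ.* u k ℚ.+ b ℚ.* v k))                ≈⟨ +-homo _ _ ⟩
      ι (g k) + ι (a ℚ.* u k ℚ.+ b ℚ.* v k)                ≈⟨ +-congˡ (trans (+-homo _ _) (+-cong (*-homo _ _) (*-homo _ _))) ⟩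
      ι (g k) + (ι a * ι (u k) + ι b * ι (v k))            ≈⟨ solve 3 (λ g u v → g :+ (u :+ v) := u :+ (v :+ g)) refl _ _ _ ⟩
      ι a * ι (u k) + (ι b * ι (v k) + ι (g k))            ∎

  lift-vanishing : ∀ f N → (∀ i → i ℕ.< N → f i ≡ 0ℚ) → ∀ i → i ℕ.< N → lift f i ≈ 0#
  lift-vanishing f N f≡0 = τ-vanishing x (ι ∘ f) N λ i i<N → trans (ι-cong (f≡0 i i<N)) 0#-homo

  lift-leading : ∀ f N → (∀ i → i ℕ.< N → f i ≡ 0ℚ) → lift f N ≈ ι (f N)
  lift-leading f N f≡0 = τ-leading x (ι ∘ f) N λ i i<N → trans (ι-cong (f≡0 i i<N)) 0#-homo

  w : ℕ → Column
  w = weave Fˣ Gˣ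

  weave-F : ∀ (A B : ℕ → Column) m → weave A B (double m) ≡ A m
  weave-F A B zero    = ≡.refl
  weave-F A B (suc m) = weave-F (λ m → A (suc m)) (λ m → B (suc m)) m

  weave-G : ∀ (A B : ℕ → Column) m → weave A B (suc (double m)) ≡ B m
  weave-G A B zero    = ≡.refl
  weave-G A B (suc m) = weave-G (λ m → A (suc m)) (λ m → B (suc m)) m

  spanned-F : ∀ {k} m → double m ℕ.< k → Span w k (Fˣ m)
  spanned-F {k} m m<k = ≡.subst (Span w k) (weave-F Fˣ Gˣ m) (column m<k)

  spanned-G : ∀ {k} m → suc (double m) ℕ.< k → Span w k (Gˣ m)
  spanned-G {k} m m<k = ≡.subst (Span w k) (weave-G Fˣ Gˣ m) (column m<k)

  spanned-0 : ∀ {k} → Span w k (lift (λ _ → 0ℚ))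
  spanned-0 = vanishing λ i → trans (lift-leading (λ _ → 0ℚ) i (λ _ _ → ≡.refl)) 0#-homo

  spanned-previous-F : ∀ {k} m → double m ℕ.≤ k → Span w k (lift (previous F m))
  spanned-previous-F zero    _   = spanned-0
  spanned-previous-F (suc m) m<k = spanned-F m (ℕ.<⇒≤ m<k)

  spanned-previous-G : ∀ {k} m → double m ℕ.≤ k → Span w k (lift (previous G m))
  spanned-previous-G zero    _   = spanned-0
  spanned-previous-G (suc m) m<k = spanned-G m m<k

  data Parity : ℕ → Set where
    even : ∀ m → Parity (double m)
    odd  : ∀ m → Parity (suc (double m))

  parity : ∀ n → Parity n
  parity zero    = even 0
  parity (suc n) with parity n
  ... | even m = odd m
  ... | odd m  = even (suc m)

  w-recurrent : Recurrent w
  w-recurrent j with parity j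
  ... | even m = _ ,
    -- The coefficient 0 pads `F-step`, which has a single correction term, to the shape of
    -- `lift-shift`.
    combine (ι 0ℚ) (spanned-F m ℕ.≤-refl) (combine (ι (p m)) (spanned-previous-G m (ℕ.n≤1+n _))
      (combine x (spanned-F m ℕ.≤-refl) (vanishing (λ _ → refl)) (λ _ → refl)) (λ _ → refl)) (λ _ → refl) ,
    λ n → trans (reflexive (≡.cong (λ f → f (suc n)) (weave-F Fˣ Gˣ m)))
      (trans (lift-shift {f = F m} {g = G m} {u = F m} {v = previous G m} {a = 0ℚ} {b = p m} (λ n → ≡.trans (F-step m n) (≡.cong (G m n ℚ.+_)
          (≡.sym (≡.trans (≡.cong (ℚ._+ p m ℚ.* previous G m n) (ℚ.*-zeroˡ (F m n))) (ℚ.+-identityˡ _))))) n)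
        (+-congʳ (reflexive (≡.cong (λ f → f n) (≡.sym (weave-G Fˣ Gˣ m))))))
  ... | odd m  = _ ,
    combine (ι (α m)) (spanned-F m (ℕ.n≤1+n _)) (combine (ι (β m)) (spanned-previous-F m (ℕ.m≤n⇒m≤1+n (ℕ.n≤1+n _)))
      (combine x (spanned-G m ℕ.≤-refl) (vanishing (λ _ → refl)) (λ _ → refl)) (λ _ → refl)) (λ _ → refl) ,
    λ n → trans (reflexive (≡.cong (λ f → f (suc n)) (weave-G Fˣ Gˣ m)))
      (trans (lift-shift {f = G m} {g = F (suc m)} {u = F m} {v = previous F m} {a = α m} {b = β m} (G-step m) n)
        (+-congʳ (reflexive (≡.cong (λ f → f n) (≡.sym (weave-F Fˣ Gˣ (suc m)))))))

  Fˣ-stag : Staggered Fˣ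
  Fˣ-stag m = lift-vanishing (F m) (double m) (F-stag m)

  Gˣ-stag : Staggered Gˣ
  Gˣ-stag m = lift-vanishing (G m) (double m) (G-stag m)

  vanishing-suc : ∀ {f : ℕ → ℚ} {N} → (∀ i → i ℕ.< N → f i ≡ 0ℚ) → f N ≡ 0ℚ → ∀ i → i ℕ.< suc N → f i ≡ 0ℚ
  vanishing-suc f≡0 fN≡0 i i<1+N with ℕ.m≤n⇒m<n∨m≡n (s≤s⁻¹ i<1+N)
  ... | inj₁ i<N    = f≡0 i i<N
  ... | inj₂ ≡.refl = fN≡0

  -- Lifting preserves only leading entries, whereas a block also has entries one row lower. By
  -- `corner` one sequence of the pair vanishes at 2k as well: its entry at 2k + 1 is then leading,
  -- and the other entry at 2k + 1 is multiplied by zero.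
  blockDet-ι : ∀ k → blockDet Fˣ Gˣ k ≈ ι (block k)
  blockDet-ι k = begin
    Fˣ k (double k) * Gˣ k (suc (double k)) - Gˣ k (double k) * Fˣ k (suc (double k))
      ≈⟨ +-cong (first (corner k)) (-‿cong (second (corner k))) ⟩
    ι (F k (double k)) * ι (G k (suc (double k))) - ι (G k (double k)) * ι (F k (suc (double k)))
      ≈⟨ +-cong (*-homo _ _) (-‿cong (*-homo _ _)) ⟨
    ι (F k (double k) ℚ.* G k (suc (double k))) - ι (G k (double k) ℚ.* F k (suc (double k)))
      ≈⟨ +-congˡ (-‿homo _) ⟨
    ι (F k (double k) ℚ.* G k (suc (double k))) + ι (ℚ.- (G k (double k) ℚ.* F k (suc (double k))))
      ≈⟨ +-homo _ _ ⟨
    ι (block k) ∎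
    where
    F≈ : Fˣ k (double k) ≈ ι (F k (double k))
    F≈ = lift-leading (F k) (double k) (F-stag k)
    G≈ : Gˣ k (double k) ≈ ι (G k (double k))
    G≈ = lift-leading (G k) (double k) (G-stag k)
    product-zero : ∀ {u v u′ v′} → u ≈ 0# → u′ ≈ 0# → u * v ≈ u′ * v′
    product-zero u≈0 u′≈0 = trans (trans (*-congʳ u≈0) (zeroˡ _)) (sym (trans (*-congʳ u′≈0) (zeroˡ _)))
    first : F k (double k) ≡ 0ℚ ⊎ G k (double k) ≡ 0ℚ →
      Fˣ k (double k) * Gˣ k (suc (double k)) ≈ ι (F k (double k)) * ι (G k (suc (double k)))
    first (inj₁ F≡0) = product-zero (trans F≈ ιF≈0) ιF≈0
      where ιF≈0 = trans (ι-cong F≡0) 0#-homo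
    first (inj₂ G≡0) = *-cong F≈ (lift-leading (G k) (suc (double k)) (vanishing-suc (G-stag k) G≡0))
    second : F k (double k) ≡ 0ℚ ⊎ G k (double k) ≡ 0ℚ →
      Gˣ k (double k) * Fˣ k (suc (double k)) ≈ ι (G k (double k)) * ι (F k (suc (double k)))
    second (inj₁ F≡0) = *-cong G≈ (lift-leading (F k) (suc (double k)) (vanishing-suc (F-stag k) F≡0))
    second (inj₂ G≡0) = product-zero (trans G≈ ιG≈0) ιG≈0
      where ιG≈0 = trans (ι-cong G≡0) 0#-homo

  ∏blocks-ι : ∀ m → ∏blocks Fˣ Gˣ m ≈ ι (∏block m)
  ∏blocks-ι m = go m (blockDet Fˣ Gˣ) block blockDet-ι
    where
    go : ∀ m (f : ℕ → Carrier) (g : ℕ → ℚ) → (∀ k → f k ≈ ι (g k)) →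
      Sum.sum *-commutativeMonoid {m} (f ∘ toℕ) ≈ ι (Sum.sum ℚ.*-1-commutativeMonoid {m} (g ∘ toℕ))
    go zero    f g f≈g = sym 1#-homo
    go (suc m) f g f≈g = trans (*-cong (f≈g 0) (go m (f ∘ suc) (g ∘ suc) (f≈g ∘ suc))) (sym (*-homo _ _))

  module _ (s : Column) (s≈ : ∀ n → s n ≈ lift μ n) where
    open ColumnOperations x≈-x⇒x≈0

    hankel≈D : ∀ n → hankel R n s ≈ D (suc n) w
    hankel≈D = hankel-columns s w (λ i → trans (τ-cong refl (λ n → ι-cong (F-0 n)) i) (sym (s≈ i))) w-recurrent

    2*-double : ∀ m → 2 ℕ.* m ≡ double m
    2*-double zero    = ≡.refl
    2*-double (suc m) = ≡.cong suc (≡.trans (ℕ.+-suc m (m ℕ.+ 0)) (≡.cong suc (2*-double m)))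

    hankel-odd : ∀ m → hankel R (2 ℕ.* m ℕ.+ 1) s ≈ ι (∏block (suc m))
    hankel-odd m = begin
      hankel R (2 ℕ.* m ℕ.+ 1) s   ≡⟨ ≡.cong (λ n → hankel R n s) (≡.trans (ℕ.+-comm (2 ℕ.* m) 1) (≡.cong suc (2*-double m))) ⟩
      hankel R (suc (double m)) s  ≈⟨ hankel≈D (suc (double m)) ⟩
      D (double (suc m)) w         ≈⟨ D-weave-even (suc m) Fˣ Gˣ Fˣ-stag Gˣ-stag ⟩
      ∏blocks Fˣ Gˣ (suc m)        ≈⟨ ∏blocks-ι (suc m) ⟩
      ι (∏block (suc m))           ∎

    hankel-even : ∀ m → hankel R (2 ℕ.* m) s ≈ ι (∏block m ℚ.* F m (double m))
    hankel-even m = begin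
      hankel R (2 ℕ.* m) s                   ≡⟨ ≡.cong (λ n → hankel R n s) (2*-double m) ⟩
      hankel R (double m) s                  ≈⟨ hankel≈D (double m) ⟩
      D (suc (double m)) w                   ≈⟨ D-weave-odd m Fˣ Gˣ Fˣ-stag Gˣ-stag ⟩
      ∏blocks Fˣ Gˣ m * Fˣ m (double m)      ≈⟨ *-cong (∏blocks-ι m) (lift-leading (F m) (double m) (F-stag m)) ⟩
      ι (∏block m) * ι (F m (double m))      ≈⟨ *-homo _ _ ⟨
      ι (∏block m ℚ.* F m (double m))        ∎

-- Generalized Bernoulli numbers as moments

ℚring : AlmostCommutativeRing _ _
ℚring = fromCommutativeRing ℚ.+-*-commutativeRing λ x → dec⇒maybe (0ℚ ℚ.≟ x)

fromℕ-+ : ∀ m n → fromℕ (m ℕ.+ n) ≡ fromℕ m ℚ.+ fromℕ n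
fromℕ-+ m n = ℚ.toℚᵘ-injective (begin
  ℚ.toℚᵘ (fromℕ (m ℕ.+ n))               ≈⟨ ℚ.toℚᵘ-fromℚᵘ (mkℚᵘ (+ (m ℕ.+ n)) 0) ⟩
  mkℚᵘ (+ (m ℕ.+ n)) 0                   ≈⟨ *≡* (≡.cong (ℤ._* + 1) (≡.cong₂ ℤ._+_ (≡.sym (ℤ.*-identityʳ (+ m))) (≡.sym (ℤ.*-identityʳ (+ n))))) ⟩
  mkℚᵘ (+ m) 0 ℚᵘ.+ mkℚᵘ (+ n) 0         ≈⟨ ℚᵘ.+-cong (ℚ.toℚᵘ-fromℚᵘ (mkℚᵘ (+ m) 0)) (ℚ.toℚᵘ-fromℚᵘ (mkℚᵘ (+ n) 0)) ⟨
  ℚ.toℚᵘ (fromℕ m) ℚᵘ.+ ℚ.toℚᵘ (fromℕ n) ≈⟨ ℚ.toℚᵘ-homo-+ (fromℕ m) (fromℕ n) ⟨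
  ℚ.toℚᵘ (fromℕ m ℚ.+ fromℕ n)           ∎)
  where open ℚᵘ.≃-Reasoning

fromℕ-* : ∀ m n → fromℕ (m ℕ.* n) ≡ fromℕ m ℚ.* fromℕ n
fromℕ-* zero    n = ≡.sym (ℚ.*-zeroˡ (fromℕ n))
fromℕ-* (suc m) n = begin
  fromℕ (n ℕ.+ m ℕ.* n)              ≡⟨ fromℕ-+ n (m ℕ.* n) ⟩
  fromℕ n ℚ.+ fromℕ (m ℕ.* n)        ≡⟨ ≡.cong (fromℕ n ℚ.+_) (fromℕ-* m n) ⟩
  fromℕ n ℚ.+ fromℕ m ℚ.* fromℕ n    ≡⟨ distrib (fromℕ m) (fromℕ n) ⟩
  (1ℚ ℚ.+ fromℕ m) ℚ.* fromℕ n       ≡⟨ ≡.cong (ℚ._* fromℕ n) (fromℕ-+ 1 m) ⟨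
  fromℕ (suc m) ℚ.* fromℕ n          ∎
  where
  open ≡.≡-Reasoning
  distrib : ∀ x y → y ℚ.+ x ℚ.* y ≡ (1ℚ ℚ.+ x) ℚ.* y
  distrib = solve-∀ ℚring

fromℕ-^ : ∀ m n → fromℕ (m ℕ.^ n) ≡ fromℕ m ^ n
fromℕ-^ m zero    = ≡.refl
fromℕ-^ m (suc n) = ≡.trans (fromℕ-* m (m ℕ.^ n)) (≡.cong (fromℕ m ℚ.*_) (fromℕ-^ m n))

fromℕ-!*1/! : ∀ n → fromℕ (n !) ℚ.* 1/! n ≡ 1ℚ
fromℕ-!*1/! n = fromℕ-*-recip (n !) {{ℕ._!≢0 n}}

binomial*factorial : ∀ {n k} → k ℕ.≤ n → fromℕ (n C k) ℚ.* fromℕ (k !) ≡ fromℕ (n !) ℚ.* 1/! (n ℕ.∸ k)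
binomial*factorial {n} {k} k≤n = begin
  c ℚ.* d                             ≡⟨ ℚ.*-identityʳ _ ⟨
  c ℚ.* d ℚ.* 1ℚ                      ≡⟨ ≡.cong (c ℚ.* d ℚ.*_) (fromℕ-!*1/! (n ℕ.∸ k)) ⟨
  c ℚ.* d ℚ.* (e ℚ.* i)               ≡⟨ assoc c d e i ⟩
  c ℚ.* (d ℚ.* e) ℚ.* i               ≡⟨ ≡.cong (λ x → c ℚ.* x ℚ.* i) (fromℕ-* (k !) ((n ℕ.∸ k) !)) ⟨
  c ℚ.* fromℕ (k ! ℕ.* (n ℕ.∸ k) !) ℚ.* i ≡⟨ ≡.cong (ℚ._* i) (fromℕ-* (n C k) _) ⟨
  fromℕ ((n C k) ℕ.* (k ! ℕ.* (n ℕ.∸ k) !)) ℚ.* i ≡⟨ ≡.cong (λ m → fromℕ m ℚ.* i) C*! ⟩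
  fromℕ (n !) ℚ.* i                   ∎
  where
  open ≡.≡-Reasoning
  c = fromℕ (n C k)
  d = fromℕ (k !)
  e = fromℕ ((n ℕ.∸ k) !)
  i = 1/! (n ℕ.∸ k)
  assoc : ∀ c d e i → c ℚ.* d ℚ.* (e ℚ.* i) ≡ c ℚ.* (d ℚ.* e) ℚ.* i
  assoc = solve-∀ ℚring
  C*! : (n C k) ℕ.* (k ! ℕ.* (n ℕ.∸ k) !) ≡ n !
  C*! = ≡.trans (≡.cong (ℕ._* (k ! ℕ.* (n ℕ.∸ k) !)) (nCk≡n!/k![n-k]! k≤n)) (m/n*n≡m {{_}} (k![n∸k]!∣n! k≤n))

module Tℚ = Transform ℚ.+-*-commutativeRing
open Tℚ using (τ; τ-binomial; τ-cong; τ-linear; τ-∘; τ-^; τ-leading)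
open Columns ℚ.+-*-commutativeRing using (sum-cong)
open SemiringSum (CommutativeRing.semiring ℚ.+-*-commutativeRing) using (*-distribˡ-sum)

-- The bridge from products of power series to `τ`: after clearing factorials, the Cauchy product
-- with e^{at} is the binomial sum.
egf-τ : ∀ a e n → fromℕ (n !) ℚ.* (e ⊛ exp a) n ≡ τ (fromℕ a) (λ k → fromℕ (k !) ℚ.* e k) n
egf-τ a e n = begin
  fromℕ (n !) ℚ.* ∑ (suc n) (u ∘ toℕ)        ≡⟨ *-distribˡ-sum {suc n} (fromℕ (n !)) (u ∘ toℕ) ⟩
  ∑ (suc n) (λ k → fromℕ (n !) ℚ.* u (toℕ k)) ≡⟨ sum-cong (suc n) (λ k → fromℕ (n !) ℚ.* u k) v step ⟩
  ∑ (suc n) (v ∘ toℕ)                        ≡⟨ τ-binomial fromℕ ≡.refl ≡.refl fromℕ-+ (fromℕ a) _ n ⟨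
  τ (fromℕ a) (λ k → fromℕ (k !) ℚ.* e k) n  ∎
  where
  open ≡.≡-Reasoning
  u v : ℕ → ℚ
  u k = e k ℚ.* exp a (n ℕ.∸ k)
  v k = fromℕ (n C k) ℚ.* (fromℕ (k !) ℚ.* e k) ℚ.* fromℕ a ^ (n ℕ.∸ k)
  rearrange : ∀ f e p i → f ℚ.* (e ℚ.* (p ℚ.* i)) ≡ (f ℚ.* i) ℚ.* (e ℚ.* p)
  rearrange = solve-∀ ℚring
  rearrange′ : ∀ c f e p → (c ℚ.* f) ℚ.* (e ℚ.* p) ≡ c ℚ.* (f ℚ.* e) ℚ.* p
  rearrange′ = solve-∀ ℚring
  step : ∀ k → k ℕ.< suc n → fromℕ (n !) ℚ.* u k ≡ v k
  step k k≤n = begin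
    fromℕ (n !) ℚ.* u k
      ≡⟨ rearrange (fromℕ (n !)) (e k) (fromℕ (a ℕ.^ (n ℕ.∸ k))) (1/! (n ℕ.∸ k)) ⟩
    fromℕ (n !) ℚ.* 1/! (n ℕ.∸ k) ℚ.* (e k ℚ.* fromℕ (a ℕ.^ (n ℕ.∸ k)))
      ≡⟨ ≡.cong₂ (λ x y → x ℚ.* (e k ℚ.* y)) (≡.sym (binomial*factorial (s≤s⁻¹ k≤n))) (fromℕ-^ a (n ℕ.∸ k)) ⟩
    fromℕ (n C k) ℚ.* fromℕ (k !) ℚ.* (e k ℚ.* fromℕ a ^ (n ℕ.∸ k))
      ≡⟨ rearrange′ (fromℕ (n C k)) (fromℕ (k !)) (e k) _ ⟩
    v k ∎

⊛-last : ∀ f g n → (f ⊛ g) (suc n) ≡ (f ⊛ (g ∘ suc)) n ℚ.+ f (suc n) ℚ.* g 0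
⊛-last f g zero    = rearrange (f 0 ℚ.* g 1) (f 1 ℚ.* g 0)
  where
  rearrange : ∀ x y → x ℚ.+ (y ℚ.+ 0ℚ) ≡ x ℚ.+ 0ℚ ℚ.+ y
  rearrange = solve-∀ ℚring
⊛-last f g (suc n) = ≡.trans (≡.cong (f 0 ℚ.* g (suc (suc n)) ℚ.+_) (⊛-last (f ∘ suc) g n))
  (≡.sym (ℚ.+-assoc (f 0 ℚ.* g (suc (suc n))) (((f ∘ suc) ⊛ (g ∘ suc)) n) (f (suc (suc n)) ℚ.* g 0)))

module Moments {N} (χ : DirichletCharacter N) (total≡0 : twistedExp χ 0 ≡ 0ℚ) where
  open DirichletCharacter χ using (modulus≢0)
  instance _ = expm1/t-nonZero N

  coefficient : Series
  coefficient = quotient (twistedExp χ) (expm1/t N)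

  -- moment k = B_{k+1,χ} / (k + 1)
  moment : ℕ → ℚ
  moment k = fromℕ (k !) ℚ.* coefficient (suc k)

  -- As the character sums to zero, the Bernoulli series is divisible by t, and the quotient has the
  -- numbers `moment` as its exponential coefficients.
  coefficient₀≡0 : coefficient 0 ≡ 0ℚ
  coefficient₀≡0 = ≡.trans (≡.cong (ℚ._* ℚ.1/ expm1/t N 0) total≡0) (ℚ.*-zeroˡ (ℚ.1/ expm1/t N 0))

  -- The factor t removed from `coefficient` cancels the denominator of (e^{Nt} - 1)/t; the -1 has
  -- been moved to the right-hand side.
  shifted-⊛ : ∀ n → ((coefficient ∘ suc) ⊛ exp N) n ≡ coefficient (suc n) ℚ.+ twistedExp χ n
  shifted-⊛ zero    = begin
    coefficient 1 ℚ.* 1ℚ ℚ.+ 0ℚ         ≡⟨ ≡.cong (ℚ._+ 0ℚ) (ℚ.*-identityʳ (coefficient 1)) ⟩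
    coefficient 1 ℚ.+ 0ℚ                ≡⟨ ≡.cong (coefficient 1 ℚ.+_) total≡0 ⟨
    coefficient 1 ℚ.+ twistedExp χ 0    ∎
    where open ≡.≡-Reasoning
  shifted-⊛ (suc n) = begin
    (c′ ⊛ exp N) (suc n)                                  ≡⟨ ⊛-last c′ (exp N) n ⟩
    (c′ ⊛ expm1/t N) n ℚ.+ coefficient (suc (suc n)) ℚ.* 1ℚ ≡⟨ ≡.cong₂ ℚ._+_ (≡.sym drop) (ℚ.*-identityʳ (coefficient (suc (suc n)))) ⟩
    twistedExp χ (suc n) ℚ.+ coefficient (suc (suc n))    ≡⟨ ℚ.+-comm (twistedExp χ (suc n)) _ ⟩
    coefficient (suc (suc n)) ℚ.+ twistedExp χ (suc n)    ∎
    where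
    open ≡.≡-Reasoning
    c′ = coefficient ∘ suc
    drop : twistedExp χ (suc n) ≡ (c′ ⊛ expm1/t N) n
    drop = begin
      twistedExp χ (suc n)            ≡⟨ quotient-⊛ (twistedExp χ) (expm1/t N) (suc n) ⟨
      (coefficient ⊛ expm1/t N) (suc n) ≡⟨ ≡.cong (λ c₀ → c₀ ℚ.* expm1/t N (suc n) ℚ.+ (c′ ⊛ expm1/t N) n) coefficient₀≡0 ⟩
      0ℚ ℚ.* expm1/t N (suc n) ℚ.+ (c′ ⊛ expm1/t N) n ≡⟨ ≡.cong (ℚ._+ (c′ ⊛ expm1/t N) n) (ℚ.*-zeroˡ (expm1/t N (suc n))) ⟩
      0ℚ ℚ.+ (c′ ⊛ expm1/t N) n       ≡⟨ ℚ.+-identityˡ _ ⟩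
      (c′ ⊛ expm1/t N) n              ∎

  τ-moment : ∀ n → τ (fromℕ N) moment n ≡ moment n ℚ.+ fromℕ (n !) ℚ.* twistedExp χ n
  τ-moment n = begin
    τ (fromℕ N) moment n                              ≡⟨ egf-τ N (coefficient ∘ suc) n ⟨
    fromℕ (n !) ℚ.* ((coefficient ∘ suc) ⊛ exp N) n   ≡⟨ ≡.cong (fromℕ (n !) ℚ.*_) (shifted-⊛ n) ⟩
    fromℕ (n !) ℚ.* (coefficient (suc n) ℚ.+ twistedExp χ n) ≡⟨ ℚ.*-distribˡ-+ (fromℕ (n !)) _ _ ⟩
    moment n ℚ.+ fromℕ (n !) ℚ.* twistedExp χ n       ∎
    where open ≡.≡-Reasoning

  recip-binomial-genBernoulli : ∀ {n k} → k ℕ.≤ n →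
    (+ 1 / suc n) ℚ.* (fromℕ (suc n C suc k) ℚ.* genBernoulli χ (suc k)) ≡ fromℕ (n C k) ℚ.* moment k
  recip-binomial-genBernoulli {n} {k} k≤n = begin
    r ℚ.* (fromℕ (suc n C suc k) ℚ.* (fromℕ (suc k !) ℚ.* c))  ≡⟨ assoc₁ r (fromℕ (suc n C suc k)) (fromℕ (suc k !)) c ⟩
    r ℚ.* (fromℕ (suc n C suc k) ℚ.* fromℕ (suc k !)) ℚ.* c    ≡⟨ ≡.cong (λ x → r ℚ.* x ℚ.* c) (binomial*factorial (s≤s k≤n)) ⟩
    r ℚ.* (fromℕ (suc n !) ℚ.* i) ℚ.* c                       ≡⟨ ≡.cong (λ x → r ℚ.* (x ℚ.* i) ℚ.* c) (fromℕ-* (suc n) (n !)) ⟩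
    r ℚ.* (fromℕ (suc n) ℚ.* fromℕ (n !) ℚ.* i) ℚ.* c         ≡⟨ assoc₂ r (fromℕ (suc n)) (fromℕ (n !)) i c ⟩
    fromℕ (suc n) ℚ.* r ℚ.* (fromℕ (n !) ℚ.* i ℚ.* c)         ≡⟨ ≡.cong₂ (λ x y → x ℚ.* (y ℚ.* c)) (fromℕ-*-recip (suc n)) (≡.sym (binomial*factorial k≤n)) ⟩
    1ℚ ℚ.* (fromℕ (n C k) ℚ.* fromℕ (k !) ℚ.* c)              ≡⟨ assoc₃ (fromℕ (n C k)) (fromℕ (k !)) c ⟩
    fromℕ (n C k) ℚ.* moment k                                ∎
    where
    open ≡.≡-Reasoning
    r = + 1 / suc n
    c = coefficient (suc k)
    i = 1/! (n ℕ.∸ k)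
    assoc₁ : ∀ r b f c → r ℚ.* (b ℚ.* (f ℚ.* c)) ≡ r ℚ.* (b ℚ.* f) ℚ.* c
    assoc₁ = solve-∀ ℚring
    assoc₂ : ∀ r s f i c → r ℚ.* (s ℚ.* f ℚ.* i) ℚ.* c ≡ s ℚ.* r ℚ.* (f ℚ.* i ℚ.* c)
    assoc₂ = solve-∀ ℚring
    assoc₃ : ∀ b f c → 1ℚ ℚ.* (b ℚ.* f ℚ.* c) ≡ b ℚ.* (f ℚ.* c)
    assoc₃ = solve-∀ ℚring

  module _ {c ℓ} (R : CommutativeRing c ℓ) (ι : ℚ → CommutativeRing.Carrier R)
    (ι-hom : IsRingHomomorphism ℚ.+-*-rawRing (CommutativeRing.rawRing R) ι) where
    open CommutativeRing R hiding (zero)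
    open Exp semiring using () renaming (_^_ to _^ᴿ_)
    open Sum +-commutativeMonoid using (sum)
    open SemiringSum semiring using () renaming (*-distribˡ-sum to *-distribˡ-sumᴿ)
    open IsRingHomomorphism ι-hom renaming (⟦⟧-cong to ι-cong)
    open SemiringSolver commutativeSemiring using (solve; _:=_; _:*_)
    open SetoidReasoning setoid

    -- The term with B_0 drops out, and C(n+1, k+1)/(n+1) = C(n, k)/(k+1) absorbs the denominator of
    -- the remaining ones.
    shiftedBernoulli-τ : ∀ x n → shiftedBernoulli R ι χ x n ≈ Transform.τ R x (ι ∘ moment) n
    shiftedBernoulli-τ x n = begin
      ι r * (u 0 + sum {suc n} (λ k → u (suc (toℕ k))))  ≈⟨ *-congˡ (trans (+-congʳ u₀≈0) (+-identityˡ _)) ⟩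
      ι r * sum {suc n} (λ k → u (suc (toℕ k)))          ≈⟨ *-distribˡ-sumᴿ {suc n} (ι r) (λ k → u (suc (toℕ k))) ⟩
      sum {suc n} (λ k → ι r * u (suc (toℕ k)))          ≈⟨ Columns.sum-cong R (suc n) (λ k → ι r * u (suc k)) v step ⟩
      sum {suc n} (v ∘ toℕ)
        ≈⟨ Transform.τ-binomial R (ι ∘ fromℕ) 0#-homo 1#-homo
             (λ m k → trans (ι-cong (fromℕ-+ m k)) (+-homo _ _)) x (ι ∘ moment) n ⟨
      Transform.τ R x (ι ∘ moment) n                     ∎
      where
      r = + 1 / suc n
      u v : ℕ → Carrier
      u k = ι (fromℕ (suc n C k)) * ι (genBernoulli χ k) * x ^ᴿ (suc n ℕ.∸ k)
      v k = ι (fromℕ (n C k)) * ι (moment k) * x ^ᴿ (n ℕ.∸ k)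
      u₀≈0 : u 0 ≈ 0#
      u₀≈0 = trans (*-congʳ (trans (*-congˡ (trans
        (ι-cong (≡.trans (≡.cong (fromℕ 1 ℚ.*_) coefficient₀≡0) (ℚ.*-zeroʳ (fromℕ 1)))) 0#-homo)) (zeroʳ _))) (zeroˡ _)
      step : ∀ k → k ℕ.< suc n → ι r * u (suc k) ≈ v k
      step k k≤n = begin
        ι r * u (suc k)
          ≈⟨ solve 4 (λ r b c p → r :* (b :* c :* p) := r :* (b :* c) :* p) refl _ _ _ _ ⟩
        ι r * (ι (fromℕ (suc n C suc k)) * ι (genBernoulli χ (suc k))) * x ^ᴿ (n ℕ.∸ k)
          ≈⟨ *-congʳ (trans (*-homo _ _) (*-congˡ (*-homo _ _))) ⟨
        ι (r ℚ.* (fromℕ (suc n C suc k) ℚ.* genBernoulli χ (suc k))) * x ^ᴿ (n ℕ.∸ k)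
          ≈⟨ *-congʳ (trans (ι-cong (recip-binomial-genBernoulli (s≤s⁻¹ k≤n))) (*-homo _ _)) ⟩
        v k ∎

-- Uniqueness and parity for exponential functional equations

open import Data.Rational using (_+_; _*_; _-_; -_)
open ≡ using (refl; sym; trans; cong; cong₂)
open ≡.≡-Reasoning

0-x*0≡0 : ∀ x → 0ℚ - x * 0ℚ ≡ 0ℚ
0-x*0≡0 = solve-∀ ℚring

0+x*0≡0 : ∀ x → 0ℚ + x * 0ℚ ≡ 0ℚ
0+x*0≡0 = solve-∀ ℚring

neg-involutive : ∀ x → - - x ≡ x
neg-involutive = solve-∀ ℚring

x+x≡0⇒x≡0 : ∀ x → x + x ≡ 0ℚ → x ≡ 0ℚ
x+x≡0⇒x≡0 x x+x≡0 = begin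
  x           ≡⟨ half x ⟩
  ½ * (x + x) ≡⟨ cong (½ *_) x+x≡0 ⟩
  ½ * 0ℚ      ≡⟨ ℚ.*-zeroʳ ½ ⟩
  0ℚ          ∎
  where
  half : ∀ x → x ≡ ½ * (x + x)
  half = solve-∀ ℚring

x+x≡y+y⇒x≡y : ∀ x y → x + x ≡ y + y → x ≡ y
x+x≡y+y⇒x≡y x y eq = begin
  x             ≡⟨ split x y ⟩
  (x - y) + y   ≡⟨ cong (_+ y) (x+x≡0⇒x≡0 (x - y) (begin
    (x - y) + (x - y)   ≡⟨ regroup x y ⟩
    (x + x) - (y + y)   ≡⟨ cong (_- (y + y)) eq ⟩
    (y + y) - (y + y)   ≡⟨ ℚ.+-inverseʳ (y + y) ⟩
    0ℚ                  ∎)) ⟩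
  0ℚ + y        ≡⟨ ℚ.+-identityˡ y ⟩
  y             ∎
  where
  split : ∀ x y → x ≡ (x - y) + y
  split = solve-∀ ℚring
  regroup : ∀ x y → (x - y) + (x - y) ≡ (x + x) - (y + y)
  regroup = solve-∀ ℚring

-- The linear term of e^{at} acts on the lowest entry with weight C(n+1, n) = n + 1.
τ-subleading : ∀ a f n → (∀ i → i ℕ.< n → f i ≡ 0ℚ) →
  τ a f (suc n) ≡ f (suc n) + fromℕ (suc n) * (a * f n)
τ-subleading a f zero    f≡0 = cong (_+_ (f 1)) (sym (ℚ.*-identityˡ (a * f 0)))
τ-subleading a f (suc n) f≡0 = begin
  τ a (f ∘ suc) (suc n) + a * τ a f (suc n)
    ≡⟨ cong₂ (λ x y → x + a * y) (τ-subleading a (f ∘ suc) n (λ i i<n → f≡0 (suc i) (s<s i<n))) (τ-leading a f (suc n) f≡0) ⟩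
  f (suc (suc n)) + fromℕ (suc n) * (a * f (suc n)) + a * f (suc n)
    ≡⟨ rearrange (f (suc (suc n))) (fromℕ (suc n)) (a * f (suc n)) ⟩
  f (suc (suc n)) + (1ℚ + fromℕ (suc n)) * (a * f (suc n))
    ≡⟨ cong (λ m → f (suc (suc n)) + m * (a * f (suc n))) (fromℕ-+ 1 (suc n)) ⟨
  f (suc (suc n)) + fromℕ (suc (suc n)) * (a * f (suc n)) ∎
  where
  rearrange : ∀ x m y → x + m * y + y ≡ x + (1ℚ + m) * y
  rearrange = solve-∀ ℚring

-- Here e^{at} - 1 annihilates the series and its lowest term at is nonzero: if all entries below
-- `n` vanish, the equation at `suc n` reads (n + 1) a f(n) = 0.
τ-fixed⇒0 : ∀ a a⁻¹ → a⁻¹ * a ≡ 1ℚ → ∀ f → (∀ n → τ a f n ≡ f n) → ∀ n → f n ≡ 0ℚ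
τ-fixed⇒0 a a⁻¹ a⁻¹a≡1 f fixed = <-rec (λ n → f n ≡ 0ℚ) λ n f≡0 → begin
  f n                                          ≡⟨ ℚ.*-identityˡ (f n) ⟨
  1ℚ * f n                                     ≡⟨ cong (_* f n) (cong₂ _*_ a⁻¹a≡1 (fromℕ-*-recip (suc n))) ⟨
  (a⁻¹ * a) * (fromℕ (suc n) * r n) * f n      ≡⟨ rearrange a⁻¹ a (fromℕ (suc n)) (r n) (f n) (f (suc n)) ⟩
  a⁻¹ * r n * ((f (suc n) + fromℕ (suc n) * (a * f n)) - f (suc n))
    ≡⟨ cong (λ x → a⁻¹ * r n * (x - f (suc n))) (trans (sym (τ-subleading a f n λ i i<n → f≡0 i<n)) (fixed (suc n))) ⟩
  a⁻¹ * r n * (f (suc n) - f (suc n))          ≡⟨ cong (a⁻¹ * r n *_) (ℚ.+-inverseʳ (f (suc n))) ⟩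
  a⁻¹ * r n * 0ℚ                               ≡⟨ ℚ.*-zeroʳ (a⁻¹ * r n) ⟩
  0ℚ                                           ∎
  where
  r : ℕ → ℚ
  r n = + 1 / suc n
  rearrange : ∀ b a m r y z → (b * a) * (m * r) * y ≡ b * r * ((z + m * (a * y)) - z)
  rearrange = solve-∀ ℚring

τ-sum-zero⇒0 : ∀ a b f → (∀ n → τ a f n + τ b f n ≡ 0ℚ) → ∀ n → f n ≡ 0ℚ
τ-sum-zero⇒0 a b f eq = <-rec (λ n → f n ≡ 0ℚ) λ n f≡0 → x+x≡0⇒x≡0 (f n)
  (trans (cong₂ _+_ (sym (τ-leading a f n λ i i<n → f≡0 i<n)) (sym (τ-leading b f n λ i i<n → f≡0 i<n))) (eq n))

-- The substitution of -t for t in the generating function, with the sign produced by recursion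
-- instead of a power.
alternate : (ℕ → ℚ) → ℕ → ℚ
alternate f zero    = f 0
alternate f (suc n) = - alternate (f ∘ suc) n

alternate-cong : ∀ {f g} → (∀ n → f n ≡ g n) → ∀ n → alternate f n ≡ alternate g n
alternate-cong f≗g zero    = f≗g 0
alternate-cong f≗g (suc n) = cong -_ (alternate-cong (f≗g ∘ suc) n)

alternate-0 : ∀ n → alternate (λ _ → 0ℚ) n ≡ 0ℚ
alternate-0 zero    = refl
alternate-0 (suc n) = cong -_ (alternate-0 n)

alternate-linear : ∀ a f g n → alternate (λ k → a * f k + g k) n ≡ a * alternate f n + alternate g n
alternate-linear a f g zero    = refl
alternate-linear a f g (suc n) = trans (cong -_ (alternate-linear a (f ∘ suc) (g ∘ suc) n))
  (rearrange a (alternate (f ∘ suc) n) (alternate (g ∘ suc) n))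
  where
  rearrange : ∀ a x y → - (a * x + y) ≡ a * (- x) + (- y)
  rearrange = solve-∀ ℚring

alternate-double : ∀ f j → alternate f (double j) ≡ f (double j)
alternate-double f zero    = refl
alternate-double f (suc j) = trans (neg-involutive (alternate (f ∘ suc ∘ suc) (double j)))
  (alternate-double (f ∘ suc ∘ suc) j)

alternate-^ : ∀ a n → alternate (a ^_) n ≡ (- a) ^ n
alternate-^ a zero    = refl
alternate-^ a (suc n) = begin
  - alternate (λ k → a * a ^ k) n       ≡⟨ cong -_ (alternate-cong (λ k → sym (ℚ.+-identityʳ (a * a ^ k))) n) ⟩
  - alternate (λ k → a * a ^ k + 0ℚ) n  ≡⟨ cong -_ (alternate-linear a (a ^_) (λ _ → 0ℚ) n) ⟩
  - (a * alternate (a ^_) n + alternate (λ _ → 0ℚ) n)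
                                        ≡⟨ cong₂ (λ x y → - (a * x + y)) (alternate-^ a n) (alternate-0 n) ⟩
  - (a * (- a) ^ n + 0ℚ)                ≡⟨ rearrange a ((- a) ^ n) ⟩
  (- a) * (- a) ^ n                     ∎
  where
  rearrange : ∀ a x → - (a * x + 0ℚ) ≡ (- a) * x
  rearrange = solve-∀ ℚring

τ-alternate : ∀ a b → b ≡ - a → ∀ f n → τ a (alternate f) n ≡ alternate (τ b f) n
τ-alternate a b b≡-a f zero    = refl
τ-alternate a b b≡-a f (suc n) = begin
  τ a (λ k → - alternate (f ∘ suc) k) n + a * τ a (alternate f) n
    ≡⟨ cong (_+ a * τ a (alternate f) n) (τ-cong refl (λ k → sym (rearrange₁ (alternate (f ∘ suc) k))) n) ⟩
  τ a (λ k → (- 1ℚ) * alternate (f ∘ suc) k + 0ℚ * 0ℚ) n + a * τ a (alternate f) n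
    ≡⟨ cong (_+ a * τ a (alternate f) n) (τ-linear a (- 1ℚ) (alternate (f ∘ suc)) (λ _ → 0ℚ) n) ⟩
  (- 1ℚ) * τ a (alternate (f ∘ suc)) n + τ a (λ _ → 0ℚ) n + a * τ a (alternate f) n
    ≡⟨ cong₂ (λ x y → x + y + a * τ a (alternate f) n) (cong ((- 1ℚ) *_) (τ-alternate a b b≡-a (f ∘ suc) n)) (τ-leading a (λ _ → 0ℚ) n (λ _ _ → refl)) ⟩
  (- 1ℚ) * alternate (τ b (f ∘ suc)) n + 0ℚ + a * τ a (alternate f) n
    ≡⟨ cong (λ x → (- 1ℚ) * alternate (τ b (f ∘ suc)) n + 0ℚ + a * x) (τ-alternate a b b≡-a f n) ⟩
  (- 1ℚ) * alternate (τ b (f ∘ suc)) n + 0ℚ + a * alternate (τ b f) n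
    ≡⟨ rearrange₂ a (alternate (τ b (f ∘ suc)) n) (alternate (τ b f) n) ⟩
  - ((- a) * alternate (τ b f) n + alternate (τ b (f ∘ suc)) n)
    ≡⟨ cong (λ c → - (c * alternate (τ b f) n + alternate (τ b (f ∘ suc)) n)) b≡-a ⟨
  - (b * alternate (τ b f) n + alternate (τ b (f ∘ suc)) n)
    ≡⟨ cong -_ (alternate-linear b (τ b f) (τ b (f ∘ suc)) n) ⟨
  - alternate (λ k → b * τ b f k + τ b (f ∘ suc) k) n
    ≡⟨ cong -_ (alternate-cong (λ k → ℚ.+-comm (b * τ b f k) (τ b (f ∘ suc) k)) n) ⟩
  - alternate (λ k → τ b (f ∘ suc) k + b * τ b f k) n ∎
  where
  rearrange₁ : ∀ x → (- 1ℚ) * x + 0ℚ * 0ℚ ≡ - x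
  rearrange₁ = solve-∀ ℚring
  rearrange₂ : ∀ a x y → (- 1ℚ) * x + 0ℚ + a * y ≡ - ((- a) * y + x)
  rearrange₂ = solve-∀ ℚring

-- The exponential generating function of f is ν(t) / (e^{ht} + e^{-ht}).
Solves : ℚ → (ν f : ℕ → ℚ) → Set
Solves h ν f = ∀ n → τ h f n + τ (- h) f n ≡ ν n

Solves-parity : ∀ {h e ν f} → (∀ n → alternate ν n ≡ e * ν n) → Solves h ν f → ∀ n → alternate f n ≡ e * f n
Solves-parity {h} {e} {ν} {f} parity sol n = begin
  alternate f n                  ≡⟨ split e (f n) (alternate f n) ⟩
  ((- e) * f n + alternate f n) + e * f n ≡⟨ cong (_+ e * f n) (τ-sum-zero⇒0 h (- h) g zeros n) ⟩
  0ℚ + e * f n                   ≡⟨ ℚ.+-identityˡ _ ⟩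
  e * f n                        ∎
  where
  split : ∀ e x y → y ≡ ((- e) * x + y) + e * x
  split = solve-∀ ℚring
  g : ℕ → ℚ
  g k = (- e) * f k + alternate f k
  regroup : ∀ e x y z w → ((- e) * x + z) + ((- e) * y + w) ≡ (- e) * (x + y) + (1ℚ * w + z)
  regroup = solve-∀ ℚring
  cancel : ∀ e x → (- e) * x + e * x ≡ 0ℚ
  cancel = solve-∀ ℚring
  zeros : ∀ n → τ h g n + τ (- h) g n ≡ 0ℚ
  zeros n = begin
    τ h g n + τ (- h) g n
      ≡⟨ cong₂ _+_ (τ-linear h (- e) f (alternate f) n) (τ-linear (- h) (- e) f (alternate f) n) ⟩
    ((- e) * τ h f n + τ h (alternate f) n) + ((- e) * τ (- h) f n + τ (- h) (alternate f) n)
      ≡⟨ regroup e (τ h f n) (τ (- h) f n) (τ h (alternate f) n) (τ (- h) (alternate f) n) ⟩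
    (- e) * (τ h f n + τ (- h) f n) + (1ℚ * τ (- h) (alternate f) n + τ h (alternate f) n)
      ≡⟨ cong₂ (λ x y → (- e) * x + y) (sol n) (cong₂ (λ x y → 1ℚ * x + y) (τ-alternate (- h) h (sym (neg-involutive h)) f n) (τ-alternate h (- h) refl f n)) ⟩
    (- e) * ν n + (1ℚ * alternate (τ h f) n + alternate (τ (- h) f) n)
      ≡⟨ cong (_+_ ((- e) * ν n)) (trans (sym (alternate-linear 1ℚ (τ h f) (τ (- h) f) n)) (alternate-cong (λ k → trans (cong (_+ τ (- h) f k) (ℚ.*-identityˡ (τ h f k))) (sol k)) n)) ⟩
    (- e) * ν n + alternate ν n
      ≡⟨ cong (_+_ ((- e) * ν n)) (parity n) ⟩
    (- e) * ν n + e * ν n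
      ≡⟨ cancel e (ν n) ⟩
    0ℚ ∎

-- Continuous dual Hahn polynomials

module Family (h σ c₀ : ℚ) where

  progression : ℚ → ℕ → ℚ
  progression b zero    = b
  progression b (suc k) = progression b k + (h + h)

  -- With σ = s², `a k` is the value of y² - (c_k + h)² at y = ±s, and `d k` is the distance 2hk
  -- from c_0 to c_k.
  c d a : ℕ → ℚ
  c = progression c₀
  d = progression 0ℚ
  a k = σ - (c k + h) * (c k + h)

  c-+ : ∀ m k → c (m ℕ.+ k) ≡ c k + d m
  c-+ zero    k = sym (ℚ.+-identityʳ (c k))
  c-+ (suc m) k = trans (cong (_+ (h + h)) (c-+ m k)) (ℚ.+-assoc (c k) (d m) (h + h))

  -- If `f` lists the moments of a functional, this is its value on yⁿ ∏_{i<k} (y² - c_i²).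
  φ : (ℕ → ℚ) → ℕ → ℕ → ℚ
  φ f zero    n = f n
  φ f (suc k) n = φ f k (suc (suc n)) - c k * c k * φ f k n

  φ-shift : ∀ f k n → φ (f ∘ suc) k n ≡ φ f k (suc n)
  φ-shift f zero    n = refl
  φ-shift f (suc k) n = cong₂ (λ x y → x - c k * c k * y) (φ-shift f k (suc (suc n))) (φ-shift f k n)

  φ-vanishing : ∀ f → (∀ j → f (double j) ≡ 0ℚ) → ∀ k j → φ f k (double j) ≡ 0ℚ
  φ-vanishing f f≡0 zero    j = f≡0 j
  φ-vanishing f f≡0 (suc k) j = trans
    (cong₂ (λ x y → x - c k * c k * y) (φ-vanishing f f≡0 k (suc j)) (φ-vanishing f f≡0 k j)) (0-x*0≡0 (c k * c k))

  -- F f m k = Σⱼ (−1)^(m−j) C(m,j) a_{k+j} ⋯ a_{k+m−1} φ f (k+j): up to scaling, the m-th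
  -- difference at k of j ↦ φ f j / (a₀ ⋯ a_{j−1}).
  F : (ℕ → ℚ) → ℕ → ℕ → ℕ → ℚ
  F f zero    k n = φ f k n
  F f (suc m) k n = F f m (suc k) n - a (m ℕ.+ k) * F f m k n

  F-shift : ∀ f m k n → F (f ∘ suc) m k n ≡ F f m k (suc n)
  F-shift f zero    k n = φ-shift f k n
  F-shift f (suc m) k n = cong₂ (λ x y → x - a (m ℕ.+ k) * y) (F-shift f m (suc k) n) (F-shift f m k n)

  F-vanishing : ∀ f → (∀ j → f (double j) ≡ 0ℚ) → ∀ m k j → F f m k (double j) ≡ 0ℚ
  F-vanishing f f≡0 zero    k j = φ-vanishing f f≡0 k j
  F-vanishing f f≡0 (suc m) k j = trans
    (cong₂ (λ x y → x - a (m ℕ.+ k) * y) (F-vanishing f f≡0 m (suc k) j) (F-vanishing f f≡0 m k j)) (0-x*0≡0 (a (m ℕ.+ k)))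

  -- The hypothesis makes the rescaled sequence φ_j/(a_0 ⋯ a_{j-1}) constant, so its differences
  -- vanish. With denominators cleared, no `a k` has to be nonzero.
  F-at-0 : ∀ f → (∀ k → φ f (suc k) 0 ≡ a k * φ f k 0) → ∀ m k → F f (suc m) k 0 ≡ 0ℚ
  F-at-0 f φ-ratio zero    k = trans (cong (_- a k * φ f k 0) (φ-ratio k)) (ℚ.+-inverseʳ (a k * φ f k 0))
  F-at-0 f φ-ratio (suc m) k = trans
    (cong₂ (λ x y → x - a (suc m ℕ.+ k) * y) (F-at-0 f φ-ratio m (suc k)) (F-at-0 f φ-ratio m k)) (0-x*0≡0 (a (suc m ℕ.+ k)))

  F⁻ : (ℕ → ℚ) → ℕ → ℕ → ℕ → ℚ
  F⁻ f m k = previous (λ m → F f m k) m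

  -- The factor d_m² is essential at m = 0: there `F⁻` is zero by convention and the relation
  -- without the factor would fail, but d_0 = 0.
  F⁻-step : ∀ f m k n →
    d m * d m * F⁻ f m (suc k) n ≡ d m * d m * (F f m k n + a (ℕ.pred m ℕ.+ k) * F⁻ f m k n)
  F⁻-step f zero    k n = zeros (φ f k n) (a k)
    where
    zeros : ∀ x y → 0ℚ * 0ℚ * 0ℚ ≡ 0ℚ * 0ℚ * (x + y * 0ℚ)
    zeros = solve-∀ ℚring
  F⁻-step f (suc m) k n = cong (d (suc m) * d (suc m) *_) (split (F f m (suc k) n) (a (m ℕ.+ k) * F f m k n))
    where
    split : ∀ x y → x ≡ x - y + y
    split = solve-∀ ℚring

  -- Induction on `m` with `k` free. For m = 0 this is the definition of `φ`. Once c_{m+k} is split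
  -- as c_k + d_m, the inductive step is a polynomial identity in the values at k, k + 1, k + 2 and
  -- the value of degree one less.
  F-recurrence : ∀ f m k n → F f m k (suc (suc n))
    ≡ F f m (suc k) n + c k * c k * F f m k n - d m * d m * F⁻ f m (suc k) n
  F-recurrence f zero    k n = rearrange (φ f k (suc (suc n))) (c k * c k * φ f k n)
    where
    rearrange : ∀ x y → x ≡ (x - y) + y - 0ℚ * 0ℚ * 0ℚ
    rearrange = solve-∀ ℚring
  F-recurrence f (suc m) k n = begin
    F f m (suc k) (suc (suc n)) - a (m ℕ.+ k) * F f m k (suc (suc n))
      ≡⟨ cong₂ (λ x y → x - a (m ℕ.+ k) * y) (F-recurrence f m (suc k) n) (F-recurrence f m k n) ⟩
    (F₂ + c (suc k) * c (suc k) * F₁ - d m * d m * F⁻ f m (suc (suc k)) n)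
      - a (m ℕ.+ k) * (F₁ + c k * c k * F₀ - d m * d m * F⁻₁)
      ≡⟨ cong₂ (λ x y → (F₂ + c (suc k) * c (suc k) * F₁ - x) - y * (F₁ + c k * c k * F₀ - d m * d m * F⁻₁)) step A≡ ⟩
    (F₂ + c (suc k) * c (suc k) * F₁ - d m * d m * (F₁ + A * F⁻₁))
      - A * (F₁ + c k * c k * F₀ - d m * d m * F⁻₁)
      ≡⟨ algebra h σ (c k) (d m) F₂ F₁ F₀ F⁻₁ ⟩
    (F₂ - A′ * F₁) + c k * c k * (F₁ - A * F₀) - d (suc m) * d (suc m) * F₁
      ≡⟨ cong₂ (λ x y → (F₂ - x * F₁) + c k * c k * (F₁ - y * F₀) - d (suc m) * d (suc m) * F₁) A′≡ A≡ ⟨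
    F f (suc m) (suc k) n + c k * c k * F f (suc m) k n - d (suc m) * d (suc m) * F₁ ∎
    where
    F₂ = F f m (suc (suc k)) n
    F₁ = F f m (suc k) n
    F₀ = F f m k n
    F⁻₁ = F⁻ f m (suc k) n
    A = σ - (c k + d m + h) * (c k + d m + h)
    A′ = σ - (c k + (h + h) + d m + h) * (c k + (h + h) + d m + h)
    A≡ : a (m ℕ.+ k) ≡ A
    A≡ = cong (λ x → σ - (x + h) * (x + h)) (c-+ m k)
    A′≡ : a (m ℕ.+ suc k) ≡ A′
    A′≡ = cong (λ x → σ - (x + h) * (x + h)) (c-+ m (suc k))
    pred-index : ∀ m → d m * d m * (a (ℕ.pred m ℕ.+ suc k) * F⁻ f m (suc k) n) ≡ d m * d m * (a (m ℕ.+ k) * F⁻ f m (suc k) n)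
    pred-index zero    = zeros (a (suc k)) (a k)
      where
      zeros : ∀ x y → 0ℚ * 0ℚ * (x * 0ℚ) ≡ 0ℚ * 0ℚ * (y * 0ℚ)
      zeros = solve-∀ ℚring
    pred-index (suc m) = cong (λ i → d (suc m) * d (suc m) * (a i * F f m (suc k) n)) (ℕ.+-suc m k)
    step : d m * d m * F⁻ f m (suc (suc k)) n ≡ d m * d m * (F₁ + A * F⁻₁)
    step = begin
      d m * d m * F⁻ f m (suc (suc k)) n                               ≡⟨ F⁻-step f m (suc k) n ⟩
      d m * d m * (F₁ + a (ℕ.pred m ℕ.+ suc k) * F⁻₁)                  ≡⟨ ℚ.*-distribˡ-+ (d m * d m) F₁ _ ⟩
      d m * d m * F₁ + d m * d m * (a (ℕ.pred m ℕ.+ suc k) * F⁻₁)      ≡⟨ cong (_+_ (d m * d m * F₁)) (pred-index m) ⟩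
      d m * d m * F₁ + d m * d m * (a (m ℕ.+ k) * F⁻₁)                 ≡⟨ ℚ.*-distribˡ-+ (d m * d m) F₁ _ ⟨
      d m * d m * (F₁ + a (m ℕ.+ k) * F⁻₁)                             ≡⟨ cong (λ x → d m * d m * (F₁ + x * F⁻₁)) A≡ ⟩
      d m * d m * (F₁ + A * F⁻₁)                                       ∎
    algebra : ∀ h σ c d F₂ F₁ F₀ F⁻ →
      (F₂ + (c + (h + h)) * (c + (h + h)) * F₁ - d * d * (F₁ + (σ - (c + d + h) * (c + d + h)) * F⁻))
        - (σ - (c + d + h) * (c + d + h)) * (F₁ + c * c * F₀ - d * d * F⁻)
      ≡ (F₂ - (σ - (c + (h + h) + d + h) * (c + (h + h) + d + h)) * F₁)
        + c * c * (F₁ - (σ - (c + d + h) * (c + d + h)) * F₀) - (d + (h + h)) * (d + (h + h)) * F₁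
    algebra = solve-∀ ℚring

  F-1 : ∀ f m n → F f m 1 n ≡ F f (suc m) 0 n + a m * F f m 0 n
  F-1 f m n = begin
    F f m 1 n                                                     ≡⟨ split (F f m 1 n) (a m * F f m 0 n) ⟩
    F f m 1 n - a m * F f m 0 n + a m * F f m 0 n                 ≡⟨ cong (λ i → F f m 1 n - a i * F f m 0 n + a m * F f m 0 n) (ℕ.+-identityʳ m) ⟨
    F f m 1 n - a (m ℕ.+ 0) * F f m 0 n + a m * F f m 0 n         ∎
    where
    split : ∀ x y → x ≡ x - y + y
    split = solve-∀ ℚring

  module _ (y f κ : ℕ → ℚ) (y-shift : ∀ n → y (suc n) ≡ c₀ * f n)
    (κ-shift : ∀ n → κ (suc (suc n)) ≡ σ * κ n)
    (sol : ∀ n → τ h (λ k → f k + y k) n + τ (- h) (λ k → f k - y k) n ≡ κ n) where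

    -- With E the shift, φ f k ± Y k = ∏_{i<k} ((E ± h)² − (cᵢ + h)²) (f ± y).
    Y : ℕ → ℕ → ℚ
    Y zero    n = y n
    Y (suc k) n = (c k + (h + h)) * (φ f k (suc n) - c k * Y k n)

    -- `Y k` plays the role of c_k E⁻¹ φ_k, so that φ_k ± Y_k is the telescoped product (E ± c_k)
    -- E⁻¹ φ_k. Expanding c_{k+1} E⁻¹ (E² - c_k²) φ_k gives the recursion for `Y` without inverting
    -- the shift.
    Y-shift : ∀ k n → Y k (suc n) ≡ c k * φ f k n
    Y-shift zero    n = y-shift n
    Y-shift (suc k) n = cong ((c k + (h + h)) *_) (trans (cong (λ x → φ f k (suc (suc n)) - c k * x) (Y-shift k n))
      (rearrange (φ f k (suc (suc n))) (c k) (φ f k n)))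
      where
      rearrange : ∀ x c y → x - c * (c * y) ≡ x - c * c * y
      rearrange = solve-∀ ℚring

    ρ : ℕ → ℚ
    ρ zero    = 1ℚ
    ρ (suc k) = a k * ρ k

    -- Multiplication by e^{ht} conjugates E + h into E, hence (E + h)² - (c + h)² into E² - (c +
    -- h)².
    τ-quadratic : ∀ h c X X′ →
      (∀ i → X′ i ≡ X (suc (suc i)) + (h + h) * X (suc i) - (c * c + c * (h + h)) * X i) →
      ∀ n → τ h X′ n ≡ τ h X (suc (suc n)) - (c + h) * (c + h) * τ h X n
    τ-quadratic h c X X′ X′≡ n = begin
      τ h X′ n
        ≡⟨ τ-cong refl (λ i → trans (X′≡ i) (combine (h + h) (c * c + c * (h + h)) (X (suc (suc i))) (X (suc i)) (X i))) n ⟩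
      τ h (λ i → (h + h) * X (suc i) + ((- (c * c + c * (h + h))) * X i + X (suc (suc i)))) n
        ≡⟨ trans (τ-linear h (h + h) (X ∘ suc) _ n) (cong (_+_ ((h + h) * τ h (X ∘ suc) n)) (τ-linear h (- (c * c + c * (h + h))) X (X ∘ suc ∘ suc) n)) ⟩
      (h + h) * τ h (X ∘ suc) n + ((- (c * c + c * (h + h))) * τ h X n + τ h (X ∘ suc ∘ suc) n)
        ≡⟨ rearrange h c (τ h (X ∘ suc ∘ suc) n) (τ h (X ∘ suc) n) (τ h X n) ⟩
      (τ h (X ∘ suc ∘ suc) n + h * τ h (X ∘ suc) n) + h * (τ h (X ∘ suc) n + h * τ h X n) - (c + h) * (c + h) * τ h X n ∎
      where
      combine : ∀ p q x₂ x₁ x₀ → x₂ + p * x₁ - q * x₀ ≡ p * x₁ + ((- q) * x₀ + x₂)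
      combine = solve-∀ ℚring
      rearrange : ∀ h c x₂ x₁ x₀ → (h + h) * x₁ + ((- (c * c + c * (h + h))) * x₀ + x₂)
        ≡ (x₂ + h * x₁) + h * (x₁ + h * x₀) - (c + h) * (c + h) * x₀
      rearrange = solve-∀ ℚring

    -- After the two conjugations both summands carry the same operator ∏ (E² - (c_i + h)²). It
    -- therefore acts on their sum `κ`, where E² is the scalar σ and each factor becomes a_i. The
    -- second summand uses -h and -c_k.
    φ±Y-sum : ∀ k n → τ h (λ i → φ f k i + Y k i) n + τ (- h) (λ i → φ f k i - Y k i) n ≡ ρ k * κ n
    φ±Y-sum zero    n = trans (sol n) (sym (ℚ.*-identityˡ (κ n)))
    φ±Y-sum (suc k) n = begin
      τ h (λ i → φ f (suc k) i + Y (suc k) i) n + τ (- h) (λ i → φ f (suc k) i - Y (suc k) i) n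
        ≡⟨ cong₂ _+_ (τ-quadratic h (c k) X⁺ _ X⁺-step n) (τ-quadratic (- h) (- c k) X⁻ _ X⁻-step n) ⟩
      (τ h X⁺ (suc (suc n)) - (c k + h) * (c k + h) * τ h X⁺ n)
        + (τ (- h) X⁻ (suc (suc n)) - (- c k + - h) * (- c k + - h) * τ (- h) X⁻ n)
        ≡⟨ regroup (c k) h (τ h X⁺ (suc (suc n))) (τ h X⁺ n) (τ (- h) X⁻ (suc (suc n))) (τ (- h) X⁻ n) ⟩
      (τ h X⁺ (suc (suc n)) + τ (- h) X⁻ (suc (suc n))) - (c k + h) * (c k + h) * (τ h X⁺ n + τ (- h) X⁻ n)
        ≡⟨ cong₂ (λ x y → x - (c k + h) * (c k + h) * y) (φ±Y-sum k (suc (suc n))) (φ±Y-sum k n) ⟩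
      ρ k * κ (suc (suc n)) - (c k + h) * (c k + h) * (ρ k * κ n)
        ≡⟨ cong (λ x → ρ k * x - (c k + h) * (c k + h) * (ρ k * κ n)) (κ-shift n) ⟩
      ρ k * (σ * κ n) - (c k + h) * (c k + h) * (ρ k * κ n)
        ≡⟨ factor (ρ k) σ (c k + h) (κ n) ⟩
      a k * ρ k * κ n ∎
      where
      X⁺ X⁻ : ℕ → ℚ
      X⁺ i = φ f k i + Y k i
      X⁻ i = φ f k i - Y k i
      regroup : ∀ c h x₂ x₀ y₂ y₀ → (x₂ - (c + h) * (c + h) * x₀) + (y₂ - (- c + - h) * (- c + - h) * y₀)
        ≡ (x₂ + y₂) - (c + h) * (c + h) * (x₀ + y₀)
      regroup = solve-∀ ℚring
      factor : ∀ ρ σ e κ → ρ * (σ * κ) - e * e * (ρ * κ) ≡ (σ - e * e) * ρ * κ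
      factor = solve-∀ ℚring
      identity⁺ : ∀ h c φ₂ φ₁ φ₀ Y₀ → (φ₂ - c * c * φ₀) + (c + (h + h)) * (φ₁ - c * Y₀)
        ≡ (φ₂ + c * φ₁) + (h + h) * (φ₁ + c * φ₀) - (c * c + c * (h + h)) * (φ₀ + Y₀)
      identity⁺ = solve-∀ ℚring
      identity⁻ : ∀ h c φ₂ φ₁ φ₀ Y₀ → (φ₂ - c * c * φ₀) - (c + (h + h)) * (φ₁ - c * Y₀)
        ≡ (φ₂ - c * φ₁) + (- h + - h) * (φ₁ - c * φ₀) - (- c * - c + - c * (- h + - h)) * (φ₀ - Y₀)
      identity⁻ = solve-∀ ℚring
      X⁺-step : ∀ i → φ f (suc k) i + Y (suc k) i
        ≡ X⁺ (suc (suc i)) + (h + h) * X⁺ (suc i) - (c k * c k + c k * (h + h)) * X⁺ i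
      X⁺-step i = trans (identity⁺ h (c k) (φ f k (suc (suc i))) (φ f k (suc i)) (φ f k i) (Y k i))
        (sym (cong₂ (λ u v → (φ f k (suc (suc i)) + u) + (h + h) * (φ f k (suc i) + v) - (c k * c k + c k * (h + h)) * X⁺ i)
          (Y-shift k (suc i)) (Y-shift k i)))
      X⁻-step : ∀ i → φ f (suc k) i - Y (suc k) i
        ≡ X⁻ (suc (suc i)) + (- h + - h) * X⁻ (suc i) - (- c k * - c k + - c k * (- h + - h)) * X⁻ i
      X⁻-step i = trans (identity⁻ h (c k) (φ f k (suc (suc i))) (φ f k (suc i)) (φ f k i) (Y k i))
        (sym (cong₂ (λ u v → (φ f k (suc (suc i)) - u) + (- h + - h) * (φ f k (suc i) - v) - (- c k * - c k + - c k * (- h + - h)) * X⁻ i)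
          (Y-shift k (suc i)) (Y-shift k i)))

    -- At index 0 both `τ` are the identity and the `Y` terms cancel, leaving twice the value
    -- sought.
    φ-ratio : ∀ k → φ f (suc k) 0 ≡ a k * φ f k 0
    φ-ratio k = x+x≡y+y⇒x≡y (φ f (suc k) 0) (a k * φ f k 0) (begin
      φ f (suc k) 0 + φ f (suc k) 0          ≡⟨ twice (suc k) ⟩
      a k * ρ k * κ 0                        ≡⟨ ℚ.*-assoc (a k) (ρ k) (κ 0) ⟩
      a k * (ρ k * κ 0)                      ≡⟨ cong (a k *_) (twice k) ⟨
      a k * (φ f k 0 + φ f k 0)              ≡⟨ ℚ.*-distribˡ-+ (a k) (φ f k 0) (φ f k 0) ⟩
      a k * φ f k 0 + a k * φ f k 0          ∎)
      where
      regroup : ∀ x y → x + x ≡ (x + y) + (x - y)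
      regroup = solve-∀ ℚring
      twice : ∀ k → φ f k 0 + φ f k 0 ≡ ρ k * κ 0
      twice k = trans (regroup (φ f k 0) (Y k 0)) (φ±Y-sum k 0)

-- From the character sum to the functional equation

τ-+ : ∀ a f g n → τ a (λ k → f k + g k) n ≡ τ a f n + τ a g n
τ-+ a f g n = begin
  τ a (λ k → f k + g k) n       ≡⟨ τ-cong refl (λ k → cong (_+ g k) (sym (ℚ.*-identityˡ (f k)))) n ⟩
  τ a (λ k → 1ℚ * f k + g k) n  ≡⟨ τ-linear a 1ℚ f g n ⟩
  1ℚ * τ a f n + τ a g n        ≡⟨ cong (_+ τ a g n) (ℚ.*-identityˡ (τ a f n)) ⟩
  τ a f n + τ a g n             ∎

τ-* : ∀ a b f n → τ a (λ k → b * f k) n ≡ b * τ a f n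
τ-* a b f n = begin
  τ a (λ k → b * f k) n                ≡⟨ τ-cong refl (λ k → sym (ℚ.+-identityʳ (b * f k))) n ⟩
  τ a (λ k → b * f k + 0ℚ) n           ≡⟨ τ-linear a b f (λ _ → 0ℚ) n ⟩
  b * τ a f n + τ a (λ _ → 0ℚ) n       ≡⟨ cong (_+_ (b * τ a f n)) (τ-leading a (λ _ → 0ℚ) n (λ _ _ → refl)) ⟩
  b * τ a f n + 0ℚ                     ≡⟨ ℚ.+-identityʳ (b * τ a f n) ⟩
  b * τ a f n                          ∎

module FromCharacterSum (h s e q⁻¹ : ℚ) (h≡1+s : h ≡ 1ℚ + s) (q⁻¹q≡1 : q⁻¹ * (h + h) ≡ 1ℚ) where

  w ν : ℕ → ℚ
  w n = 1ℚ ^ n + e * (h + s) ^ n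
  ν n = - ((- s) ^ n + e * s ^ n)

  τ-w : ∀ a n → τ a w n ≡ (a + 1ℚ) ^ n + e * (a + (h + s)) ^ n
  τ-w a n = trans (τ-+ a (1ℚ ^_) _ n) (cong₂ _+_ (τ-^ a 1ℚ n) (trans (τ-* a e ((h + s) ^_) n) (cong (e *_) (τ-^ a (h + s) n))))

  -- Cancels the factor e^{qt} − 1, q = 2h, from (e^{2qt} − 1) μ(t) = (1 − e^{qt}) w(t).
  solves : ∀ μ → (∀ n → τ ((h + h) + (h + h)) μ n ≡ μ n + (w n - τ (h + h) w n)) → Solves h ν μ
  solves μ eq n = begin
    τ h μ n + τ (- h) μ n
      ≡⟨ cong (_+ τ (- h) μ n) (trans (τ-cong (-h+2h h) (λ _ → refl) n) (sym (τ-∘ (- h) (h + h) μ n))) ⟩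
    τ (- h) (τ (h + h) μ) n + τ (- h) μ n
      ≡⟨ τ-+ (- h) (τ (h + h) μ) μ n ⟨
    τ (- h) (λ k → τ (h + h) μ k + μ k) n
      ≡⟨ τ-cong refl (λ k → trans (cancel-w (τ (h + h) μ k) (μ k) (w k)) (cong (λ z → z + (- 1ℚ) * w k) (residual≡0 k))) n ⟩
    τ (- h) (λ k → 0ℚ + (- 1ℚ) * w k) n
      ≡⟨ trans (τ-cong refl (λ k → ℚ.+-identityˡ ((- 1ℚ) * w k)) n) (τ-* (- h) (- 1ℚ) w n) ⟩
    (- 1ℚ) * τ (- h) w n
      ≡⟨ cong ((- 1ℚ) *_) (trans (τ-w (- h) n) (cong₂ (λ x y → x ^ n + e * y ^ n) -h+1≡-s (-h+h+s h s))) ⟩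
    (- 1ℚ) * ((- s) ^ n + e * s ^ n)
      ≡⟨ neg ((- s) ^ n + e * s ^ n) ⟩
    ν n ∎
    where
    -h+2h : ∀ h → h ≡ - h + (h + h)
    -h+2h = solve-∀ ℚring
    -h+h+s : ∀ h s → - h + (h + s) ≡ s
    -h+h+s = solve-∀ ℚring
    -[1+s]+1 : ∀ s → - (1ℚ + s) + 1ℚ ≡ - s
    -[1+s]+1 = solve-∀ ℚring
    -h+1≡-s : - h + 1ℚ ≡ - s
    -h+1≡-s = trans (cong (λ x → - x + 1ℚ) h≡1+s) (-[1+s]+1 s)
    neg : ∀ x → (- 1ℚ) * x ≡ - x
    neg = solve-∀ ℚring
    cancel-w : ∀ x y w → x + y ≡ (x + y + w) + (- 1ℚ) * w
    cancel-w = solve-∀ ℚring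
    residual : ℕ → ℚ
    residual k = τ (h + h) μ k + μ k + w k
    regroup : ∀ m w w′ t → (m + (w - w′)) + t + w′ ≡ t + m + w
    regroup = solve-∀ ℚring
    -- The residual is (e^{qt} + 1) μ + w, and the hypothesis says that e^{qt} - 1 annihilates it.
    residual≡0 : ∀ k → residual k ≡ 0ℚ
    residual≡0 = τ-fixed⇒0 (h + h) q⁻¹ q⁻¹q≡1 residual λ k → begin
      τ (h + h) residual k
        ≡⟨ trans (τ-+ (h + h) (λ k → τ (h + h) μ k + μ k) w k) (cong (_+ τ (h + h) w k) (τ-+ (h + h) (τ (h + h) μ) μ k)) ⟩
      τ (h + h) (τ (h + h) μ) k + τ (h + h) μ k + τ (h + h) w k
        ≡⟨ cong (λ x → x + τ (h + h) μ k + τ (h + h) w k) (trans (τ-∘ (h + h) (h + h) μ k) (eq k)) ⟩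
      (μ k + (w k - τ (h + h) w k)) + τ (h + h) μ k + τ (h + h) w k
        ≡⟨ regroup (μ k) (w k) (τ (h + h) w k) (τ (h + h) μ k) ⟩
      residual k ∎

  ν-shift : ∀ n → ν (suc (suc n)) ≡ s * s * ν n
  ν-shift n = rearrange s e ((- s) ^ n) (s ^ n)
    where
    rearrange : ∀ s e x y → - ((- s) * ((- s) * x) + e * (s * (s * y))) ≡ s * s * (- (x + e * y))
    rearrange = solve-∀ ℚring

  ν-parity : e * e ≡ 1ℚ → ∀ n → alternate ν n ≡ e * ν n
  ν-parity ee≡1 n = begin
    alternate ν n
      ≡⟨ alternate-cong (λ k → spread e ((- s) ^ k) (s ^ k)) n ⟩
    alternate (λ k → (- 1ℚ) * (- s) ^ k + ((- e) * s ^ k + 0ℚ * s ^ k)) n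
      ≡⟨ trans (alternate-linear (- 1ℚ) ((- s) ^_) _ n)
           (cong (_+_ ((- 1ℚ) * alternate ((- s) ^_) n)) (alternate-linear (- e) (s ^_) _ n)) ⟩
    (- 1ℚ) * alternate ((- s) ^_) n + ((- e) * alternate (s ^_) n + alternate (λ k → 0ℚ * s ^ k) n)
      ≡⟨ cong₂ (λ x y → (- 1ℚ) * x + ((- e) * y + alternate (λ k → 0ℚ * s ^ k) n))
           (trans (alternate-^ (- s) n) (cong (_^ n) (neg-involutive s))) (alternate-^ s n) ⟩
    (- 1ℚ) * s ^ n + ((- e) * (- s) ^ n + alternate (λ k → 0ℚ * s ^ k) n)
      ≡⟨ cong (λ z → (- 1ℚ) * s ^ n + ((- e) * (- s) ^ n + z)) (zero-part n) ⟩
    (- 1ℚ) * s ^ n + ((- e) * (- s) ^ n + 0ℚ)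
      ≡⟨ cong (λ x → (- x) * s ^ n + ((- e) * (- s) ^ n + 0ℚ)) ee≡1 ⟨
    (- (e * e)) * s ^ n + ((- e) * (- s) ^ n + 0ℚ)
      ≡⟨ collect e ((- s) ^ n) (s ^ n) ⟩
    e * ν n ∎
    where
    spread : ∀ e x y → - (x + e * y) ≡ (- 1ℚ) * x + ((- e) * y + 0ℚ * y)
    spread = solve-∀ ℚring
    collect : ∀ e x y → (- (e * e)) * y + ((- e) * x + 0ℚ) ≡ e * (- (x + e * y))
    collect = solve-∀ ℚring
    zero-part : ∀ n → alternate (λ k → 0ℚ * s ^ k) n ≡ 0ℚ
    zero-part n = trans (alternate-cong (λ k → ℚ.*-zeroˡ (s ^ k)) n) (alternate-0 n)

-- The orthogonal towers for odd and even functionals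

neg-one-fixed⇒0 : ∀ x → x ≡ (- 1ℚ) * x → x ≡ 0ℚ
neg-one-fixed⇒0 x eq = x+x≡0⇒x≡0 x (trans (cong (_+_ x) eq) (cancel x))
  where
  cancel : ∀ x → x + (- 1ℚ) * x ≡ 0ℚ
  cancel = solve-∀ ℚring

-- The case ν(t) = e^{st} − e^{-st}.
module SinhTower (h s : ℚ) (μ ν : ℕ → ℚ) (sol : Solves h ν μ)
  (ν-shift : ∀ n → ν (suc (suc n)) ≡ s * s * ν n) (μ-odd : ∀ n → alternate μ n ≡ (- 1ℚ) * μ n) where
  open Family h (s * s) h public

  -- The value L(y^{2m+1} P_m); its ratio is the last coefficient of the three-term recurrence in
  -- y².
  lead : ℕ → ℚ
  lead zero    = μ 1
  lead (suc m) = - (d (suc m) * d (suc m)) * (a m * lead m)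

  μ-double : ∀ j → μ (double j) ≡ 0ℚ
  μ-double j = neg-one-fixed⇒0 (μ (double j)) (trans (sym (alternate-double μ j)) (μ-odd (double j)))

  A : ℕ → ℕ → ℚ
  A m n = F μ m 0 n

  -- `F-recurrence` at k = 0 leads to k = 1; the defining difference relation, used once for each of
  -- the two terms, brings everything back to k = 0.
  A-recurrence : ∀ m n → A m (suc (suc n))
    ≡ A (suc m) n + ((a m + h * h - d m * d m) * A m n + (- (d m * d m * a (ℕ.pred m ℕ.+ 0))) * previous A m n)
  A-recurrence m n = begin
    A m (suc (suc n))
      ≡⟨ F-recurrence μ m 0 n ⟩
    F μ m 1 n + h * h * A m n - d m * d m * F⁻ μ m 1 n
      ≡⟨ cong₂ (λ x y → x + h * h * A m n - y) (F-1 μ m n) (F⁻-step μ m 0 n) ⟩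
    (A (suc m) n + a m * A m n) + h * h * A m n - d m * d m * (A m n + a (ℕ.pred m ℕ.+ 0) * previous A m n)
      ≡⟨ rearrange (A (suc m) n) (A m n) (previous A m n) (a m) (h * h) (d m * d m) (a (ℕ.pred m ℕ.+ 0)) ⟩
    A (suc m) n + ((a m + h * h - d m * d m) * A m n + (- (d m * d m * a (ℕ.pred m ℕ.+ 0))) * previous A m n) ∎
    where
    rearrange : ∀ x y z a h d b → (x + a * y) + h * y - d * (y + b * z) ≡ x + ((a + h - d) * y + (- (d * b)) * z)
    rearrange = solve-∀ ℚring

  -- Here the functional is p ↦ L(y p), with moments `μ ∘ suc`. With c_0 = h the two summands are (E
  -- ± h) μ, and τ with ±h turns E ± h into a shift, so the required hypothesis is `sol` one index
  -- later.
  A-at-1 : ∀ m → A (suc m) 1 ≡ 0ℚ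
  A-at-1 m = trans (sym (F-shift μ (suc m) 0 0)) (F-at-0 (μ ∘ suc)
    (φ-ratio (λ n → h * μ n) (μ ∘ suc) (ν ∘ suc) (λ _ → refl) (ν-shift ∘ suc) sol-suc) m 0)
    where
    sol-suc : ∀ n → τ h (λ k → μ (suc k) + h * μ k) n + τ (- h) (λ k → μ (suc k) - h * μ k) n ≡ ν (suc n)
    sol-suc n = trans (cong₂ _+_
      (trans (τ-+ h (μ ∘ suc) (λ k → h * μ k) n) (cong (_+_ (τ h (μ ∘ suc) n)) (τ-* h h μ n)))
      (trans (τ-cong refl (λ k → neg (μ (suc k)) h (μ k)) n) (trans (τ-+ (- h) (μ ∘ suc) (λ k → (- h) * μ k) n) (cong (_+_ (τ (- h) (μ ∘ suc) n)) (τ-* (- h) (- h) μ n)))))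
      (sol (suc n))
      where
      neg : ∀ x h y → x - h * y ≡ x + (- h) * y
      neg = solve-∀ ℚring

  zeros : ∀ x y → 0ℚ + (x * 0ℚ + y * 0ℚ) ≡ 0ℚ
  zeros = solve-∀ ℚring

  -- Even powers start from parity and odd powers from `A-at-1`. Trading two powers of y for one
  -- step in `m` respects the bound 2m + 1.
  A-vanishing : ∀ i m → i ℕ.< suc (double m) → A m i ≡ 0ℚ
  A-vanishing zero          m       _   = F-vanishing μ μ-double m 0 0
  A-vanishing (suc zero)    zero    (s≤s ())
  A-vanishing (suc zero)    (suc m) _   = A-at-1 m
  A-vanishing (suc (suc i)) zero    (s≤s ())
  A-vanishing (suc (suc i)) (suc m) i<m = begin
    A (suc m) (suc (suc i))   ≡⟨ A-recurrence (suc m) i ⟩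
    A (suc (suc m)) i + (α * A (suc m) i + β * A m i)
      ≡⟨ cong₂ (λ x y → x + y) (A-vanishing i (suc (suc m)) (up (up i<m′)))
           (cong₂ (λ y z → α * y + β * z) (A-vanishing i (suc m) (up i<m′)) (A-vanishing i m i<m′)) ⟩
    0ℚ + (α * 0ℚ + β * 0ℚ)    ≡⟨ zeros α β ⟩
    0ℚ                        ∎
    where
    α = a (suc m) + h * h - d (suc m) * d (suc m)
    β = - (d (suc m) * d (suc m) * a (m ℕ.+ 0))
    i<m′ : i ℕ.< suc (double m)
    i<m′ = s<s⁻¹ (s<s⁻¹ i<m)
    up : ∀ {n} → i ℕ.< n → i ℕ.< suc (suc n)
    up = ℕ.m≤n⇒m≤1+n ∘ ℕ.m≤n⇒m≤1+n

  A-lead : ∀ m → A m (suc (double m)) ≡ lead m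
  A-lead zero    = refl
  A-lead (suc m) = begin
    A (suc m) (suc (suc n))   ≡⟨ A-recurrence (suc m) n ⟩
    A (suc (suc m)) n + (α * A (suc m) n + (- (d (suc m) * d (suc m) * a (m ℕ.+ 0))) * A m n)
      ≡⟨ cong₂ (λ x y → x + (α * y + (- (d (suc m) * d (suc m) * a (m ℕ.+ 0))) * A m n))
           (A-vanishing n (suc (suc m)) (s<s (up (ℕ.m≤n⇒m≤1+n ℕ.≤-refl))))
           (A-vanishing n (suc m) (s<s (ℕ.m≤n⇒m≤1+n ℕ.≤-refl))) ⟩
    0ℚ + (α * 0ℚ + (- (d (suc m) * d (suc m) * a (m ℕ.+ 0))) * A m n)
      ≡⟨ cong₂ (λ i y → 0ℚ + (α * 0ℚ + (- (d (suc m) * d (suc m) * a i)) * y)) (ℕ.+-identityʳ m) (A-lead m) ⟩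
    0ℚ + (α * 0ℚ + (- (d (suc m) * d (suc m) * a m)) * lead m)
      ≡⟨ rearrange α (d (suc m) * d (suc m)) (a m) (lead m) ⟩
    lead (suc m) ∎
    where
    n = suc (double m)
    up : ∀ {i n} → i ℕ.< n → i ℕ.< suc (suc n)
    up = ℕ.m≤n⇒m≤1+n ∘ ℕ.m≤n⇒m≤1+n
    α = a (suc m) + h * h - d (suc m) * d (suc m)
    rearrange : ∀ α d a l → 0ℚ + (α * 0ℚ + (- (d * a)) * l) ≡ - d * (a * l)
    rearrange = solve-∀ ℚring

  tower : Tower μ
  tower = record
    { F      = A
    ; G      = λ m n → A m (suc n)
    ; p      = λ _ → 0ℚ
    ; α      = λ m → a m + h * h - d m * d m
    ; β      = λ m → - (d m * d m * a (ℕ.pred m ℕ.+ 0))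
    ; F-0    = λ _ → refl
    ; F-step = λ m n → add-0 (A m (suc n)) (previous (λ m n → A m (suc n)) m n)
    ; G-step = A-recurrence
    ; F-stag = λ m i i<m → A-vanishing i m (ℕ.m≤n⇒m≤1+n i<m)
    ; G-stag = λ m i i<m → A-vanishing (suc i) m (s<s i<m)
    ; corner = λ m → inj₁ (A-vanishing (double m) m ℕ.≤-refl)
    }
    where
    add-0 : ∀ x y → x ≡ x + 0ℚ * y
    add-0 = solve-∀ ℚring

  open Tower tower using (block)

  F-diagonal : ∀ m → A m (double m) ≡ 0ℚ
  F-diagonal m = A-vanishing (double m) m ℕ.≤-refl

  block-lead : ∀ m → block m ≡ - (lead m * lead m)
  block-lead m = trans (cong₂ (λ x y → x * A m (suc (suc (double m))) - y * y) (F-diagonal m) (A-lead m))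
    (rearrange (A m (suc (suc (double m)))) (lead m))
    where
    rearrange : ∀ x l → 0ℚ * x - l * l ≡ - (l * l)
    rearrange = solve-∀ ℚring

-- The case ν(t) = −(e^{st} + e^{-st}).
module CoshTower (h s : ℚ) (μ ν : ℕ → ℚ) (sol : Solves h ν μ)
  (ν-shift : ∀ n → ν (suc (suc n)) ≡ s * s * ν n) (μ-even : ∀ n → alternate μ n ≡ 1ℚ * μ n) where
  open Family h (s * s) 0ℚ public

  lead : ℕ → ℚ
  lead zero    = μ 0
  lead (suc m) = - (d (suc m) * d (suc m)) * (a m * lead m)

  μ-suc-double : ∀ j → μ (suc (double j)) ≡ 0ℚ
  μ-suc-double j = neg-one-fixed⇒0 (μ (suc (double j))) (begin
    μ (suc (double j))                         ≡⟨ ℚ.*-identityˡ _ ⟨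
    1ℚ * μ (suc (double j))                    ≡⟨ μ-even (suc (double j)) ⟨
    - alternate (μ ∘ suc) (double j)           ≡⟨ cong -_ (alternate-double (μ ∘ suc) j) ⟩
    - μ (suc (double j))                       ≡⟨ neg (μ (suc (double j))) ⟩
    (- 1ℚ) * μ (suc (double j))                ∎)
    where
    neg : ∀ x → - x ≡ (- 1ℚ) * x
    neg = solve-∀ ℚring

  -- As c_0 = 0, every polynomial at k = 1 is divisible by y². `B m` belongs to the odd monic
  -- polynomial obtained by dividing the m-th of them by y, as `B-suc` confirms; the recursion reads
  -- y P_m = B_m - d_m² B_{m-1}.
  A B : ℕ → ℕ → ℚ
  A m n = F μ m 0 n
  B zero    n = A 0 (suc n)
  B (suc m) n = A (suc m) (suc n) + d (suc m) * d (suc m) * B m n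

  A-step : ∀ m n → A m (suc n) ≡ B m n + (- (d m * d m)) * previous B m n
  A-step zero    n = add-0 (A 0 (suc n)) 
    where
    add-0 : ∀ x → x ≡ x + (- (0ℚ * 0ℚ)) * 0ℚ
    add-0 = solve-∀ ℚring
  A-step (suc m) n = split (A (suc m) (suc n)) (d (suc m) * d (suc m)) (B m n)
    where
    split : ∀ x d y → x ≡ (x + d * y) + (- d) * y
    split = solve-∀ ℚring

  B-suc : ∀ m n → B m (suc n) ≡ F μ m 1 n
  B-suc zero    n = trans (F-recurrence μ 0 0 n) (drop (F μ 0 1 n) (A 0 n))
    where
    drop : ∀ x y → x + 0ℚ * 0ℚ * y - 0ℚ * 0ℚ * 0ℚ ≡ x
    drop = solve-∀ ℚring
  B-suc (suc m) n = trans (cong₂ (λ x y → x + d (suc m) * d (suc m) * y) (F-recurrence μ (suc m) 0 n) (B-suc m n))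
    (drop (F μ (suc m) 1 n) (A (suc m) n) (d (suc m) * d (suc m)) (F μ m 1 n))
    where
    drop : ∀ x y d z → (x + 0ℚ * 0ℚ * y - d * z) + d * z ≡ x
    drop = solve-∀ ℚring

  B-step : ∀ m n → B m (suc n) ≡ A (suc m) n + (a m * A m n + 0ℚ * previous A m n)
  B-step m n = trans (B-suc m n) (trans (F-1 μ m n) (add-0 (A (suc m) n) (a m * A m n) (previous A m n)))
    where
    add-0 : ∀ x y z → x + y ≡ x + (y + 0ℚ * z)
    add-0 = solve-∀ ℚring

  -- Because c_0 = 0, the auxiliary sequence is zero and the functional equation of `μ` applies
  -- unchanged.
  A-at-0 : ∀ m → A (suc m) 0 ≡ 0ℚ
  A-at-0 m = F-at-0 μ (φ-ratio (λ _ → 0ℚ) μ ν (λ n → sym (ℚ.*-zeroˡ (μ n))) ν-shift sol′) m 0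
    where
    sol′ : ∀ n → τ h (λ k → μ k + 0ℚ) n + τ (- h) (λ k → μ k - 0ℚ) n ≡ ν n
    sol′ n = trans (cong₂ _+_ (τ-cong refl (λ k → ℚ.+-identityʳ (μ k)) n) (τ-cong refl (λ k → ℚ.+-identityʳ (μ k)) n)) (sol n)

  A-at-1 : ∀ m → A m 1 ≡ 0ℚ
  A-at-1 m = trans (sym (F-shift μ m 0 0)) (F-vanishing (μ ∘ suc) μ-suc-double m 0 0)

  B-at-0 : ∀ m → B m 0 ≡ 0ℚ
  B-at-0 zero    = A-at-1 0
  B-at-0 (suc m) = trans (cong₂ (λ x y → x + d (suc m) * d (suc m) * y) (A-at-1 (suc m)) (B-at-0 m)) (0+x*0≡0 (d (suc m) * d (suc m)))

  -- Simultaneous induction on the power: one factor y leads from `A` to `B` and from `B` back to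
  -- `A`, with the bounds 2m and 2m + 1 falling in step.
  A-vanishing : ∀ i m → i ℕ.< double m → A m i ≡ 0ℚ
  B-vanishing : ∀ i m → i ℕ.< suc (double m) → B m i ≡ 0ℚ

  A-vanishing zero    (suc m) _   = A-at-0 m
  A-vanishing (suc i) (suc m) i<m = begin
    A (suc m) (suc i)       ≡⟨ A-step (suc m) i ⟩
    B (suc m) i + (- (d (suc m) * d (suc m))) * B m i
      ≡⟨ cong₂ (λ x y → x + (- (d (suc m) * d (suc m))) * y)
           (B-vanishing i (suc m) (ℕ.m≤n⇒m≤1+n (ℕ.<⇒≤ i<m))) (B-vanishing i m (s<s⁻¹ i<m)) ⟩
    0ℚ + (- (d (suc m) * d (suc m))) * 0ℚ   ≡⟨ 0+x*0≡0 (- (d (suc m) * d (suc m))) ⟩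
    0ℚ ∎

  B-vanishing zero    m _   = B-at-0 m
  B-vanishing (suc i) m i<m = begin
    B m (suc i)             ≡⟨ trans (B-suc m i) (F-1 μ m i) ⟩
    A (suc m) i + a m * A m i
      ≡⟨ cong₂ (λ x y → x + a m * y) (A-vanishing i (suc m) (ℕ.m≤n⇒m≤1+n (ℕ.<⇒≤ i<m))) (A-vanishing i m (s<s⁻¹ i<m)) ⟩
    0ℚ + a m * 0ℚ           ≡⟨ 0+x*0≡0 (a m) ⟩
    0ℚ                      ∎

  A-lead : ∀ m → A m (double m) ≡ lead m
  B-lead : ∀ m → B m (suc (double m)) ≡ a m * lead m

  A-lead zero    = refl
  A-lead (suc m) = begin
    A (suc m) (suc (suc (double m)))   ≡⟨ A-step (suc m) (suc (double m)) ⟩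
    B (suc m) (suc (double m)) + (- (d (suc m) * d (suc m))) * B m (suc (double m))
      ≡⟨ cong₂ (λ x y → x + (- (d (suc m) * d (suc m))) * y) (B-vanishing (suc (double m)) (suc m) (ℕ.m≤n⇒m≤1+n ℕ.≤-refl)) (B-lead m) ⟩
    0ℚ + (- (d (suc m) * d (suc m))) * (a m * lead m)
      ≡⟨ ℚ.+-identityˡ _ ⟩
    lead (suc m) ∎

  B-lead m = begin
    B m (suc (double m))                       ≡⟨ trans (B-suc m (double m)) (F-1 μ m (double m)) ⟩
    A (suc m) (double m) + a m * A m (double m)
      ≡⟨ cong₂ (λ x y → x + a m * y) (A-vanishing (double m) (suc m) (ℕ.m≤n⇒m≤1+n ℕ.≤-refl)) (A-lead m) ⟩
    0ℚ + a m * lead m                          ≡⟨ ℚ.+-identityˡ _ ⟩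
    a m * lead m                               ∎

  tower : Tower μ
  tower = record
    { F      = A
    ; G      = B
    ; p      = λ m → - (d m * d m)
    ; α      = a
    ; β      = λ _ → 0ℚ
    ; F-0    = λ _ → refl
    ; F-step = A-step
    ; G-step = B-step
    ; F-stag = λ m i i<m → A-vanishing i m i<m
    ; G-stag = λ m i i<m → B-vanishing i m (ℕ.m≤n⇒m≤1+n i<m)
    ; corner = λ m → inj₂ (B-vanishing (double m) m ℕ.≤-refl)
    }

  open Tower tower using (block)

  block-lead : ∀ m → block m ≡ lead m * (a m * lead m)
  block-lead m = begin
    A m (double m) * B m (suc (double m)) - B m (double m) * A m (suc (double m))
      ≡⟨ cong₂ _-_ (cong₂ _*_ (A-lead m) (B-lead m)) (cong (_* A m (suc (double m))) (B-vanishing (double m) m ℕ.≤-refl)) ⟩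
    lead m * (a m * lead m) - 0ℚ * A m (suc (double m))
      ≡⟨ rearrange (lead m * (a m * lead m)) (A m (suc (double m))) ⟩
    lead m * (a m * lead m) ∎
    where
    rearrange : ∀ x y → x - 0ℚ * y ≡ x
    rearrange = solve-∀ ℚring

open Exp (CommutativeRing.semiring ℚ.+-*-commutativeRing) using (^-homo-*; ^-assocʳ)
open CommutativeExp (CommutativeRing.commutativeSemiring ℚ.+-*-commutativeRing) using (^-distrib-*)

-- Product formulas

∏ : ℕ → (ℕ → ℚ) → ℚ
∏ n f = Sum.sum ℚ.*-1-commutativeMonoid {n} (f ∘ toℕ)

∏-last : ∀ f n → ∏ (suc n) f ≡ ∏ n f * f n
∏-last = sum-last ℚ.*-1-commutativeMonoid

-- In the final formulas, passing from m to m + 1 raises each exponent by 2 and appends one new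
-- factor.
∏-staircase : ∀ n t t′ x → (∀ i → i ℕ.< n → t′ i ≡ t i * (x i * x i)) →
  ∏ (suc n) t′ ≡ ∏ n t * (∏ n x * ∏ n x) * t′ n
∏-staircase n t t′ x step = trans (∏-last t′ n) (cong (_* t′ n) (go n t t′ x step))
  where
  rearrange : ∀ t x T X → (t * (x * x)) * (T * (X * X)) ≡ (t * T) * ((x * X) * (x * X))
  rearrange = solve-∀ ℚring
  go : ∀ n t t′ x → (∀ i → i ℕ.< n → t′ i ≡ t i * (x i * x i)) → ∏ n t′ ≡ ∏ n t * (∏ n x * ∏ n x)
  go zero    t t′ x step = refl
  go (suc n) t t′ x step = trans
    (cong₂ _*_ (step 0 z<s) (go n (t ∘ suc) (t′ ∘ suc) (x ∘ suc) (λ i i<n → step (suc i) (s<s i<n))))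
    (rearrange (t 0) (x 0) (∏ n (t ∘ suc)) (∏ n (x ∘ suc)))

1/!-suc : ∀ n → 1/! (suc n) ≡ 1/! n * (+ 1 / suc n)
1/!-suc n = begin
  1/! (suc n)                                ≡⟨ unit (1/! (suc n)) ⟩
  1/! (suc n) * (1ℚ * 1ℚ)                    ≡⟨ cong (1/! (suc n) *_) (cong₂ _*_ (fromℕ-!*1/! n) (fromℕ-*-recip (suc n))) ⟨
  1/! (suc n) * ((fromℕ (n !) * 1/! n) * (fromℕ (suc n) * r)) ≡⟨ rearrange (1/! (suc n)) (fromℕ (n !)) (1/! n) (fromℕ (suc n)) r ⟩
  (fromℕ (suc n) * fromℕ (n !)) * 1/! (suc n) * (1/! n * r) ≡⟨ cong (λ x → x * 1/! (suc n) * (1/! n * r)) (fromℕ-* (suc n) (n !)) ⟨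
  fromℕ (suc n !) * 1/! (suc n) * (1/! n * r) ≡⟨ cong (_* (1/! n * r)) (fromℕ-!*1/! (suc n)) ⟩
  1ℚ * (1/! n * r)                           ≡⟨ ℚ.*-identityˡ _ ⟩
  1/! n * r                                  ∎
  where
  r = + 1 / suc n
  unit : ∀ x → x ≡ x * (1ℚ * 1ℚ)
  unit = solve-∀ ℚring
  rearrange : ∀ i f j s r → i * ((f * j) * (s * r)) ≡ (s * f) * i * (j * r)
  rearrange = solve-∀ ℚring

^-*-^ : ∀ x y e n → (x * y ^ e) ^ n ≡ x ^ n * y ^ (e ℕ.* n)
^-*-^ x y e n = trans (^-distrib-* x (y ^ e) n) (cong (x ^ n *_) (^-assocʳ y e n))

-- `X₁` and `X₂` at m + 1 are d_{m+1}² a_m / q⁴ in the odd and the even case; `Y₃` at m is 4 a_m /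
-- q² in the even case. All use s = q̃ h.
X₁ X₂ Y₃ : ℚ → ℕ → ℚ
X₁ q̃ ℓ = fromℕ ℓ ^ 2 * (+ 1 / 4) * (q̃ ^ 2 - fromℕ (2 ℕ.* ℓ) ^ 2)
X₂ q̃ ℓ = fromℕ ℓ ^ 2 * (+ 1 / 4) * (q̃ ^ 2 - (fromℕ (2 ℕ.* ℓ) - 1ℚ) ^ 2)
Y₃ q̃ ℓ = q̃ ^ 2 - fromℕ (2 ℕ.* ℓ ℕ.+ 1) ^ 2

staircase : (ℕ → ℚ) → ℕ → ℚ
staircase X m = ∏[ ℓ ∈ 1 ⋯ m ] (X ℓ ^ (2 ℕ.* (m ℕ.+ 1 ℕ.∸ ℓ)))

formula₁ : ℚ → ℚ → ℚ → ℕ → ℚ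
formula₁ S Q q̃ m = (- 1ℚ) ^ (m ℕ.+ 1) * (S * Q ^ (2 ℕ.* m)) ^ (2 ℕ.* m ℕ.+ 2) * staircase (X₁ q̃) m

formula₂ formula₃ : ℚ → ℚ → ℕ → ℚ
formula₂ Q q̃ m = (- 1ℚ) ^ (m ℕ.+ 1) * (Q ^ (2 ℕ.* m ℕ.* (2 ℕ.* m ℕ.+ 1)) * (1/! m) ^ 2) * staircase (X₂ q̃) m
formula₃ Q q̃ m = ((+ 1 / 2) * Q ^ (2 ℕ.* m ℕ.+ 1)) ^ (2 ℕ.* m ℕ.+ 2)
  * (∏[ ℓ ∈ 0 ⋯ m ] (fromℕ (ℓ !) ^ 4 * (+ 1 / 16) ^ ℓ * Y₃ q̃ ℓ ^ (2 ℕ.* (m ℕ.∸ ℓ) ℕ.+ 1)))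

staircase-suc : ∀ X m → staircase X (suc m)
  ≡ staircase X m * (∏ (suc m) (X ∘ suc) * ∏ (suc m) (X ∘ suc))
staircase-suc X m = begin
  staircase X (suc m)
    ≡⟨ ∏-staircase m (λ i → X (suc i) ^ (2 ℕ.* (m ℕ.+ 1 ℕ.∸ suc i))) (λ i → X (suc i) ^ (2 ℕ.* (suc m ℕ.+ 1 ℕ.∸ suc i))) (X ∘ suc) step ⟩
  staircase X m * (P * P) * X (suc m) ^ (2 ℕ.* (m ℕ.+ 1 ℕ.∸ m))
    ≡⟨ cong (λ e → staircase X m * (P * P) * X (suc m) ^ (2 ℕ.* e)) (ℕ.m+n∸m≡n m 1) ⟩
  staircase X m * (P * P) * X (suc m) ^ 2
    ≡⟨ rearrange (staircase X m) P (X (suc m)) ⟩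
  staircase X m * ((P * X (suc m)) * (P * X (suc m)))
    ≡⟨ cong (λ p → staircase X m * (p * p)) (∏-last (X ∘ suc) m) ⟨
  staircase X m * (∏ (suc m) (X ∘ suc) * ∏ (suc m) (X ∘ suc)) ∎
  where
  P = ∏ m (X ∘ suc)
  rearrange : ∀ t p x → t * (p * p) * (x * (x * 1ℚ)) ≡ t * ((p * x) * (p * x))
  rearrange = solve-∀ ℚring
  square : ∀ x y → x * (x * y) ≡ y * (x * x)
  square = solve-∀ ℚring
  step : ∀ i → i ℕ.< m → X (suc i) ^ (2 ℕ.* (suc m ℕ.+ 1 ℕ.∸ suc i))
    ≡ X (suc i) ^ (2 ℕ.* (m ℕ.+ 1 ℕ.∸ suc i)) * (X (suc i) * X (suc i))
  step i i<m = trans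
    (cong (X (suc i) ^_) (trans (cong (2 ℕ.*_) (ℕ.+-∸-assoc 1 {m ℕ.+ 1} {suc i} (ℕ.≤-trans i<m (ℕ.m≤m+n m 1)))) (ℕ.*-suc 2 _)))
    (square (X (suc i)) (X (suc i) ^ (2 ℕ.* (m ℕ.+ 1 ℕ.∸ suc i))))

module _ (h q̃ : ℚ) where
  private
    Q = h + h
    s = q̃ * h

  progression-fromℕ : ∀ b m → Family.progression h (s * s) 0ℚ b m ≡ b + fromℕ m * Q
  progression-fromℕ b zero    = zero-case b (h + h)
    where
    zero-case : ∀ b q → b ≡ b + 0ℚ * q
    zero-case = solve-∀ ℚring
  progression-fromℕ b (suc m) = trans (cong (_+ Q) (progression-fromℕ b m))
    (trans (rearrange b (fromℕ m) Q) (cong (λ x → b + x * Q) (sym (fromℕ-+ 1 m))))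
    where
    rearrange : ∀ b m q → b + m * q + q ≡ b + (1ℚ + m) * q
    rearrange = solve-∀ ℚring

  lead-square : ∀ (X lead : ℕ → ℚ) → (∀ m → lead (suc m) ≡ - (Q ^ 4 * X (suc m)) * lead m) →
    ∀ m → lead m * lead m ≡ lead 0 * lead 0 * (Q ^ (8 ℕ.* m) * (∏ m (X ∘ suc) * ∏ m (X ∘ suc)))
  lead-square X lead lead-suc zero    = unit (lead 0 * lead 0)
    where
    unit : ∀ x → x ≡ x * (1ℚ * (1ℚ * 1ℚ))
    unit = solve-∀ ℚring
  lead-square X lead lead-suc (suc m) = begin
    lead (suc m) * lead (suc m)
      ≡⟨ cong (λ x → x * x) (lead-suc m) ⟩
    (- (Q ^ 4 * X (suc m)) * lead m) * (- (Q ^ 4 * X (suc m)) * lead m)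
      ≡⟨ square (Q ^ 4) (X (suc m)) (lead m) ⟩
    (Q ^ 4 * Q ^ 4) * (X (suc m) * X (suc m)) * (lead m * lead m)
      ≡⟨ cong₂ (λ x y → x * (X (suc m) * X (suc m)) * y) (sym (^-homo-* Q 4 4)) (lead-square X lead lead-suc m) ⟩
    Q ^ 8 * (X (suc m) * X (suc m)) * (lead 0 * lead 0 * (Q ^ (8 ℕ.* m) * (P * P)))
      ≡⟨ rearrange (Q ^ 8) (X (suc m)) (lead 0 * lead 0) (Q ^ (8 ℕ.* m)) P ⟩
    lead 0 * lead 0 * ((Q ^ 8 * Q ^ (8 ℕ.* m)) * ((P * X (suc m)) * (P * X (suc m))))
      ≡⟨ cong₂ (λ x p → lead 0 * lead 0 * (x * (p * p)))
           (trans (sym (^-homo-* Q 8 (8 ℕ.* m))) (cong (Q ^_) (sym (ℕ.*-suc 8 m)))) (sym (∏-last (X ∘ suc) m)) ⟩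
    lead 0 * lead 0 * (Q ^ (8 ℕ.* suc m) * (∏ (suc m) (X ∘ suc) * ∏ (suc m) (X ∘ suc))) ∎
    where
    P = ∏ m (X ∘ suc)
    square : ∀ q x l → (- (q * x) * l) * (- (q * x) * l) ≡ (q * q) * (x * x) * (l * l)
    square = solve-∀ ℚring
    rearrange : ∀ q x l r p → q * (x * x) * (l * (r * (p * p))) ≡ l * ((q * r) * ((p * x) * (p * x)))
    rearrange = solve-∀ ℚring

  module SinhForms (μ ν : ℕ → ℚ) (sol : Solves h ν μ)
    (ν-shift : ∀ n → ν (suc (suc n)) ≡ s * s * ν n) (μ-odd : ∀ n → alternate μ n ≡ (- 1ℚ) * μ n) (μ₁≡s : μ 1 ≡ s) where
    open SinhTower h s μ ν sol ν-shift μ-odd public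
    open Tower tower using (block; ∏block)

    progression-h : ∀ m → c m ≡ h + fromℕ m * Q
    progression-h m = trans (go m) (progression-fromℕ h m)
      where
      -- The progression carries the module parameter c_0, which is h here but 0 in
      -- `progression-fromℕ`; the two copies agree by recursion.
      go : ∀ m → c m ≡ Family.progression h (s * s) 0ℚ h m
      go zero    = refl
      go (suc m) = cong (_+ Q) (go m)

    d-fromℕ : ∀ m → d m ≡ fromℕ m * Q
    d-fromℕ m = trans (go m) (trans (progression-fromℕ 0ℚ m) (ℚ.+-identityˡ _))
      where
      go : ∀ m → d m ≡ Family.progression h (s * s) 0ℚ 0ℚ m
      go zero    = refl
      go (suc m) = cong (_+ Q) (go m)

    lead-suc : ∀ m → lead (suc m) ≡ - (Q ^ 4 * X₁ q̃ (suc m)) * lead m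
    lead-suc m = begin
      - (d (suc m) * d (suc m)) * ((s * s - (c m + h) * (c m + h)) * lead m)
        ≡⟨ cong₂ (λ x y → - (x * x) * ((s * s - (y + h) * (y + h)) * lead m))
             (trans (d-fromℕ (suc m)) (cong (_* Q) (fromℕ-+ 1 m))) (progression-h m) ⟩
      - (((1ℚ + M) * Q) * ((1ℚ + M) * Q)) * ((s * s - (h + M * Q + h) * (h + M * Q + h)) * lead m)
        ≡⟨ identity h q̃ M (lead m) ⟩
      - (Q ^ 4 * ((1ℚ + M) ^ 2 * (½ * ½) * (q̃ ^ 2 - ((1ℚ + 1ℚ) * (1ℚ + M)) ^ 2))) * lead m
        ≡⟨ cong (λ x → - (Q ^ 4 * (x ^ 2 * (½ * ½) * (q̃ ^ 2 - ((1ℚ + 1ℚ) * x) ^ 2))) * lead m) (fromℕ-+ 1 m) ⟨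
      - (Q ^ 4 * (fromℕ (suc m) ^ 2 * (½ * ½) * (q̃ ^ 2 - (fromℕ 2 * fromℕ (suc m)) ^ 2))) * lead m
        ≡⟨ cong (λ x → - (Q ^ 4 * (fromℕ (suc m) ^ 2 * (½ * ½) * (q̃ ^ 2 - x ^ 2))) * lead m) (fromℕ-* 2 (suc m)) ⟨
      - (Q ^ 4 * X₁ q̃ (suc m)) * lead m ∎
      where
      M = fromℕ m
      identity : ∀ h q M l → - (((1ℚ + M) * (h + h)) * ((1ℚ + M) * (h + h)))
          * (((q * h) * (q * h) - (h + M * (h + h) + h) * (h + M * (h + h) + h)) * l)
        ≡ - (((h + h) * ((h + h) * ((h + h) * ((h + h) * 1ℚ)))) * (((1ℚ + M) * ((1ℚ + M) * 1ℚ)) * (½ * ½)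
          * (q * (q * 1ℚ) - ((1ℚ + 1ℚ) * (1ℚ + M)) * (((1ℚ + 1ℚ) * (1ℚ + M)) * 1ℚ)))) * l
      identity = solve-∀ ℚring

    block-closed : ∀ m → block m ≡ - (s * s * (Q ^ (8 ℕ.* m) * (∏ m (X₁ q̃ ∘ suc) * ∏ m (X₁ q̃ ∘ suc))))
    block-closed m = trans (block-lead m) (cong -_ (trans (lead-square (X₁ q̃) lead lead-suc m)
      (cong (λ x → x * x * (Q ^ (8 ℕ.* m) * (∏ m (X₁ q̃ ∘ suc) * ∏ m (X₁ q̃ ∘ suc)))) μ₁≡s)))

    ∏block-closed : ∀ m → ∏block (suc m) ≡ formula₁ s Q q̃ m
    ∏block-closed zero    = trans (cong (_* 1ℚ) (block-closed 0)) (base s)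
      where
      base : ∀ s → - (s * s * (1ℚ * (1ℚ * 1ℚ))) * 1ℚ ≡ ((- 1ℚ) * 1ℚ) * ((s * 1ℚ) * ((s * 1ℚ) * 1ℚ)) * 1ℚ
      base = solve-∀ ℚring
    ∏block-closed (suc m) = begin
      ∏block (suc (suc m))
        ≡⟨ ∏-last block (suc m) ⟩
      ∏block (suc m) * block (suc m)
        ≡⟨ cong₂ _*_ (∏block-closed m) (block-closed (suc m)) ⟩
      formula₁ s Q q̃ m * - (s * s * (Q ^ (8 ℕ.* suc m) * (P * P)))
        ≡⟨ cong (λ x → (- 1ℚ) ^ (m ℕ.+ 1) * x * staircase (X₁ q̃) m * - (s * s * (Q ^ (8 ℕ.* suc m) * (P * P)))) (^-*-^ s Q (2 ℕ.* m) (2 ℕ.* m ℕ.+ 2)) ⟩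
      (- 1ℚ) ^ (m ℕ.+ 1) * (s ^ (2 ℕ.* m ℕ.+ 2) * Q ^ (2 ℕ.* m ℕ.* (2 ℕ.* m ℕ.+ 2))) * staircase (X₁ q̃) m
        * - (s * s * (Q ^ (8 ℕ.* suc m) * (P * P)))
        ≡⟨ rearrange ((- 1ℚ) ^ (m ℕ.+ 1)) (s ^ (2 ℕ.* m ℕ.+ 2)) (Q ^ (2 ℕ.* m ℕ.* (2 ℕ.* m ℕ.+ 2))) (staircase (X₁ q̃) m) s (Q ^ (8 ℕ.* suc m)) P ⟩
      (- 1ℚ) ^ (suc m ℕ.+ 1) * (s ^ (2 ℕ.+ (2 ℕ.* m ℕ.+ 2)) * (Q ^ (2 ℕ.* m ℕ.* (2 ℕ.* m ℕ.+ 2)) * Q ^ (8 ℕ.* suc m))) * (staircase (X₁ q̃) m * (P * P))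
        ≡⟨ cong₂ (λ x y → (- 1ℚ) ^ (suc m ℕ.+ 1) * x * y) powers (sym (staircase-suc (X₁ q̃) m)) ⟩
      formula₁ s Q q̃ (suc m) ∎
      where
      P = ∏ (suc m) (X₁ q̃ ∘ suc)
      rearrange : ∀ n a b z s r p → n * (a * b) * z * - (s * s * (r * (p * p)))
        ≡ ((- 1ℚ) * n) * ((s * (s * a)) * (b * r)) * (z * (p * p))
      rearrange = solve-∀ ℚring
      exponent₁ : ∀ m → 2 ℕ.+ (2 ℕ.* m ℕ.+ 2) ≡ 2 ℕ.* suc m ℕ.+ 2
      exponent₁ = ℕSolver.solve-∀
      exponent₂ : ∀ m → 2 ℕ.* m ℕ.* (2 ℕ.* m ℕ.+ 2) ℕ.+ 8 ℕ.* suc m ≡ 2 ℕ.* suc m ℕ.* (2 ℕ.* suc m ℕ.+ 2)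
      exponent₂ = ℕSolver.solve-∀
      powers : s ^ (2 ℕ.+ (2 ℕ.* m ℕ.+ 2)) * (Q ^ (2 ℕ.* m ℕ.* (2 ℕ.* m ℕ.+ 2)) * Q ^ (8 ℕ.* suc m))
        ≡ (s * Q ^ (2 ℕ.* suc m)) ^ (2 ℕ.* suc m ℕ.+ 2)
      powers = trans (cong₂ _*_ (cong (s ^_) (exponent₁ m))
          (trans (sym (^-homo-* Q (2 ℕ.* m ℕ.* (2 ℕ.* m ℕ.+ 2)) (8 ℕ.* suc m))) (cong (Q ^_) (exponent₂ m))))
        (sym (^-*-^ s Q (2 ℕ.* suc m) (2 ℕ.* suc m ℕ.+ 2)))

  module CoshForms (μ ν : ℕ → ℚ) (sol : Solves h ν μ)
    (ν-shift : ∀ n → ν (suc (suc n)) ≡ s * s * ν n) (μ-even : ∀ n → alternate μ n ≡ 1ℚ * μ n) (μ₀≡-1 : μ 0 ≡ - 1ℚ) where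
    open CoshTower h s μ ν sol ν-shift μ-even public
    open Tower tower using (block; ∏block)

    d-fromℕ : ∀ m → d m ≡ fromℕ m * Q
    d-fromℕ m = trans (progression-fromℕ 0ℚ m) (ℚ.+-identityˡ _)

    fromℕ-2*suc-1 : ∀ m → fromℕ (2 ℕ.* suc m) - 1ℚ ≡ fromℕ (2 ℕ.* m ℕ.+ 1)
    fromℕ-2*suc-1 m = trans (cong (λ n → fromℕ n - 1ℚ) (index m)) (trans (cong (_- 1ℚ) (fromℕ-+ 1 (2 ℕ.* m ℕ.+ 1))) (cancel (fromℕ (2 ℕ.* m ℕ.+ 1))))
      where
      index : ∀ m → 2 ℕ.* suc m ≡ 1 ℕ.+ (2 ℕ.* m ℕ.+ 1)
      index = ℕSolver.solve-∀
      cancel : ∀ x → 1ℚ + x - 1ℚ ≡ x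
      cancel = solve-∀ ℚring

    X₂-Y : ∀ m → X₂ q̃ (suc m) ≡ fromℕ (suc m) ^ 2 * (+ 1 / 4) * Y₃ q̃ m
    X₂-Y m = cong (λ x → fromℕ (suc m) ^ 2 * (+ 1 / 4) * (q̃ ^ 2 - x ^ 2)) (fromℕ-2*suc-1 m)

    a-Y : ∀ m → a m ≡ Q ^ 2 * ((+ 1 / 4) * Y₃ q̃ m)
    a-Y m = begin
      s * s - (d m + h) * (d m + h)
        ≡⟨ cong (λ x → s * s - (x + h) * (x + h)) (d-fromℕ m) ⟩
      s * s - (fromℕ m * Q + h) * (fromℕ m * Q + h)
        ≡⟨ identity h q̃ (fromℕ m) ⟩
      Q ^ 2 * ((½ * ½) * (q̃ ^ 2 - ((1ℚ + 1ℚ) * fromℕ m + 1ℚ) ^ 2))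
        ≡⟨ cong (λ x → Q ^ 2 * ((½ * ½) * (q̃ ^ 2 - x ^ 2))) (trans (fromℕ-+ (2 ℕ.* m) 1) (cong (_+ 1ℚ) (fromℕ-* 2 m))) ⟨
      Q ^ 2 * ((+ 1 / 4) * Y₃ q̃ m) ∎
      where
      identity : ∀ h q M → (q * h) * (q * h) - (M * (h + h) + h) * (M * (h + h) + h)
        ≡ ((h + h) * ((h + h) * 1ℚ)) * ((½ * ½) * (q * (q * 1ℚ) - ((1ℚ + 1ℚ) * M + 1ℚ) * (((1ℚ + 1ℚ) * M + 1ℚ) * 1ℚ)))
      identity = solve-∀ ℚring

    lead-suc : ∀ m → lead (suc m) ≡ - (Q ^ 4 * X₂ q̃ (suc m)) * lead m
    lead-suc m = begin
      - (d (suc m) * d (suc m)) * (a m * lead m)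
        ≡⟨ cong₂ (λ x y → - (x * x) * (y * lead m)) (d-fromℕ (suc m)) (a-Y m) ⟩
      - ((M * Q) * (M * Q)) * ((Q ^ 2 * ((+ 1 / 4) * Y₃ q̃ m)) * lead m)
        ≡⟨ rearrange Q M (+ 1 / 4) (Y₃ q̃ m) (lead m) ⟩
      - (Q ^ 4 * (M ^ 2 * (+ 1 / 4) * Y₃ q̃ m)) * lead m
        ≡⟨ cong (λ x → - (Q ^ 4 * x) * lead m) (X₂-Y m) ⟨
      - (Q ^ 4 * X₂ q̃ (suc m)) * lead m ∎
      where
      M = fromℕ (suc m)
      rearrange : ∀ q M f y l → - ((M * q) * (M * q)) * (((q * (q * 1ℚ)) * (f * y)) * l)
        ≡ - ((q * (q * (q * (q * 1ℚ)))) * ((M * (M * 1ℚ)) * f * y)) * l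
      rearrange = solve-∀ ℚring

    lead²-closed : ∀ m → lead m * lead m ≡ Q ^ (8 ℕ.* m) * (∏ m (X₂ q̃ ∘ suc) * ∏ m (X₂ q̃ ∘ suc))
    lead²-closed m = trans (lead-square (X₂ q̃) lead lead-suc m)
      (trans (cong (λ x → x * x * (Q ^ (8 ℕ.* m) * (∏ m (X₂ q̃ ∘ suc) * ∏ m (X₂ q̃ ∘ suc)))) μ₀≡-1) (ℚ.*-identityˡ _))

    -- Origin of the 1/m!² in the even-index formula: `a m` is q² X₂(m+1) without the square (m+1)²,
    -- so each step contributes a factor 1/(m+1)².
    lead-product : ∀ m → (a m * lead m) * lead (suc m)
      ≡ - (Q ^ (8 ℕ.* m ℕ.+ 6) * ((+ 1 / suc m) * (+ 1 / suc m)) * (∏ (suc m) (X₂ q̃ ∘ suc) * ∏ (suc m) (X₂ q̃ ∘ suc)))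
    lead-product m = begin
      (a m * lead m) * lead (suc m)
        ≡⟨ cong₂ (λ x y → (x * lead m) * y) a-X₂ (lead-suc m) ⟩
      ((Q ^ 2 * (r * r) * X) * lead m) * (- (Q ^ 4 * X) * lead m)
        ≡⟨ rearrange₁ Q r X (lead m) ⟩
      - (Q ^ 6 * (r * r) * (X * X)) * (lead m * lead m)
        ≡⟨ cong (- (Q ^ 6 * (r * r) * (X * X)) *_) (lead²-closed m) ⟩
      - (Q ^ 6 * (r * r) * (X * X)) * (Q ^ (8 ℕ.* m) * (P * P))
        ≡⟨ rearrange₂ (Q ^ 6) (r * r) X (Q ^ (8 ℕ.* m)) P ⟩
      - ((Q ^ (8 ℕ.* m) * Q ^ 6) * (r * r) * ((P * X) * (P * X)))
        ≡⟨ cong₂ (λ x p → - (x * (r * r) * (p * p))) (^-homo-* Q (8 ℕ.* m) 6) (∏-last (X₂ q̃ ∘ suc) m) ⟨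
      - (Q ^ (8 ℕ.* m ℕ.+ 6) * (r * r) * (∏ (suc m) (X₂ q̃ ∘ suc) * ∏ (suc m) (X₂ q̃ ∘ suc))) ∎
      where
      r = + 1 / suc m
      X = X₂ q̃ (suc m)
      P = ∏ m (X₂ q̃ ∘ suc)
      M = fromℕ (suc m)
      rearrange₀ : ∀ q M r f y → q * ((M * r) * (M * r) * (f * y)) ≡ q * (r * r) * ((M * (M * 1ℚ)) * f * y)
      rearrange₀ = solve-∀ ℚring
      rearrange₁ : ∀ q r x l → (((q * (q * 1ℚ)) * (r * r) * x) * l) * (- ((q * (q * (q * (q * 1ℚ)))) * x) * l)
        ≡ - ((q * (q * (q * (q * (q * (q * 1ℚ)))))) * (r * r) * (x * x)) * (l * l)
      rearrange₁ = solve-∀ ℚring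
      rearrange₂ : ∀ q r x t p → - (q * r * (x * x)) * (t * (p * p)) ≡ - ((t * q) * r * ((p * x) * (p * x)))
      rearrange₂ = solve-∀ ℚring
      a-X₂ : a m ≡ Q ^ 2 * (r * r) * X
      a-X₂ = begin
        a m                                                ≡⟨ a-Y m ⟩
        Q ^ 2 * ((+ 1 / 4) * Y₃ q̃ m)                        ≡⟨ cong (Q ^ 2 *_) (ℚ.*-identityˡ _) ⟨
        Q ^ 2 * (1ℚ * 1ℚ * ((+ 1 / 4) * Y₃ q̃ m))            ≡⟨ cong (λ x → Q ^ 2 * (x * x * ((+ 1 / 4) * Y₃ q̃ m))) (fromℕ-*-recip (suc m)) ⟨
        Q ^ 2 * ((M * r) * (M * r) * ((+ 1 / 4) * Y₃ q̃ m))  ≡⟨ rearrange₀ (Q ^ 2) M r (+ 1 / 4) (Y₃ q̃ m) ⟩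
        Q ^ 2 * (r * r) * (M ^ 2 * (+ 1 / 4) * Y₃ q̃ m)      ≡⟨ cong (Q ^ 2 * (r * r) *_) (X₂-Y m) ⟨
        Q ^ 2 * (r * r) * X                                ∎

    -- The new block is `lead m` times `a m * lead m`. Its first factor completes the product of the
    -- induction hypothesis, and its second pairs with `lead (suc m)`.
    ∏block-lead-closed : ∀ m → ∏block m * A m (double m) ≡ formula₂ Q q̃ m
    ∏block-lead-closed m = trans (cong (∏block m *_) (A-lead m)) (go m)
      where
      go : ∀ m → ∏block m * lead m ≡ formula₂ Q q̃ m
      go zero    = cong (1ℚ *_) μ₀≡-1
      go (suc m) = begin
        ∏block (suc m) * lead (suc m)
          ≡⟨ cong (_* lead (suc m)) (trans (∏-last block m) (cong (∏block m *_) (block-lead m))) ⟩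
        ∏block m * (lead m * (a m * lead m)) * lead (suc m)
          ≡⟨ assoc (∏block m) (lead m) (a m * lead m) (lead (suc m)) ⟩
        (∏block m * lead m) * ((a m * lead m) * lead (suc m))
          ≡⟨ cong₂ _*_ (go m) (lead-product m) ⟩
        formula₂ Q q̃ m * - (Q ^ (8 ℕ.* m ℕ.+ 6) * (r * r) * (P * P))
          ≡⟨ rearrange ((- 1ℚ) ^ (m ℕ.+ 1)) (Q ^ (2 ℕ.* m ℕ.* (2 ℕ.* m ℕ.+ 1))) (1/! m) (staircase (X₂ q̃) m) (Q ^ (8 ℕ.* m ℕ.+ 6)) r P ⟩
        (- 1ℚ) ^ (suc m ℕ.+ 1) * ((Q ^ (2 ℕ.* m ℕ.* (2 ℕ.* m ℕ.+ 1)) * Q ^ (8 ℕ.* m ℕ.+ 6)) * (1/! m * r) ^ 2) * (staircase (X₂ q̃) m * (P * P))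
          ≡⟨ cong₂ (λ x y → (- 1ℚ) ^ (suc m ℕ.+ 1) * x * y)
               (cong₂ (λ x y → x * y ^ 2) (trans (sym (^-homo-* Q (2 ℕ.* m ℕ.* (2 ℕ.* m ℕ.+ 1)) (8 ℕ.* m ℕ.+ 6))) (cong (Q ^_) (exponent m))) (sym (1/!-suc m)))
               (sym (staircase-suc (X₂ q̃) m)) ⟩
        formula₂ Q q̃ (suc m) ∎
        where
        r = + 1 / suc m
        P = ∏ (suc m) (X₂ q̃ ∘ suc)
        assoc : ∀ b l x y → b * (l * x) * y ≡ (b * l) * (x * y)
        assoc = solve-∀ ℚring
        exponent : ∀ m → 2 ℕ.* m ℕ.* (2 ℕ.* m ℕ.+ 1) ℕ.+ (8 ℕ.* m ℕ.+ 6) ≡ 2 ℕ.* suc m ℕ.* (2 ℕ.* suc m ℕ.+ 1)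
        exponent = ℕSolver.solve-∀
        rearrange : ∀ n a i z b r p → n * (a * (i * (i * 1ℚ))) * z * - (b * (r * r) * (p * p))
          ≡ ((- 1ℚ) * n) * ((a * b) * ((i * r) * ((i * r) * 1ℚ))) * (z * (p * p))
        rearrange = solve-∀ ℚring

    -- The factors ℓ²/4 of `X₂` multiply to m!²/4ᵐ, and squaring gives the m!⁴/16ᵐ of the last
    -- formula.
    ∏X₂-Y : ∀ m → ∏ m (X₂ q̃ ∘ suc) * ∏ m (X₂ q̃ ∘ suc) ≡ (fromℕ (m !) ^ 4 * (+ 1 / 16) ^ m) * (∏ m (Y₃ q̃) * ∏ m (Y₃ q̃))
    ∏X₂-Y zero    = refl
    ∏X₂-Y (suc m) = begin
      ∏ (suc m) (X₂ q̃ ∘ suc) * ∏ (suc m) (X₂ q̃ ∘ suc)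
        ≡⟨ cong (λ p → p * p) (trans (∏-last (X₂ q̃ ∘ suc) m) (cong (∏ m (X₂ q̃ ∘ suc) *_) (X₂-Y m))) ⟩
      (P * (M ^ 2 * (½ * ½) * Y₃ q̃ m)) * (P * (M ^ 2 * (½ * ½) * Y₃ q̃ m))
        ≡⟨ rearrange₁ P M (Y₃ q̃ m) ⟩
      (P * P) * (M ^ 4 * (½ * ½ * (½ * ½)) * (Y₃ q̃ m * Y₃ q̃ m))
        ≡⟨ cong (_* (M ^ 4 * (½ * ½ * (½ * ½)) * (Y₃ q̃ m * Y₃ q̃ m))) (∏X₂-Y m) ⟩
      ((fromℕ (m !) ^ 4 * (+ 1 / 16) ^ m) * (PY * PY)) * (M ^ 4 * (½ * ½ * (½ * ½)) * (Y₃ q̃ m * Y₃ q̃ m))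
        ≡⟨ rearrange₂ (fromℕ (m !)) ((+ 1 / 16) ^ m) PY M (½ * ½ * (½ * ½)) (Y₃ q̃ m) ⟩
      ((M * fromℕ (m !)) ^ 4 * (+ 1 / 16) ^ suc m) * ((PY * Y₃ q̃ m) * (PY * Y₃ q̃ m))
        ≡⟨ cong₂ (λ x y → (x ^ 4 * (+ 1 / 16) ^ suc m) * (y * y)) (fromℕ-* (suc m) (m !)) (∏-last (Y₃ q̃) m) ⟨
      (fromℕ (suc m !) ^ 4 * (+ 1 / 16) ^ suc m) * (∏ (suc m) (Y₃ q̃) * ∏ (suc m) (Y₃ q̃)) ∎
      where
      P = ∏ m (X₂ q̃ ∘ suc)
      PY = ∏ m (Y₃ q̃)
      M = fromℕ (suc m)
      rearrange₁ : ∀ p M y → (p * ((M * (M * 1ℚ)) * (½ * ½) * y)) * (p * ((M * (M * 1ℚ)) * (½ * ½) * y))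
        ≡ (p * p) * ((M * (M * (M * (M * 1ℚ)))) * (½ * ½ * (½ * ½)) * (y * y))
      rearrange₁ = solve-∀ ℚring
      rearrange₂ : ∀ f t p M e y → (((f * (f * (f * (f * 1ℚ)))) * t) * (p * p)) * ((M * (M * (M * (M * 1ℚ)))) * e * (y * y))
        ≡ (((M * f) * ((M * f) * ((M * f) * ((M * f) * 1ℚ)))) * (e * t)) * ((p * y) * (p * y))
      rearrange₂ = solve-∀ ℚring

    ∏block-closed : ∀ m → ∏block (suc m) ≡ formula₃ Q q̃ m
    ∏block-closed zero    = begin
      block 0 * 1ℚ
        ≡⟨ cong (_* 1ℚ) (trans (block-lead 0) (cong₂ (λ l x → l * (x * l)) μ₀≡-1 (a-Y 0))) ⟩
      (- 1ℚ) * ((Q ^ 2 * ((½ * ½) * Y₃ q̃ 0)) * (- 1ℚ)) * 1ℚ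
        ≡⟨ base Q (Y₃ q̃ 0) ⟩
      formula₃ Q q̃ 0 ∎
      where
      base : ∀ q y → (- 1ℚ) * (((q * (q * 1ℚ)) * ((½ * ½) * y)) * (- 1ℚ)) * 1ℚ
        ≡ ((½ * (q * 1ℚ)) * ((½ * (q * 1ℚ)) * 1ℚ)) * ((1ℚ * 1ℚ * (y * 1ℚ)) * 1ℚ)
      base = solve-∀ ℚring
    ∏block-closed (suc m) = begin
      ∏block (suc (suc m))
        ≡⟨ ∏-last block (suc m) ⟩
      ∏block (suc m) * block (suc m)
        ≡⟨ cong₂ _*_ (∏block-closed m) block-suc ⟩
      formula₃ Q q̃ m * ((Q ^ 2 * ((½ * ½) * Y₃ q̃ (suc m))) * (Q ^ (8 ℕ.* suc m) * (fact * (PY * PY))))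
        ≡⟨ cong (λ x → x * W * ((Q ^ 2 * ((½ * ½) * Y₃ q̃ (suc m))) * (Q ^ (8 ℕ.* suc m) * (fact * (PY * PY))))) (^-*-^ ½ Q (2 ℕ.* m ℕ.+ 1) (2 ℕ.* m ℕ.+ 2)) ⟩
      ½ ^ (2 ℕ.* m ℕ.+ 2) * Q ^ ((2 ℕ.* m ℕ.+ 1) ℕ.* (2 ℕ.* m ℕ.+ 2)) * W
        * ((Q ^ 2 * ((½ * ½) * Y₃ q̃ (suc m))) * (Q ^ (8 ℕ.* suc m) * (fact * (PY * PY))))
        ≡⟨ rearrange (½ ^ (2 ℕ.* m ℕ.+ 2)) (Q ^ ((2 ℕ.* m ℕ.+ 1) ℕ.* (2 ℕ.* m ℕ.+ 2))) W (Q ^ 2) ½ (Y₃ q̃ (suc m)) (Q ^ (8 ℕ.* suc m)) fact PY ⟩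
      (½ ^ (2 ℕ.+ (2 ℕ.* m ℕ.+ 2)) * (Q ^ ((2 ℕ.* m ℕ.+ 1) ℕ.* (2 ℕ.* m ℕ.+ 2)) * (Q ^ (8 ℕ.* suc m) * Q ^ 2)))
        * (W * (PY * PY) * (fact * Y₃ q̃ (suc m) ^ 1))
        ≡⟨ cong₂ _*_ powers (sym W-suc) ⟩
      formula₃ Q q̃ (suc m) ∎
      where
      fact = fromℕ (suc m !) ^ 4 * (+ 1 / 16) ^ suc m
      PY = ∏ (suc m) (Y₃ q̃)
      t : ℕ → ℕ → ℚ
      t m ℓ = fromℕ (ℓ !) ^ 4 * (+ 1 / 16) ^ ℓ * Y₃ q̃ ℓ ^ (2 ℕ.* (m ℕ.∸ ℓ) ℕ.+ 1)
      W = ∏ (suc m) (t m)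
      block-suc : block (suc m) ≡ (Q ^ 2 * ((½ * ½) * Y₃ q̃ (suc m))) * (Q ^ (8 ℕ.* suc m) * (fact * (PY * PY)))
      block-suc = begin
        block (suc m)                                       ≡⟨ block-lead (suc m) ⟩
        lead (suc m) * (a (suc m) * lead (suc m))           ≡⟨ swap-factors (lead (suc m)) (a (suc m)) ⟩
        a (suc m) * (lead (suc m) * lead (suc m))           ≡⟨ cong₂ _*_ (a-Y (suc m)) (trans (lead²-closed (suc m)) (cong (Q ^ (8 ℕ.* suc m) *_) (∏X₂-Y (suc m)))) ⟩
        (Q ^ 2 * ((½ * ½) * Y₃ q̃ (suc m))) * (Q ^ (8 ℕ.* suc m) * (fact * (PY * PY))) ∎
        where
        swap-factors : ∀ l a → l * (a * l) ≡ a * (l * l)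
        swap-factors = solve-∀ ℚring
      rearrange : ∀ a b w q e y r f p → a * b * w * ((q * ((e * e) * y)) * (r * (f * (p * p))))
        ≡ ((e * (e * a)) * (b * (r * q))) * (w * (p * p) * (f * (y * 1ℚ)))
      rearrange = solve-∀ ℚring
      exponent₁ : ∀ m → 2 ℕ.+ (2 ℕ.* m ℕ.+ 2) ≡ 2 ℕ.* suc m ℕ.+ 2
      exponent₁ = ℕSolver.solve-∀
      exponent₂ : ∀ m → (2 ℕ.* m ℕ.+ 1) ℕ.* (2 ℕ.* m ℕ.+ 2) ℕ.+ (8 ℕ.* suc m ℕ.+ 2) ≡ (2 ℕ.* suc m ℕ.+ 1) ℕ.* (2 ℕ.* suc m ℕ.+ 2)
      exponent₂ = ℕSolver.solve-∀
      powers : ½ ^ (2 ℕ.+ (2 ℕ.* m ℕ.+ 2)) * (Q ^ ((2 ℕ.* m ℕ.+ 1) ℕ.* (2 ℕ.* m ℕ.+ 2)) * (Q ^ (8 ℕ.* suc m) * Q ^ 2))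
        ≡ (½ * Q ^ (2 ℕ.* suc m ℕ.+ 1)) ^ (2 ℕ.* suc m ℕ.+ 2)
      powers = trans (cong₂ _*_ (cong (½ ^_) (exponent₁ m))
          (trans (cong (Q ^ ((2 ℕ.* m ℕ.+ 1) ℕ.* (2 ℕ.* m ℕ.+ 2)) *_) (sym (^-homo-* Q (8 ℕ.* suc m) 2)))
          (trans (sym (^-homo-* Q ((2 ℕ.* m ℕ.+ 1) ℕ.* (2 ℕ.* m ℕ.+ 2)) (8 ℕ.* suc m ℕ.+ 2))) (cong (Q ^_) (exponent₂ m)))))
        (sym (^-*-^ ½ Q (2 ℕ.* suc m ℕ.+ 1) (2 ℕ.* suc m ℕ.+ 2)))
      W-suc : ∏ (suc (suc m)) (t (suc m)) ≡ W * (PY * PY) * (fact * Y₃ q̃ (suc m) ^ 1)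
      W-suc = trans (∏-staircase (suc m) (t m) (t (suc m)) (Y₃ q̃) step)
        -- The appended factor has ℓ = m + 1, where the exponent 2((m+1) - ℓ) + 1 is 1.
        (cong (λ e → W * (PY * PY) * (fact * Y₃ q̃ (suc m) ^ (2 ℕ.* e ℕ.+ 1))) (ℕ.n∸n≡0 m))
        where
        square : ∀ f x y → f * (x * (x * y)) ≡ f * y * (x * x)
        square = solve-∀ ℚring
        step : ∀ i → i ℕ.< suc m → t (suc m) i ≡ t m i * (Y₃ q̃ i * Y₃ q̃ i)
        step i i≤m = trans
          (cong (λ e → fromℕ (i !) ^ 4 * (+ 1 / 16) ^ i * Y₃ q̃ i ^ e)
            (trans (cong (λ e → 2 ℕ.* e ℕ.+ 1) (ℕ.+-∸-assoc 1 (s≤s⁻¹ i≤m))) (cong (ℕ._+ 1) (ℕ.*-suc 2 (m ℕ.∸ i)))))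
          (square (fromℕ (i !) ^ 4 * (+ 1 / 16) ^ i) (Y₃ q̃ i) (Y₃ q̃ i ^ (2 ℕ.* (m ℕ.∸ i) ℕ.+ 1)))

-- Evaluation at the four characters

!*exp : ∀ a n → fromℕ (n !) * exp a n ≡ fromℕ a ^ n
!*exp a n = begin
  fromℕ (n !) * (fromℕ (a ℕ.^ n) * 1/! n)   ≡⟨ rearrange (fromℕ (n !)) (fromℕ (a ℕ.^ n)) (1/! n) ⟩
  fromℕ (n !) * 1/! n * fromℕ (a ℕ.^ n)     ≡⟨ cong₂ _*_ (fromℕ-!*1/! n) (fromℕ-^ a n) ⟩
  1ℚ * fromℕ a ^ n                          ≡⟨ ℚ.*-identityˡ _ ⟩
  fromℕ a ^ n                               ∎
  where
  rearrange : ∀ f p i → f * (p * i) ≡ f * i * p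
  rearrange = solve-∀ ℚring

powers : ∀ e a b c d n →
  (fromℕ (n !) * exp a n + e * (fromℕ (n !) * exp b n)) - (fromℕ (n !) * exp c n + e * (fromℕ (n !) * exp d n))
  ≡ (fromℕ a ^ n + e * fromℕ b ^ n) - (fromℕ c ^ n + e * fromℕ d ^ n)
powers e a b c d n = cong₂ _-_
  (cong₂ (λ x y → x + e * y) (!*exp a n) (!*exp b n)) (cong₂ (λ x y → x + e * y) (!*exp c n) (!*exp d n))

-- The units modulo 2q are 1, q - 1 and their translates by q, on which the character changes sign;
-- hence the grouping into a difference of two equal patterns.
twistedExp-8,1 : ∀ n → fromℕ (n !) * twistedExp χ₈,₁ n
  ≡ (fromℕ 1 ^ n + (- 1ℚ) * fromℕ 3 ^ n) - (fromℕ 5 ^ n + (- 1ℚ) * fromℕ 7 ^ n)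
twistedExp-8,1 n = trans
  (collect (fromℕ (n !)) (exp 1 n) (exp 2 n) (exp 3 n) (exp 4 n) (exp 5 n) (exp 6 n) (exp 7 n) (exp 8 n))
  (powers (- 1ℚ) 1 3 5 7 n)
  where
  collect : ∀ f x₁ x₂ x₃ x₄ x₅ x₆ x₇ x₈ →
    f * (1ℚ * x₁ + (0ℚ * x₂ + ((- 1ℚ) * x₃ + (0ℚ * x₄ + ((- 1ℚ) * x₅ + (0ℚ * x₆ + (1ℚ * x₇ + (0ℚ * x₈ + 0ℚ))))))))
    ≡ (f * x₁ + (- 1ℚ) * (f * x₃)) - (f * x₅ + (- 1ℚ) * (f * x₇))
  collect = solve-∀ ℚring

twistedExp-8,2 : ∀ n → fromℕ (n !) * twistedExp χ₈,₂ n
  ≡ (fromℕ 1 ^ n + 1ℚ * fromℕ 3 ^ n) - (fromℕ 5 ^ n + 1ℚ * fromℕ 7 ^ n)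
twistedExp-8,2 n = trans
  (collect (fromℕ (n !)) (exp 1 n) (exp 2 n) (exp 3 n) (exp 4 n) (exp 5 n) (exp 6 n) (exp 7 n) (exp 8 n))
  (powers 1ℚ 1 3 5 7 n)
  where
  collect : ∀ f x₁ x₂ x₃ x₄ x₅ x₆ x₇ x₈ →
    f * (1ℚ * x₁ + (0ℚ * x₂ + (1ℚ * x₃ + (0ℚ * x₄ + ((- 1ℚ) * x₅ + (0ℚ * x₆ + ((- 1ℚ) * x₇ + (0ℚ * x₈ + 0ℚ))))))))
    ≡ (f * x₁ + 1ℚ * (f * x₃)) - (f * x₅ + 1ℚ * (f * x₇))
  collect = solve-∀ ℚring

twistedExp-12,1 : ∀ n → fromℕ (n !) * twistedExp χ₁₂,₁ n
  ≡ (fromℕ 1 ^ n + (- 1ℚ) * fromℕ 5 ^ n) - (fromℕ 7 ^ n + (- 1ℚ) * fromℕ 11 ^ n)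
twistedExp-12,1 n = trans
  (collect (fromℕ (n !)) (exp 1 n) (exp 2 n) (exp 3 n) (exp 4 n) (exp 5 n) (exp 6 n)
    (exp 7 n) (exp 8 n) (exp 9 n) (exp 10 n) (exp 11 n) (exp 12 n))
  (powers (- 1ℚ) 1 5 7 11 n)
  where
  collect : ∀ f x₁ x₂ x₃ x₄ x₅ x₆ x₇ x₈ x₉ x₁₀ x₁₁ x₁₂ →
    f * (1ℚ * x₁ + (0ℚ * x₂ + (0ℚ * x₃ + (0ℚ * x₄ + ((- 1ℚ) * x₅ + (0ℚ * x₆ + ((- 1ℚ) * x₇ + (0ℚ * x₈
      + (0ℚ * x₉ + (0ℚ * x₁₀ + (1ℚ * x₁₁ + (0ℚ * x₁₂ + 0ℚ))))))))))))
    ≡ (f * x₁ + (- 1ℚ) * (f * x₅)) - (f * x₇ + (- 1ℚ) * (f * x₁₁))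
  collect = solve-∀ ℚring

twistedExp-12,2 : ∀ n → fromℕ (n !) * twistedExp χ₁₂,₂ n
  ≡ (fromℕ 1 ^ n + 1ℚ * fromℕ 5 ^ n) - (fromℕ 7 ^ n + 1ℚ * fromℕ 11 ^ n)
twistedExp-12,2 n = trans
  (collect (fromℕ (n !)) (exp 1 n) (exp 2 n) (exp 3 n) (exp 4 n) (exp 5 n) (exp 6 n)
    (exp 7 n) (exp 8 n) (exp 9 n) (exp 10 n) (exp 11 n) (exp 12 n))
  (powers 1ℚ 1 5 7 11 n)
  where
  collect : ∀ f x₁ x₂ x₃ x₄ x₅ x₆ x₇ x₈ x₉ x₁₀ x₁₁ x₁₂ →
    f * (1ℚ * x₁ + (0ℚ * x₂ + (0ℚ * x₃ + (0ℚ * x₄ + (1ℚ * x₅ + (0ℚ * x₆ + ((- 1ℚ) * x₇ + (0ℚ * x₈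
      + (0ℚ * x₉ + (0ℚ * x₁₀ + ((- 1ℚ) * x₁₁ + (0ℚ * x₁₂ + 0ℚ))))))))))))
    ≡ (f * x₁ + 1ℚ * (f * x₅)) - (f * x₇ + 1ℚ * (f * x₁₁))
  collect = solve-∀ ℚring

module Hankel {N} (h q̃ q⁻¹ : ℚ) (h≡1+s : h ≡ 1ℚ + q̃ * h) (q⁻¹q≡1 : q⁻¹ * (h + h) ≡ 1ℚ)
  (N≡2q : fromℕ N ≡ (h + h) + (h + h)) (χ : DirichletCharacter N) (total≡0 : twistedExp χ 0 ≡ 0ℚ) where
  open Moments χ total≡0 using (moment; τ-moment; shiftedBernoulli-τ)

  private
    Q = h + h
    s = q̃ * h

  module _ (e : ℚ) (e²≡1 : e * e ≡ 1ℚ) (twisted : ∀ n → fromℕ (n !) * twistedExp χ n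
    ≡ (1ℚ ^ n + e * (h + s) ^ n) - ((Q + 1ℚ) ^ n + e * (Q + (h + s)) ^ n)) where
    open FromCharacterSum h s e q⁻¹ h≡1+s q⁻¹q≡1 public

    moment-solves : Solves h ν moment
    moment-solves = solves moment λ n → begin
      τ (Q + Q) moment n                              ≡⟨ cong (λ a → τ a moment n) N≡2q ⟨
      τ (fromℕ N) moment n                            ≡⟨ τ-moment n ⟩
      moment n + fromℕ (n !) * twistedExp χ n         ≡⟨ cong (_+_ (moment n)) (twisted n) ⟩
      moment n + (w n - ((Q + 1ℚ) ^ n + e * (Q + (h + s)) ^ n))
                                                      ≡⟨ cong (λ y → moment n + (w n - y)) (τ-w Q n) ⟨
      moment n + (w n - τ Q w n)                      ∎

    moment-parity : ∀ n → alternate moment n ≡ e * moment n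
    moment-parity = Solves-parity {h} {e} (ν-parity e²≡1) moment-solves

  -- The functional equation at index 1, where the contributions ±h of `moment 0` cancel.
  moment₁≡s : (∀ n → fromℕ (n !) * twistedExp χ n
      ≡ (1ℚ ^ n + (- 1ℚ) * (h + s) ^ n) - ((Q + 1ℚ) ^ n + (- 1ℚ) * (Q + (h + s)) ^ n)) → moment 1 ≡ s
  moment₁≡s twisted = x+x≡y+y⇒x≡y (moment 1) s (begin
    moment 1 + moment 1
      ≡⟨ cancel (moment 1) h (moment 0) ⟩
    (moment 1 + h * moment 0) + (moment 1 + (- h) * moment 0)
      ≡⟨ moment-solves (- 1ℚ) refl twisted 1 ⟩
    - ((- s) * 1ℚ + (- 1ℚ) * (s * 1ℚ))
      ≡⟨ evaluate s ⟩
    s + s ∎)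
    where
    cancel : ∀ x h y → x + x ≡ (x + h * y) + (x + (- h) * y)
    cancel = solve-∀ ℚring
    evaluate : ∀ s → - ((- s) * 1ℚ + (- 1ℚ) * (s * 1ℚ)) ≡ s + s
    evaluate = solve-∀ ℚring

  module _ {c ℓ} (R : CommutativeRing c ℓ) (ι : ℚ → CommutativeRing.Carrier R)
    (ι-hom : IsRingHomomorphism +-*-rawRing (CommutativeRing.rawRing R) ι) (x : CommutativeRing.Carrier R) where
    module R = CommutativeRing R
    open R using (_≈_; 0#)
    open IsRingHomomorphism ι-hom using (0#-homo) renaming (⟦⟧-cong to ι-cong)

    hankel-b₁ : (∀ n → fromℕ (n !) * twistedExp χ n
        ≡ (1ℚ ^ n + (- 1ℚ) * (h + s) ^ n) - ((Q + 1ℚ) ^ n + (- 1ℚ) * (Q + (h + s)) ^ n)) → ∀ m →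
      (hankel R (2 ℕ.* m) (shiftedBernoulli R ι χ x) ≈ 0#)
      × (hankel R (2 ℕ.* m ℕ.+ 1) (shiftedBernoulli R ι χ x) ≈ ι (formula₁ s Q q̃ m))
    hankel-b₁ twisted m =
      R.trans (hankel-even _ (shiftedBernoulli-τ R ι ι-hom x) m)
        (R.trans (ι-cong (trans (cong (∏block m *_) (F-diagonal m)) (ℚ.*-zeroʳ (∏block m)))) 0#-homo) ,
      R.trans (hankel-odd _ (shiftedBernoulli-τ R ι ι-hom x) m) (ι-cong (∏block-closed m))
      where
      open SinhForms h q̃ moment (ν (- 1ℚ) refl twisted) (moment-solves (- 1ℚ) refl twisted)
        (ν-shift (- 1ℚ) refl twisted) (moment-parity (- 1ℚ) refl twisted)
        (moment₁≡s twisted)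
        using (tower; F-diagonal; ∏block-closed)
      open Tower tower using (∏block)
      open Transfer R ι ι-hom x tower using (hankel-even; hankel-odd)

    hankel-b₂ : (∀ n → fromℕ (n !) * twistedExp χ n
        ≡ (1ℚ ^ n + 1ℚ * (h + s) ^ n) - ((Q + 1ℚ) ^ n + 1ℚ * (Q + (h + s)) ^ n)) → ∀ m →
      (hankel R (2 ℕ.* m) (shiftedBernoulli R ι χ x) ≈ ι (formula₂ Q q̃ m))
      × (hankel R (2 ℕ.* m ℕ.+ 1) (shiftedBernoulli R ι χ x) ≈ ι (formula₃ Q q̃ m))
    hankel-b₂ twisted m =
      R.trans (hankel-even _ (shiftedBernoulli-τ R ι ι-hom x) m) (ι-cong (∏block-lead-closed m)) ,
      R.trans (hankel-odd _ (shiftedBernoulli-τ R ι ι-hom x) m) (ι-cong (∏block-closed m))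
      where
      open CoshForms h q̃ moment (ν 1ℚ refl twisted) (moment-solves 1ℚ refl twisted)
        (ν-shift 1ℚ refl twisted) (moment-parity 1ℚ refl twisted)
        -- At index 0 the functional equation reads 2 `moment 0` = -2.
        (x+x≡y+y⇒x≡y (moment 0) (- 1ℚ) (moment-solves 1ℚ refl twisted 0))
        using (tower; ∏block-lead-closed; ∏block-closed)
      open Transfer R ι ι-hom x tower using (hankel-even; hankel-odd)

corollary4p4 :
    ∀ {c ℓ} (R : CommutativeRing c ℓ) →
    let _≈_ = CommutativeRing._≈_ R
        0#  = CommutativeRing.0# R
    in
    (ι : ℚ → CommutativeRing.Carrier R) →
    IsRingHomomorphism +-*-rawRing (CommutativeRing.rawRing R) ι →
    (x : CommutativeRing.Carrier R) →
    (q : ℕ) .{{_ : ℕ.NonZero q}} (q≡4⊎q≡6 : q ≡ 4 ⊎ q ≡ 6) →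
    let Q  = fromℕ q
        q̃  = (+ q ℤ.- + 2) / q
        b₁ = shiftedBernoulli R ι (χ₂q,₁ q≡4⊎q≡6) x
        b₂ = shiftedBernoulli R ι (χ₂q,₂ q≡4⊎q≡6) x
    in
    (m : ℕ) →
      (hankel R (2 ℕ.* m) b₁ ≈ 0#)
    × (hankel R (2 ℕ.* m ℕ.+ 1) b₁ ≈ ι
        ( (- 1ℚ) ^ (m ℕ.+ 1)
        * ((+ q ℤ.- + 2) / 2 * Q ^ (2 ℕ.* m)) ^ (2 ℕ.* m ℕ.+ 2)
        * (∏[ ℓ ∈ 1 ⋯ m ] ((fromℕ ℓ ^ 2 * (+ 1 / 4) * (q̃ ^ 2 - fromℕ (2 ℕ.* ℓ) ^ 2)) ^ (2 ℕ.* (m ℕ.+ 1 ℕ.∸ ℓ))))))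
    × (hankel R (2 ℕ.* m) b₂ ≈ ι
        ( (- 1ℚ) ^ (m ℕ.+ 1)
        * (Q ^ (2 ℕ.* m ℕ.* (2 ℕ.* m ℕ.+ 1)) * (1/! m) ^ 2)
        * (∏[ ℓ ∈ 1 ⋯ m ] ((fromℕ ℓ ^ 2 * (+ 1 / 4) * (q̃ ^ 2 - (fromℕ (2 ℕ.* ℓ) - 1ℚ) ^ 2)) ^ (2 ℕ.* (m ℕ.+ 1 ℕ.∸ ℓ))))))
    × (hankel R (2 ℕ.* m ℕ.+ 1) b₂ ≈ ι
        ( ((+ 1 / 2) * Q ^ (2 ℕ.* m ℕ.+ 1)) ^ (2 ℕ.* m ℕ.+ 2)
        * (∏[ ℓ ∈ 0 ⋯ m ] (fromℕ (ℓ !) ^ 4 * (+ 1 / 16) ^ ℓ * (q̃ ^ 2 - fromℕ (2 ℕ.* ℓ ℕ.+ 1) ^ 2) ^ (2 ℕ.* (m ℕ.∸ ℓ) ℕ.+ 1)))))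
corollary4p4 R ι ι-hom x q (inj₁ refl) m =
  -- With h = q/2, the numerical conditions h = 1 + q̃ h, q⁻¹ · 2h = 1, N = 4h and the vanishing of
  -- the character sum all hold by evaluation.
  let b₁-even , b₁-odd = Hankel.hankel-b₁ (fromℕ 2) ((+ 4 ℤ.- + 2) / 4) (+ 1 / 4) refl refl refl χ₈,₁ refl
        R ι ι-hom x twistedExp-8,1 m
      b₂-even , b₂-odd = Hankel.hankel-b₂ (fromℕ 2) ((+ 4 ℤ.- + 2) / 4) (+ 1 / 4) refl refl refl χ₈,₂ refl
        R ι ι-hom x twistedExp-8,2 m
  in b₁-even , b₁-odd , b₂-even , b₂-odd
corollary4p4 R ι ι-hom x q (inj₂ refl) m =
  let b₁-even , b₁-odd = Hankel.hankel-b₁ (fromℕ 3) ((+ 6 ℤ.- + 2) / 6) (+ 1 / 6) refl refl refl χ₁₂,₁ refl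
        R ι ι-hom x twistedExp-12,1 m
      b₂-even , b₂-odd = Hankel.hankel-b₂ (fromℕ 3) ((+ 6 ℤ.- + 2) / 6) (+ 1 / 6) refl refl refl χ₁₂,₂ refl
        R ι ι-hom x twistedExp-12,2 m
  in b₁-even , b₁-odd , b₂-even , b₂-odd
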